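{- There exists a bivariate polynomial $f$ such that for all positive integers $n,N,k$ and all $A\in\mathcal{S}(n,N)$, the hafnian of $A$ modulo $2^k$, denoted $\operatorname{haf}_{2^k}A$, can be computed (by a single deterministic algorithm taking $A$ and $k$ as input) in $O(f(n,N)^k)$ time.
   Context: The hafnian of a $2n\times 2n$ symmetric matrix $A=(a_{ij})$ is $\operatorname{haf}A:=\sum_{M\in\mathcal{M}}\prod_{ij\in M}a_{ij}$, where $\mathcal{M}$ is the set of all partitions of $\{1,2,\dots,2n\}$ into $n$ (unordered) pairs, and $ij$ denotes the unordered pair $\{i,j\}$. $\mathcal{S}(n,N)$ denotes the set of all $2n\times 2n$ symmetric matrices with zero diagonal each of whose entries is a univariate polynomial (in an indeterminate $x$, with integer coefficients) of degree at most $N$. $\operatorname{haf}_{2^k}A$ is the polynomial $\operatorname{haf}A$ with its coefficients reduced modulo $2^k$. Running time is counted in arithmetic operations on coefficients. -}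

module Defs where

open import Data.Empty using (⊥-elim)
open import Data.Fin.Base using (Fin)
open import Data.Fin.Properties using (all?) renaming (_≟_ to _≟ᶠ_; _<?_ to _<?ᶠ_)
open import Data.Integer.Base using (ℤ; +_; 0ℤ; 1ℤ; -_)
import Data.Integer.Base as ℤ
open import Data.List.Base
  using (List; []; _∷_; _++_; map; foldr; filter; length; tabulate; allFin; cartesianProduct)
open import Data.List.Membership.Propositional using (_∈_)
open import Data.List.Relation.Unary.All using (All; []; _∷_; lookup)
open import Data.Nat.Base using (ℕ; zero; suc; _+_; _*_; _^_)
open import Data.Nat.Properties using (m^n≢0) renaming (_≟_ to _≟ⁿ_)
open import Data.Product.Base using (_×_; _,_; proj₁; proj₂)
open import Data.Sum.Base using (_⊎_)
open import Data.Vec.Base as Vec using (Vec)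
open import Relation.Binary.PropositionalEquality using (_≡_; _≢_; refl)
open import Relation.Nullary.Decidable using (_⊎-dec_)
open import Relation.Unary using (Decidable)

------------------------------------------------------------------------
-- Polynomials over ℤ

-- Coefficients with the constant term first; trailing zeros are allowed, so
-- two lists denote the same polynomial when they are related by _≈ᵖ_.
Poly : Set
Poly = List ℤ

coeff : Poly → ℕ → ℤ
coeff []      _       = 0ℤ
coeff (a ∷ p) zero    = a
coeff (a ∷ p) (suc i) = coeff p i

infix 4 _≈ᵖ_
_≈ᵖ_ : Poly → Poly → Set
p ≈ᵖ q = ∀ i → coeff p i ≡ coeff q i

infixl 6 _+ᵖ_
_+ᵖ_ : Poly → Poly → Poly
[]      +ᵖ q       = q
(a ∷ p) +ᵖ []      = a ∷ p
(a ∷ p) +ᵖ (b ∷ q) = (a ℤ.+ b) ∷ (p +ᵖ q)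

infixl 7 _*ᵖ_
_*ᵖ_ : Poly → Poly → Poly
[]      *ᵖ q = []
(a ∷ p) *ᵖ q = map (a ℤ.*_) q +ᵖ (0ℤ ∷ (p *ᵖ q))

sumᵖ productᵖ : List Poly → Poly
sumᵖ     = foldr _+ᵖ_ []
productᵖ = foldr _*ᵖ_ (1ℤ ∷ [])

evalᵖ : Poly → ℤ → ℤ
evalᵖ p x = foldr (λ a r → a ℤ.+ x ℤ.* r) 0ℤ p

-- A polynomial in X whose coefficients are polynomials in Y.
Poly₂ : Set
Poly₂ = List Poly

evalᵖ₂ : Poly₂ → ℤ → ℤ → ℤ
evalᵖ₂ f x y = evalᵖ (map (λ q → evalᵖ q y) f) x

------------------------------------------------------------------------
-- The matrices 𝒮(n,N)

-- A polynomial of degree at most N is given by its N + 1 coefficients, so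
-- propositional equality of entries is equality of polynomials.
record 𝒮 (n N : ℕ) : Set where
  field
    entry        : Fin (2 * n) → Fin (2 * n) → Vec ℤ (suc N)
    symmetric    : ∀ i j → entry i j ≡ entry j i
    zeroDiagonal : ∀ i → entry i i ≡ Vec.replicate (suc N) 0ℤ

  poly : Fin (2 * n) → Fin (2 * n) → Poly
  poly i j = Vec.toList (entry i j)

------------------------------------------------------------------------
-- Hafnian

-- The unordered pair {i , j} with i ≠ j is listed once, as (i , j) with i < j.
pairs : ∀ m → List (Fin m × Fin m)
pairs m = filter (λ p → proj₁ p <?ᶠ proj₂ p) (cartesianProduct (allFin m) (allFin m))

_isEndOf_ : ∀ {m} → Fin m → Fin m × Fin m → Set
v isEndOf (i , j) = v ≡ i ⊎ v ≡ j

_isEndOf?_ : ∀ {m} (v : Fin m) → Decidable (v isEndOf_)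
v isEndOf? (i , j) = (v ≟ᶠ i) ⊎-dec (v ≟ᶠ j)

-- Every element lies in exactly one of the pairs.
IsPartition : ∀ {m} → List (Fin m × Fin m) → Set
IsPartition M = ∀ v → length (filter (v isEndOf?_) M) ≡ 1

isPartition? : ∀ {m} → Decidable (IsPartition {m})
isPartition? M = all? (λ v → length (filter (v isEndOf?_) M) ≟ⁿ 1)

-- All subsets of a duplicate-free list, each exactly once.
sublists : ∀ {A : Set} → List A → List (List A)
sublists []       = [] ∷ []
sublists (x ∷ xs) = sublists xs ++ map (x ∷_) (sublists xs)

matchings : ∀ m → List (List (Fin m × Fin m))
matchings m = filter isPartition? (sublists (pairs m))

haf : ∀ {n N} → 𝒮 n N → Poly
haf {n} A = sumᵖ (map (λ M → productᵖ (map weight M)) (matchings (2 * n)))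
  where
  weight : Fin (2 * n) × Fin (2 * n) → Poly
  weight (i , j) = 𝒮.poly A i j

-- The remainder in {0, …, 2^k - 1}.
_mod2^_ : ℤ → ℕ → ℤ
c mod2^ k = + (ℤ._%ℕ_ c (2 ^ k) {{m^n≢0 2 k}})

haf₂^ : ∀ {n N} → ℕ → 𝒮 n N → Poly
haf₂^ k A = map (_mod2^ k) (haf A)

------------------------------------------------------------------------
-- Model of computation
--
-- A deterministic call-by-value functional language with recursion.  The
-- running time is the number of evaluation rules applied, so control flow,
-- variable access and data handling are charged along with the arithmetic on
-- coefficients; it is polynomially related to time on a RAM.
--
-- Coefficients are integers with unit-cost operations, but the only ones
-- available are +, -, *, reduction modulo 2^j and the test for 0.  There is
-- no order test and no quotient, and j is a natural number, which a program
-- can only count up to in unary; this excludes speed-ups obtained by packing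
-- much data into one large integer.

infixr 7 _⇒_
infixr 8 _⊗_

data Ty : Set where
  nat int : Ty
  list    : Ty → Ty
  _⊗_ _⇒_ : Ty → Ty → Ty

Cx : Set
Cx = List Ty

data Tm (Γ : Cx) : Ty → Set where
  var     : ∀ {τ} → τ ∈ Γ → Tm Γ τ
  let′    : ∀ {σ τ} → Tm Γ σ → Tm (σ ∷ Γ) τ → Tm Γ τ
  -- The body refers to the argument (first variable) and to the function
  -- itself (second variable).
  fun     : ∀ {σ τ} → Tm (σ ∷ (σ ⇒ τ) ∷ Γ) τ → Tm Γ (σ ⇒ τ)
  app     : ∀ {σ τ} → Tm Γ (σ ⇒ τ) → Tm Γ σ → Tm Γ τ
  pair    : ∀ {σ τ} → Tm Γ σ → Tm Γ τ → Tm Γ (σ ⊗ τ)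
  fst     : ∀ {σ τ} → Tm Γ (σ ⊗ τ) → Tm Γ σ
  snd     : ∀ {σ τ} → Tm Γ (σ ⊗ τ) → Tm Γ τ
  nil     : ∀ {τ} → Tm Γ (list τ)
  cons    : ∀ {τ} → Tm Γ τ → Tm Γ (list τ) → Tm Γ (list τ)
  caseL   : ∀ {σ τ} → Tm Γ (list σ) → Tm Γ τ → Tm (σ ∷ list σ ∷ Γ) τ → Tm Γ τ
  ze      : Tm Γ nat
  su      : Tm Γ nat → Tm Γ nat
  caseN   : ∀ {τ} → Tm Γ nat → Tm Γ τ → Tm (nat ∷ Γ) τ → Tm Γ τ
  lit     : ℤ → Tm Γ int
  add mul : Tm Γ int → Tm Γ int → Tm Γ int
  neg     : Tm Γ int → Tm Γ int
  reduce  : Tm Γ int → Tm Γ nat → Tm Γ int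
  ifZero  : ∀ {τ} → Tm Γ int → Tm Γ τ → Tm Γ τ → Tm Γ τ

data Val : Ty → Set where
  natᵛ  : ℕ → Val nat
  intᵛ  : ℤ → Val int
  listᵛ : ∀ {τ} → List (Val τ) → Val (list τ)
  pairᵛ : ∀ {σ τ} → Val σ → Val τ → Val (σ ⊗ τ)
  closᵛ : ∀ {Γ σ τ} → All Val Γ → Tm (σ ∷ (σ ⇒ τ) ∷ Γ) τ → Val (σ ⇒ τ)

Env : Cx → Set
Env = All Val

-- ρ ⊢ e ⇓ v [ t ]: in environment ρ, e evaluates to v in time t.
infix 3 _⊢_⇓_[_]
data _⊢_⇓_[_] {Γ : Cx} (ρ : Env Γ) : ∀ {τ} → Tm Γ τ → Val τ → ℕ → Set where

  ⇓var : ∀ {τ} {x : τ ∈ Γ} → ρ ⊢ var x ⇓ lookup ρ x [ 1 ]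

  ⇓let : ∀ {σ τ} {d : Tm Γ σ} {e : Tm (σ ∷ Γ) τ} {u v s t} →
         ρ ⊢ d ⇓ u [ s ] → (u ∷ ρ) ⊢ e ⇓ v [ t ] →
         ρ ⊢ let′ d e ⇓ v [ 1 + s + t ]

  ⇓fun : ∀ {σ τ} {b : Tm (σ ∷ (σ ⇒ τ) ∷ Γ) τ} → ρ ⊢ fun b ⇓ closᵛ ρ b [ 1 ]

  ⇓app : ∀ {Δ σ τ} {d : Tm Γ (σ ⇒ τ)} {e : Tm Γ σ} {ρ′ : Env Δ} {b u v r s t} →
         ρ ⊢ d ⇓ closᵛ ρ′ b [ r ] → ρ ⊢ e ⇓ u [ s ] →
         (u ∷ closᵛ ρ′ b ∷ ρ′) ⊢ b ⇓ v [ t ] →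
         ρ ⊢ app d e ⇓ v [ 1 + r + s + t ]

  ⇓pair : ∀ {σ τ} {d : Tm Γ σ} {e : Tm Γ τ} {u v s t} →
          ρ ⊢ d ⇓ u [ s ] → ρ ⊢ e ⇓ v [ t ] →
          ρ ⊢ pair d e ⇓ pairᵛ u v [ 1 + s + t ]

  ⇓fst : ∀ {σ τ} {e : Tm Γ (σ ⊗ τ)} {u v t} →
         ρ ⊢ e ⇓ pairᵛ u v [ t ] → ρ ⊢ fst e ⇓ u [ 1 + t ]

  ⇓snd : ∀ {σ τ} {e : Tm Γ (σ ⊗ τ)} {u v t} →
         ρ ⊢ e ⇓ pairᵛ u v [ t ] → ρ ⊢ snd e ⇓ v [ 1 + t ]

  ⇓nil : ∀ {τ} → ρ ⊢ nil {τ = τ} ⇓ listᵛ [] [ 1 ]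

  ⇓cons : ∀ {τ} {d : Tm Γ τ} {e : Tm Γ (list τ)} {u vs s t} →
          ρ ⊢ d ⇓ u [ s ] → ρ ⊢ e ⇓ listᵛ vs [ t ] →
          ρ ⊢ cons d e ⇓ listᵛ (u ∷ vs) [ 1 + s + t ]

  ⇓caseL-[] : ∀ {σ τ} {c : Tm Γ (list σ)} {d : Tm Γ τ} {e v s t} →
              ρ ⊢ c ⇓ listᵛ [] [ s ] → ρ ⊢ d ⇓ v [ t ] →
              ρ ⊢ caseL c d e ⇓ v [ 1 + s + t ]

  ⇓caseL-∷ : ∀ {σ τ} {c : Tm Γ (list σ)} {d : Tm Γ τ} {e u us v s t} →
             ρ ⊢ c ⇓ listᵛ (u ∷ us) [ s ] → (u ∷ listᵛ us ∷ ρ) ⊢ e ⇓ v [ t ] →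
             ρ ⊢ caseL c d e ⇓ v [ 1 + s + t ]

  ⇓ze : ρ ⊢ ze ⇓ natᵛ 0 [ 1 ]

  ⇓su : ∀ {e m t} → ρ ⊢ e ⇓ natᵛ m [ t ] → ρ ⊢ su e ⇓ natᵛ (suc m) [ 1 + t ]

  ⇓caseN-ze : ∀ {τ c} {d : Tm Γ τ} {e v s t} →
              ρ ⊢ c ⇓ natᵛ 0 [ s ] → ρ ⊢ d ⇓ v [ t ] →
              ρ ⊢ caseN c d e ⇓ v [ 1 + s + t ]

  ⇓caseN-su : ∀ {τ c} {d : Tm Γ τ} {e m v s t} →
              ρ ⊢ c ⇓ natᵛ (suc m) [ s ] → (natᵛ m ∷ ρ) ⊢ e ⇓ v [ t ] →
              ρ ⊢ caseN c d e ⇓ v [ 1 + s + t ]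

  ⇓lit : ∀ {a} → ρ ⊢ lit a ⇓ intᵛ a [ 1 ]

  ⇓add : ∀ {d e a b s t} → ρ ⊢ d ⇓ intᵛ a [ s ] → ρ ⊢ e ⇓ intᵛ b [ t ] →
         ρ ⊢ add d e ⇓ intᵛ (a ℤ.+ b) [ 1 + s + t ]

  ⇓mul : ∀ {d e a b s t} → ρ ⊢ d ⇓ intᵛ a [ s ] → ρ ⊢ e ⇓ intᵛ b [ t ] →
         ρ ⊢ mul d e ⇓ intᵛ (a ℤ.* b) [ 1 + s + t ]

  ⇓neg : ∀ {e a t} → ρ ⊢ e ⇓ intᵛ a [ t ] → ρ ⊢ neg e ⇓ intᵛ (- a) [ 1 + t ]

  ⇓reduce : ∀ {d e a j s t} → ρ ⊢ d ⇓ intᵛ a [ s ] → ρ ⊢ e ⇓ natᵛ j [ t ] →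
            ρ ⊢ reduce d e ⇓ intᵛ (a mod2^ j) [ 1 + s + t ]

  ⇓ifZero-yes : ∀ {τ c} {d e : Tm Γ τ} {v s t} →
                ρ ⊢ c ⇓ intᵛ 0ℤ [ s ] → ρ ⊢ d ⇓ v [ t ] →
                ρ ⊢ ifZero c d e ⇓ v [ 1 + s + t ]

  ⇓ifZero-no : ∀ {τ c} {d e : Tm Γ τ} {a v s t} →
               ρ ⊢ c ⇓ intᵛ a [ s ] → a ≢ 0ℤ → ρ ⊢ e ⇓ v [ t ] →
               ρ ⊢ ifZero c d e ⇓ v [ 1 + s + t ]

⇓-deterministic : ∀ {Γ τ} {ρ : Env Γ} {e : Tm Γ τ} {v v′ t t′} →
                  ρ ⊢ e ⇓ v [ t ] → ρ ⊢ e ⇓ v′ [ t′ ] → v ≡ v′ × t ≡ t′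
⇓-deterministic ⇓var ⇓var = refl , refl
⇓-deterministic (⇓let p q) (⇓let p′ q′)
  with refl , refl ← ⇓-deterministic p p′
  with refl , refl ← ⇓-deterministic q q′ = refl , refl
⇓-deterministic ⇓fun ⇓fun = refl , refl
⇓-deterministic (⇓app p q r) (⇓app p′ q′ r′)
  with refl , refl ← ⇓-deterministic p p′
  with refl , refl ← ⇓-deterministic q q′
  with refl , refl ← ⇓-deterministic r r′ = refl , refl
⇓-deterministic (⇓pair p q) (⇓pair p′ q′)
  with refl , refl ← ⇓-deterministic p p′
  with refl , refl ← ⇓-deterministic q q′ = refl , refl
⇓-deterministic (⇓fst p) (⇓fst p′)
  with refl , refl ← ⇓-deterministic p p′ = refl , refl
⇓-deterministic (⇓snd p) (⇓snd p′)
  with refl , refl ← ⇓-deterministic p p′ = refl , refl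
⇓-deterministic ⇓nil ⇓nil = refl , refl
⇓-deterministic (⇓cons p q) (⇓cons p′ q′)
  with refl , refl ← ⇓-deterministic p p′
  with refl , refl ← ⇓-deterministic q q′ = refl , refl
⇓-deterministic (⇓caseL-[] p q) (⇓caseL-[] p′ q′)
  with refl , refl ← ⇓-deterministic p p′
  with refl , refl ← ⇓-deterministic q q′ = refl , refl
⇓-deterministic (⇓caseL-[] p q) (⇓caseL-∷ p′ q′)
  with () , _ ← ⇓-deterministic p p′
⇓-deterministic (⇓caseL-∷ p q) (⇓caseL-[] p′ q′)
  with () , _ ← ⇓-deterministic p p′
⇓-deterministic (⇓caseL-∷ p q) (⇓caseL-∷ p′ q′)
  with refl , refl ← ⇓-deterministic p p′
  with refl , refl ← ⇓-deterministic q q′ = refl , refl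
⇓-deterministic ⇓ze ⇓ze = refl , refl
⇓-deterministic (⇓su p) (⇓su p′)
  with refl , refl ← ⇓-deterministic p p′ = refl , refl
⇓-deterministic (⇓caseN-ze p q) (⇓caseN-ze p′ q′)
  with refl , refl ← ⇓-deterministic p p′
  with refl , refl ← ⇓-deterministic q q′ = refl , refl
⇓-deterministic (⇓caseN-ze p q) (⇓caseN-su p′ q′)
  with () , _ ← ⇓-deterministic p p′
⇓-deterministic (⇓caseN-su p q) (⇓caseN-ze p′ q′)
  with () , _ ← ⇓-deterministic p p′
⇓-deterministic (⇓caseN-su p q) (⇓caseN-su p′ q′)
  with refl , refl ← ⇓-deterministic p p′
  with refl , refl ← ⇓-deterministic q q′ = refl , refl
⇓-deterministic ⇓lit ⇓lit = refl , refl
⇓-deterministic (⇓add p q) (⇓add p′ q′)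
  with refl , refl ← ⇓-deterministic p p′
  with refl , refl ← ⇓-deterministic q q′ = refl , refl
⇓-deterministic (⇓mul p q) (⇓mul p′ q′)
  with refl , refl ← ⇓-deterministic p p′
  with refl , refl ← ⇓-deterministic q q′ = refl , refl
⇓-deterministic (⇓neg p) (⇓neg p′)
  with refl , refl ← ⇓-deterministic p p′ = refl , refl
⇓-deterministic (⇓reduce p q) (⇓reduce p′ q′)
  with refl , refl ← ⇓-deterministic p p′
  with refl , refl ← ⇓-deterministic q q′ = refl , refl
⇓-deterministic (⇓ifZero-yes p q) (⇓ifZero-yes p′ q′)
  with refl , refl ← ⇓-deterministic p p′
  with refl , refl ← ⇓-deterministic q q′ = refl , refl
⇓-deterministic (⇓ifZero-yes p q) (⇓ifZero-no p′ a≢0 q′)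
  with refl , refl ← ⇓-deterministic p p′ = ⊥-elim (a≢0 refl)
⇓-deterministic (⇓ifZero-no p a≢0 q) (⇓ifZero-yes p′ q′)
  with refl , refl ← ⇓-deterministic p p′ = ⊥-elim (a≢0 refl)
⇓-deterministic (⇓ifZero-no p _ q) (⇓ifZero-no p′ _ q′)
  with refl , refl ← ⇓-deterministic p p′
  with refl , refl ← ⇓-deterministic q q′ = refl , refl

------------------------------------------------------------------------
-- Algorithms on polynomial matrices

polyTy matrixTy : Ty
polyTy   = list int
matrixTy = list (list polyTy)

polyᵛ : Poly → Val polyTy
polyᵛ p = listᵛ (map intᵛ p)

matrixᵛ : ∀ {n N} → 𝒮 n N → Val matrixTy
matrixᵛ A = listᵛ (tabulate λ i → listᵛ (tabulate λ j → polyᵛ (𝒮.poly A i j)))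

-- The two free variables are the inputs: a matrix and the exponent k.
Algorithm : Set
Algorithm = Tm (matrixTy ∷ nat ∷ []) polyTy

record RunsIn (P : Algorithm) {n N} (A : 𝒮 n N) (k : ℕ) (p : Poly) (t : ℕ) : Set where
  constructor runsIn
  field run : (matrixᵛ A ∷ natᵛ k ∷ []) ⊢ P ⇓ polyᵛ p [ t ]

{-# OPTIONS --safe #-}

-- The computation takes place in R = ℤ[x]/(xᴰ) with D larger than the degree of the
-- hafnian.  In Λ = R[x₁,…,xₘ]/(x₁²,…,xₘ²) the hafnian is the coefficient of x₁⋯xₘ in
-- E = ∏ (1 + aᵢⱼxᵢxⱼ), and for a matrix with first row r above a matrix T it is the top
-- coefficient of r·E(T), where r is read as a linear form.
--
-- As power series modulo 2, some entry g = rₚ divides all entries of r, so r = gc + e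
-- with cₚ = 1 and e even.  The summand e only needs hafnians modulo 2^(k-1).  For c,
-- write E(T) = (1 + xₚq)E(T⁻), where T⁻ lacks the index p; the coefficient of xₚ in
-- c·E(T) is (1 + c⁻q)E(T⁻).  Now exp(c⁻q)E(T⁻) is again of the form E, and its
-- difference from (1 + c⁻q)E(T⁻) is twice a signed sum of O(m²) elements of the form E,
-- whose hafnians are only needed modulo 2^(k-1).  Hence a hafnian modulo 2^k reduces to
-- one of smaller size modulo 2^k and O(m²) others modulo 2^(k-1), all in polynomial time.

module Submission where

-- Modulo 2 and `xᴰ`, every nonzero series is a power of `x` times a unit, so of any two series one
-- divides the other. This supplies the pivot, and it is why the calculation runs over truncated
-- series: units there have inverses, which polynomials lack. The obstacle is that nothing can be
-- halved, since the model of computation has no quotient. Hence the even row `e` is not divided by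
-- 2 but expanded in unit rows, whose hafnians modulo 2^(k-1) are multiplied by the even entries of
-- `e`. Likewise half of `exp(c⁻q)E(T⁻) - (1 + c⁻q)E(T⁻)` is given outright as a signed list of
-- matrices, and the identity for it is verified in doubled form. Among the recursive calls only the
-- one for the smaller matrix keeps `k`. These calls form a single chain, along which costs add up
-- instead of multiplying. All other calls lower `k`, and there are polynomially many per
-- elimination, so the total is a polynomial to the power `k`.

module SquarefreeAlgebra where

  open import Algebra.Bundles using (CommutativeSemiring)
  open import Algebra.Structures.Biased using (isCommutativeSemiringˡ)
  import Algebra.Solver.Ring.NaturalCoefficients.Default as Solver
  open import Data.Fin.Base using (Fin; zero; suc)
  open import Data.Integer.Base as ℤ using (ℤ; 1ℤ; -1ℤ)
  open import Data.List.Base as List using (List; []; _∷_; _++_)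
  open import Data.Nat.Base using (ℕ; zero; suc)
  open import Data.Product.Base using (_×_; _,_; proj₁; proj₂)
  open import Data.Vec.Base as Vec using (Vec; []; _∷_)
  open import Level using (0ℓ)
  open import Relation.Binary.Structures using (IsEquivalence)

  -- Triangular matrices and the squarefree algebra

  infixr 5 _∷_

  -- Strictly upper triangular matrices, row by row.
  data Tri (A : Set) : ℕ → Set where
    []  : Tri A 0
    _∷_ : ∀ {m} → Vec A m → Tri A m → Tri A (suc m)

  pick : ∀ {A : Set} {m} → Fin (suc m) → Vec A (suc m) → A × Vec A m
  pick         zero    (a ∷ v) = a , v
  pick {m = suc m} (suc p) (a ∷ v) = proj₁ (pick p v) , a ∷ proj₂ (pick p v)

  -- In triangular form the entries that involve index `p` are spread over the earlier rows and row
  -- `p` itself; they are gathered here into one row.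
  pull : ∀ {A : Set} {m} → Fin (suc m) → Tri A (suc m) → Vec A m × Tri A m
  pull         zero    (t ∷ T) = t , T
  pull {m = suc m} (suc p) (t ∷ T) =
    proj₁ (pick p t) ∷ proj₁ (pull p T) , proj₂ (pick p t) ∷ proj₂ (pull p T)

  module Elimination {P : Set} (_⊕_ _⊗_ : P → P → P) (𝟘 𝟙 : P) where

    Row : ℕ → Set
    Row = Vec P

    -- A list of pairs `(s , M)` stands for the sum of the elements `s · E(M)`; the weights that
    -- arise are products of 1 and -1.
    WeightedList : ℕ → Set
    WeightedList m = List (ℤ × Tri P m)

    _·_ : ∀ {m} → P → Row m → Row m
    a · r = Vec.map (a ⊗_) r

    _⊞_ : ∀ {m} → Row m → Row m → Row m
    r ⊞ s = Vec.zipWith _⊕_ r s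

    zeros : ∀ {m} {A : Set} → Vec A m → Row m
    zeros r = Vec.map (λ _ → 𝟘) r

    prepend : ∀ {m} → ℤ → Row m → ℤ × Tri P m → ℤ × Tri P (suc m)
    prepend σ t (s , M) = σ ℤ.* s , t ∷ M

    consAll : ∀ {m} → ℤ → Row m → WeightedList m → WeightedList (suc m)
    consAll σ t L = List.map (prepend σ t) L

    -- x₁u as the difference of 1 + x₁u and 1
    mark : ∀ {m} → Row m → WeightedList m → WeightedList (suc m)
    mark u L = consAll 1ℤ u L ++ consAll -1ℤ (zeros u) L

    -- The divided square q²/2 times E(T)
    quad : ∀ {m} → Row m → Tri P m → WeightedList m
    quad []      []      = []
    quad (a ∷ q) (t ∷ T) = mark (a · q) ((1ℤ , T) ∷ []) ++ consAll 1ℤ t (quad q T)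

    -- The numbers `aqⱼ + bcⱼ` are the coefficients of `x₁xⱼ` in `(ax₁ + c)(bx₁ + q)`; they are
    -- added to the first row `t` of the old matrix.
    newRow : ∀ {m} → P → Row m → P → Row m → Row m → Row m
    newRow a c b q t = ((a · q) ⊞ (b · c)) ⊞ t

    -- Half of (exp(cq) - 1 - cq) E(T)
    cross : ∀ {m} → Row m → Row m → Tri P m → WeightedList m
    cross []      []      []      = []
    cross (a ∷ c) (b ∷ q) (t ∷ T) =
      mark (a · c) (quad q T) ++
      (mark (b · q) (quad c T) ++ consAll 1ℤ (newRow a c b q t) (cross c q T))

    -- exp(cq) E(T), because exp(cq) is the product of all 1 + (cᵢqⱼ + cⱼqᵢ)xᵢxⱼ with i < j
    update : ∀ {m} → Row m → Row m → Tri P m → Tri P m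
    update []      []      []      = []
    update (a ∷ c) (b ∷ q) (t ∷ T) = newRow a c b q t ∷ update c q T

    units : ∀ {m} → Row m → List (P × Row m)
    units []      = []
    units (a ∷ r) = (a , 𝟙 ∷ zeros r) ∷ List.map (λ (b , u) → b , 𝟘 ∷ u) (units r)

  -- Dual numbers `R[x]/(x²)`, with `(a , b)` read as `a + bx`. Only semiring laws are carried
  -- along; subtraction enters later through a weight that acts as -1.
  dual : CommutativeSemiring 0ℓ 0ℓ → CommutativeSemiring 0ℓ 0ℓ
  dual R = record
    { Carrier = Carrier × Carrier
    ; _≈_     = λ (a , b) (c , d) → (a ≈ c) × (b ≈ d)
    ; _+_     = λ (a , b) (c , d) → a + c , b + d
    ; _*_     = λ (a , b) (c , d) → a * c , a * d + b * c
    ; 0#      = 0# , 0#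
    ; 1#      = 1# , 0#
    ; isCommutativeSemiring = isCommutativeSemiringˡ record
      { +-isCommutativeMonoid = record
        { isMonoid = record
          { isSemigroup = record
            { isMagma = record
              { isEquivalence = isEquivalenceᵈ
              ; ∙-cong = λ (p , q) (r , s) → +-cong p r , +-cong q s }
            ; assoc = λ _ _ _ → +-assoc _ _ _ , +-assoc _ _ _ }
          ; identity = (λ _ → +-identityˡ _ , +-identityˡ _)
                     , (λ _ → +-identityʳ _ , +-identityʳ _) }
        ; comm = λ _ _ → +-comm _ _ , +-comm _ _ }
      ; *-isCommutativeMonoid = record
        { isMonoid = record
          { isSemigroup = record
            { isMagma = record
              { isEquivalence = isEquivalenceᵈ
              ; ∙-cong = λ (p , q) (r , s) →
                  *-cong p r , +-cong (*-cong p s) (*-cong q r) }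
            ; assoc = λ (a , b) (c , d) (e , f) → *-assoc a c e ,
                solve 6 (λ a b c d e f → (a :* c) :* f :+ (a :* d :+ b :* c) :* e
                           := a :* (c :* f :+ d :* e) :+ b :* (c :* e))
                      refl a b c d e f }
          ; identity = (λ (a , b) → *-identityˡ a ,
                solve 2 (λ a b → con 1 :* b :+ con 0 :* a := b) refl a b)
                     , (λ (a , b) → *-identityʳ a ,
                solve 2 (λ a b → a :* con 0 :+ b :* con 1 := b) refl a b) }
        ; comm = λ (a , b) (c , d) → *-comm a c ,
            solve 4 (λ a b c d → a :* d :+ b :* c := c :* b :+ d :* a) refl a b c d }
      ; distribʳ = λ (a , b) (c , d) (e , f) → distribʳ a c e ,
          solve 6 (λ a b c d e f → (c :+ e) :* b :+ (d :+ f) :* a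
                     := (c :* b :+ d :* a) :+ (e :* b :+ f :* a))
                refl a b c d e f
      ; zeroˡ = λ (a , b) → zeroˡ a ,
          solve 2 (λ a b → con 0 :* b :+ con 0 :* a := con 0) refl a b
      }
    }
    where
    open CommutativeSemiring R
    open Solver R using (solve; con; _:=_; _:+_; _:*_)
    isEquivalenceᵈ : IsEquivalence (λ ((a , b) (c , d) : Carrier × Carrier) → (a ≈ c) × (b ≈ d))
    isEquivalenceᵈ = record
      { refl  = refl , refl
      ; sym   = λ (p , q) → sym p , sym q
      ; trans = λ (p , q) (r , s) → trans p r , trans q s }

  -- Λ m = S[x₁,…,xₘ]/(x₁²,…,xₘ²); an element a + b x₁ is the pair (a , b).
  module Squarefree (S : CommutativeSemiring 0ℓ 0ℓ) where

    Λ : ℕ → CommutativeSemiring 0ℓ 0ℓ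
    Λ zero    = S
    Λ (suc m) = dual (Λ m)

    private
      module S = CommutativeSemiring S
      module Λ m = CommutativeSemiring (Λ m)

    Scalar : Set
    Scalar = S.Carrier

    ∣Λ∣ : ℕ → Set
    ∣Λ∣ m = Λ.Carrier m

    top : ∀ m → ∣Λ∣ m → Scalar
    top zero    a       = a
    top (suc m) (_ , b) = top m b

    κ : ∀ m → Scalar → ∣Λ∣ m
    κ zero    a = a
    κ (suc m) a = κ m a , Λ.0# m

    top-cong : ∀ m {x y} → Λ._≈_ m x y → top m x S.≈ top m y
    top-cong zero    p       = p
    top-cong (suc m) (_ , p) = top-cong m p

    top-0 : ∀ m → top m (Λ.0# m) S.≈ S.0#
    top-0 zero    = S.refl
    top-0 (suc m) = top-0 m

    top-+ : ∀ m x y → top m (Λ._+_ m x y) S.≈ top m x S.+ top m y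
    top-+ zero    _       _       = S.refl
    top-+ (suc m) (_ , x) (_ , y) = top-+ m x y

    top-κ : ∀ m a x → top m (Λ._*_ m (κ m a) x) S.≈ a S.* top m x
    top-κ zero    a x       = S.refl
    top-κ (suc m) a (x , y) = S.trans
      (top-cong m (let open Λ m in trans (+-congˡ (zeroˡ x)) (+-identityʳ _)))
      (top-κ m a y)

    κ-cong : ∀ m {a b} → a S.≈ b → Λ._≈_ m (κ m a) (κ m b)
    κ-cong zero    p = p
    κ-cong (suc m) p = κ-cong m p , Λ.refl m

    κ-0 : ∀ m → Λ._≈_ m (κ m S.0#) (Λ.0# m)
    κ-0 zero    = S.refl
    κ-0 (suc m) = κ-0 m , Λ.refl m

    κ-1 : ∀ m → Λ._≈_ m (κ m S.1#) (Λ.1# m)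
    κ-1 zero    = S.refl
    κ-1 (suc m) = κ-1 m , Λ.refl m

    κ-+ : ∀ m a b → Λ._≈_ m (κ m (a S.+ b)) (Λ._+_ m (κ m a) (κ m b))
    κ-+ zero    a b = S.refl
    κ-+ (suc m) a b = κ-+ m a b , Λ.sym m (Λ.+-identityˡ m _)

    κ-* : ∀ m a b → Λ._≈_ m (κ m (a S.* b)) (Λ._*_ m (κ m a) (κ m b))
    κ-* zero    a b = S.refl
    κ-* (suc m) a b = κ-* m a b ,
      (let open Λ m in sym (trans (+-cong (zeroʳ _) (zeroˡ _)) (+-identityˡ _)))

    -- σ p moves the variable with index p to the front.
    σ : ∀ {m} → Fin (suc m) → ∣Λ∣ (suc m) → ∣Λ∣ (suc m)
    σ         zero    x       = x
    σ {suc m} (suc p) (a , b) =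
      (proj₁ (σ p a) , proj₁ (σ p b)) , (proj₂ (σ p a) , proj₂ (σ p b))

    σ-0 : ∀ {m} (p : Fin (suc m)) → Λ._≈_ (suc m) (σ p (Λ.0# (suc m))) (Λ.0# (suc m))
    σ-0 {m}     zero    = Λ.refl (suc m)
    σ-0 {suc m} (suc p) =
      let (e₀ , e₁) = σ-0 p in (e₀ , e₀) , (e₁ , e₁)

    σ-+ : ∀ {m} (p : Fin (suc m)) x y →
          Λ._≈_ (suc m) (σ p (Λ._+_ (suc m) x y)) (Λ._+_ (suc m) (σ p x) (σ p y))
    σ-+ {m}     zero    x       y       = Λ.refl (suc m)
    σ-+ {suc m} (suc p) (a , b) (c , d) =
      let (e₀ , e₁) = σ-+ p a c
          (f₀ , f₁) = σ-+ p b d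
      in (e₀ , f₀) , (e₁ , f₁)

    σ-* : ∀ {m} (p : Fin (suc m)) x y →
          Λ._≈_ (suc m) (σ p (Λ._*_ (suc m) x y)) (Λ._*_ (suc m) (σ p x) (σ p y))
    σ-* {m}     zero    x       y       = Λ.refl (suc m)
    σ-* {suc m} (suc p) (a , b) (c , d) =
      let (e₀ , e₁) = σ-* p a c
          (f₀ , f₁) = σ-+ p (Λ._*_ (suc m) a d) (Λ._*_ (suc m) b c)
          (g₀ , g₁) = σ-* p a d
          (h₀ , h₁) = σ-* p b c
          a₀ = proj₁ (σ p a) ; a₁ = proj₂ (σ p a)
          b₀ = proj₁ (σ p b) ; b₁ = proj₂ (σ p b)
          c₀ = proj₁ (σ p c) ; c₁ = proj₂ (σ p c)
          d₀ = proj₁ (σ p d) ; d₁ = proj₂ (σ p d)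
      in (e₀ , trans f₀ (+-cong g₀ h₀)) ,
         (e₁ , trans (trans f₁ (+-cong g₁ h₁))
           (solve 8 (λ a₀ a₁ b₀ b₁ c₀ c₁ d₀ d₁ →
               (a₀ :* d₁ :+ a₁ :* d₀) :+ (b₀ :* c₁ :+ b₁ :* c₀) :=
               (a₀ :* d₁ :+ b₀ :* c₁) :+ (a₁ :* d₀ :+ b₁ :* c₀))
             refl a₀ a₁ b₀ b₁ c₀ c₁ d₀ d₁))
      where
      open Λ m
      open Solver (Λ m) using (solve; _:=_; _:+_; _:*_)

    -- The monomial `x₁⋯xₘ` contains every variable and is therefore fixed by every renaming.
    top-σ : ∀ {m} (p : Fin (suc m)) x → top (suc m) (σ p x) S.≈ top (suc m) x
    top-σ         zero    x       = S.refl
    top-σ {suc m} (suc p) (a , b) = top-σ p b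

    module Expansion
      {P : Set} (⟦_⟧ : P → Scalar) where

      lin : ∀ {m} → Vec P m → ∣Λ∣ m
      lin          []      = S.0#
      lin {suc m} (a ∷ r) = lin r , κ m ⟦ a ⟧

      -- Because `x₁² = 0`, the factors `1 + tⱼx₁xⱼ` that belong to the first row multiply to
      -- `1 + x₁ lin(t)`.
      E : ∀ {m} → Tri P m → ∣Λ∣ m
      E          []      = S.1#
      E {suc m} (t ∷ T) = E T , Λ._*_ m (lin t) (E T)

      haf : ∀ {m} → Tri P m → Scalar
      haf {m} T = top m (E T)

      σ-lin : ∀ {m} (p : Fin (suc m)) (r : Vec P (suc m)) →
              Λ._≈_ (suc m) (σ p (lin r)) (lin (proj₁ (pick p r) ∷ proj₂ (pick p r)))
      σ-lin {m}     zero    (a ∷ r) = Λ.refl (suc m)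
      σ-lin {suc m} (suc p) (a ∷ r) =
        let (e₀ , e₁) = σ-lin p r
            (f₀ , f₁) = σ-κ p ⟦ a ⟧
        in (e₀ , f₀) , (e₁ , f₁)
        where
        σ-κ : ∀ {m} (p : Fin (suc m)) a → Λ._≈_ (suc m) (σ p (κ (suc m) a)) (κ (suc m) a)
        σ-κ {m}     zero    a = Λ.refl (suc m)
        σ-κ {suc m} (suc p) a =
          let (e₀ , e₁) = σ-κ p a
              (f₀ , f₁) = σ-0 p
          in (e₀ , f₀) , (e₁ , f₁)

      -- Index `p` splits off as the factor `1 + xₚq`. In the inductive step the entry between the
      -- first index and `p` moves from the row `t` into `q`, which is why the products agree only
      -- after regrouping.
      σ-E : ∀ {m} (p : Fin (suc m)) (T : Tri P (suc m)) →
            Λ._≈_ (suc m) (σ p (E T)) (E (proj₁ (pull p T) ∷ proj₂ (pull p T)))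
      σ-E {m}     zero    (t ∷ T) = Λ.refl (suc m)
      σ-E {suc m} (suc p) (t ∷ T) =
        let (e₀ , e₁) = σ-E p T
            (f₀ , f₁) = σ-* p (lin t) (E T)
            (g₀ , g₁) = σ-lin p t
            q = lin (proj₁ (pull p T))
            E′ = E (proj₂ (pull p T))
            t⁻ = lin (proj₂ (pick p t))
            tₚ = κ m ⟦ proj₁ (pick p t) ⟧
        in (e₀ , trans f₀ (*-cong g₀ e₀)) ,
           (e₁ , trans f₁ (trans (+-cong (*-cong g₀ e₁) (*-cong g₁ e₀))
             (solve 4 (λ q E t p → t :* (q :* E) :+ p :* E := q :* (t :* E) :+ p :* E)
               refl q E′ t⁻ tₚ)))
        where
        open Λ m
        open Solver (Λ m) using (solve; _:=_; _:+_; _:*_)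

-- Identities between elements of the form E

module ReductionIdentities where

  open import Algebra.Bundles using (CommutativeSemiring)
  import Algebra.Solver.Ring.NaturalCoefficients.Default as Solver
  open import Data.Fin.Base using (Fin; suc)
  open import Data.Integer.Base as ℤ using (ℤ; 1ℤ; -1ℤ)
  open import Data.List.Base as List using (List; []; _∷_; _++_)
  open import Data.Nat.Base using (suc)
  open import Data.Product.Base using (_×_; _,_; proj₁; proj₂)
  open import Data.Vec.Base using (Vec; []; _∷_)
  open import Data.Vec.Relation.Binary.Pointwise.Inductive using ([]; _∷_)
  open import Level using (0ℓ)
  open SquarefreeAlgebra

  -- Lists of coefficients satisfy no ring laws exactly, only after passage to `S`. Of the integers
  -- it suffices that 1 acts as the unit and -1 as additive inverse, which makes differences
  -- expressible in a semiring.
  record Interpretation (S : CommutativeSemiring 0ℓ 0ℓ)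
                        {P : Set} (_⊕_ _⊗_ : P → P → P) (𝟘 𝟙 : P) : Set where
    open CommutativeSemiring S
    field
      ⟦_⟧   : P → Carrier
      ⟨_⟩   : ℤ → Carrier
      ⟦⊕⟧   : ∀ a b → ⟦ a ⊕ b ⟧ ≈ ⟦ a ⟧ + ⟦ b ⟧
      ⟦⊗⟧   : ∀ a b → ⟦ a ⊗ b ⟧ ≈ ⟦ a ⟧ * ⟦ b ⟧
      ⟦𝟘⟧   : ⟦ 𝟘 ⟧ ≈ 0#
      ⟦𝟙⟧   : ⟦ 𝟙 ⟧ ≈ 1#
      ⟨1⟩   : ⟨ 1ℤ ⟩ ≈ 1#
      ⟨1*⟩  : ∀ s → ⟨ 1ℤ ℤ.* s ⟩ ≈ ⟨ s ⟩
      ⟨-1*⟩ : ∀ s → ⟨ -1ℤ ℤ.* s ⟩ + ⟨ s ⟩ ≈ 0#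

  module Reduction
    (S : CommutativeSemiring 0ℓ 0ℓ)
    {P : Set} (_⊕_ _⊗_ : P → P → P) (𝟘 𝟙 : P) (interp : Interpretation S _⊕_ _⊗_ 𝟘 𝟙)
    where

    open Interpretation interp
    open Squarefree S
    open Expansion ⟦_⟧
    open Elimination _⊕_ _⊗_ 𝟘 𝟙
    private
      module S = CommutativeSemiring S
      module Λ m = CommutativeSemiring (Λ m)

    lin-· : ∀ {m} a (r : Row m) → Λ._≈_ m (lin (a · r)) (Λ._*_ m (κ m ⟦ a ⟧) (lin r))
    lin-·         a []      = S.sym (S.zeroʳ _)
    lin-· {suc m} a (b ∷ r) = lin-· a r ,
      (let open Λ m in trans (trans (κ-cong m (⟦⊗⟧ a b)) (κ-* m ⟦ a ⟧ ⟦ b ⟧))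
                             (sym (trans (+-congˡ (zeroˡ _)) (+-identityʳ _))))

    lin-⊞ : ∀ {m} (r s : Row m) → Λ._≈_ m (lin (r ⊞ s)) (Λ._+_ m (lin r) (lin s))
    lin-⊞         []      []      = S.sym (S.+-identityˡ _)
    lin-⊞ {suc m} (a ∷ r) (b ∷ s) = lin-⊞ r s ,
      (let open Λ m in trans (κ-cong m (⟦⊕⟧ a b)) (κ-+ m ⟦ a ⟧ ⟦ b ⟧))

    lin-zeros : ∀ {m} {A : Set} (r : Vec A m) → Λ._≈_ m (lin (zeros r)) (Λ.0# m)
    lin-zeros         []      = S.refl
    lin-zeros {suc m} (a ∷ r) = lin-zeros r , Λ.trans m (κ-cong m ⟦𝟘⟧) (κ-0 m)

    weightedSum : ∀ {m} → (Tri P m → S.Carrier) → WeightedList m → S.Carrier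
    weightedSum f []            = S.0#
    weightedSum f ((s , M) ∷ L) = ⟨ s ⟩ S.* f M S.+ weightedSum f L

    Ê : ∀ {m} → WeightedList m → ∣Λ∣ m
    Ê {m} []            = Λ.0# m
    Ê {m} ((s , M) ∷ L) = Λ._+_ m (Λ._*_ m (κ m ⟨ s ⟩) (E M)) (Ê L)

    top-Ê : ∀ {m} (L : WeightedList m) → top m (Ê L) S.≈ weightedSum haf L
    top-Ê {m} []            = top-0 m
    top-Ê {m} ((s , M) ∷ L) = S.trans (top-+ m _ _) (S.+-cong (top-κ m ⟨ s ⟩ (E M)) (top-Ê L))

    Ê-++ : ∀ {m} (L K : WeightedList m) → Λ._≈_ m (Ê (L ++ K)) (Λ._+_ m (Ê L) (Ê K))
    Ê-++ {m} []            K = Λ.sym m (Λ.+-identityˡ m _)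
    Ê-++ {m} ((s , M) ∷ L) K =
      (let open Λ m in trans (+-congˡ (Ê-++ L K)) (sym (+-assoc _ _ _)))

    Ê-consAll : ∀ {m} (t : Row m) (L : WeightedList m) →
                Λ._≈_ (suc m) (Ê (consAll 1ℤ t L)) (Ê L , Λ._*_ m (lin t) (Ê L))
    Ê-consAll {m} t []            = Λ.refl m , Λ.sym m (Λ.zeroʳ m _)
    Ê-consAll {m} t ((s , M) ∷ L) =
      let (e , f) = Ê-consAll t L
      in +-cong (*-congʳ (κ-cong m (⟨1*⟩ s))) e ,
         trans (+-cong (+-congʳ (*-congʳ (κ-cong m (⟨1*⟩ s)))) f)
           (solve 4 (λ s t M L → (s :* (t :* M) :+ con 0 :* M) :+ t :* L := t :* (s :* M :+ L))
             refl (κ m ⟨ s ⟩) (lin t) (E M) (Ê L))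
      where
      open Λ m
      open Solver (Λ m) using (solve; con; _:=_; _:+_; _:*_)

    -- A zero row contributes the factor 1, so the list with negated weights represents the negative
    -- of `Ê L`, free of `x₁`. Being a negative is expressed by a vanishing sum.
    Ê-cancel : ∀ {m} {A : Set} (r : Vec A m) (L : WeightedList m) →
      Λ._≈_ m (Λ._+_ m (proj₁ (Ê (consAll -1ℤ (zeros r) L))) (Ê L)) (Λ.0# m) ×
      Λ._≈_ m (proj₂ (Ê (consAll -1ℤ (zeros r) L))) (Λ.0# m)
    Ê-cancel {m} r []            = Λ.+-identityˡ m _ , Λ.refl m
    Ê-cancel {m} r ((s , M) ∷ L) =
      let (e , f) = Ê-cancel r L
      in trans (solve 5 (λ n s M X Y → (n :* M :+ X) :+ (s :* M :+ Y) := (n :+ s) :* M :+ (X :+ Y))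
                  refl (κ m ⟨ -1ℤ ℤ.* s ⟩) (κ m ⟨ s ⟩) (E M) _ (Ê L))
               (trans (+-cong (trans (*-congʳ (trans (sym (κ-+ m _ _))
                                                     (trans (κ-cong m (⟨-1*⟩ s)) (κ-0 m))))
                                     (zeroˡ _)) e)
                      (+-identityˡ _)) ,
         trans (+-cong (+-cong (trans (*-congˡ (trans (*-congʳ (lin-zeros r)) (zeroˡ _))) (zeroʳ _))
                               (zeroˡ _)) f)
               (trans (+-congʳ (+-identityˡ _)) (+-identityˡ _))
      where
      open Λ m
      open Solver (Λ m) using (solve; _:=_; _:+_; _:*_)

    Ê-mark : ∀ {m} (u : Row m) (L : WeightedList m) →
             Λ._≈_ (suc m) (Ê (mark u L)) (Λ.0# m , Λ._*_ m (lin u) (Ê L))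
    Ê-mark {m} u L =
      let (e , f) = Ê-++ (consAll 1ℤ u L) (consAll -1ℤ (zeros u) L)
          (g , h) = Ê-consAll u L
          (i , j) = Ê-cancel u L
      in trans e (trans (+-congʳ g) (trans (+-comm _ _) i)) ,
         trans f (trans (+-cong h j) (+-identityʳ _))
      where open Λ m

    -- Since `x₁² = 0`, the square of `ax₁ + q` is `2ax₁q + q²`: the mixed term carries its own
    -- factor 2, and `q²` is left to induction. The doubled form makes sense of `q²/2` without
    -- division.
    Ê-quad : ∀ {m} (q : Row m) (T : Tri P m) (let open CommutativeSemiring (Λ m) using () renaming (_+_ to _+′_; _*_ to _*′_; _≈_ to _≈′_)) →
             (Ê (quad q T) +′ Ê (quad q T)) ≈′ ((lin q *′ lin q) *′ E T)
    Ê-quad         []      []      = S.trans (S.+-identityˡ _) (S.sym (S.trans (S.*-congʳ (S.zeroˡ _)) (S.zeroˡ _)))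
    Ê-quad {suc m} (a ∷ q) (t ∷ T) =
      let (e , f) = Ê-++ (mark (a · q) ((1ℤ , T) ∷ [])) (consAll 1ℤ t (quad q T))
          (g , h) = Ê-mark (a · q) ((1ℤ , T) ∷ [])
          (i , j) = Ê-consAll t (quad q T)
          ih = Ê-quad q T
          e′ = trans e (trans (+-cong g i) (+-identityˡ _))
          f′ = trans f (+-cong (trans h (*-cong (lin-· a q)
                 (trans (+-identityʳ _) (trans (*-congʳ (trans (κ-cong m ⟨1⟩) (κ-1 m))) (*-identityˡ _))))) j)
          Q = Ê (quad q T)
          L = lin q
          A = κ m ⟦ a ⟧
          R = lin t
          X = E T
      in trans (+-cong e′ e′) ih ,
         trans (+-cong f′ f′)
           (trans (solve 5 (λ A L X R Q → (A :* L :* X :+ R :* Q) :+ (A :* L :* X :+ R :* Q)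
                      := con 2 :* A :* L :* X :+ R :* (Q :+ Q)) refl A L X R Q)
           (trans (+-congˡ (*-congˡ ih))
             (solve 4 (λ A L X R → con 2 :* A :* L :* X :+ R :* (L :* L :* X)
                      := (L :* L) :* (R :* X) :+ (L :* A :+ A :* L) :* X) refl A L X R)))
      where
      open Λ m
      open Solver (Λ m) using (solve; con; _:=_; _:+_; _:*_)

    -- With `C` and `Q` for the linear forms without `x₁`, the extra contribution at `x₁`, apart
    -- from that of the inductive error, is `(aQ + bC)CQ · E(T) = (aC · Q² + bQ · C²) ·
    -- E(T)`. The squares `Q²` and `C²` are twice divided squares, so the whole difference is even,
    -- and halving it term by term gives the recursion of `cross`.
    E-update : ∀ {m} (c q : Row m) (T : Tri P m) (let open CommutativeSemiring (Λ m) using () renaming (_+_ to _+′_; _*_ to _*′_; _≈_ to _≈′_; 1# to 1′)) →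
      E (update c q T) ≈′ ((1′ +′ lin c *′ lin q) *′ E T +′ (Ê (cross c q T) +′ Ê (cross c q T)))
    E-update [] [] [] = S.sym (S.trans (S.+-cong (S.*-congʳ (S.+-congˡ (S.zeroˡ _))) (S.+-identityˡ _))
                                (S.trans (S.+-identityʳ _) (S.trans (S.*-identityʳ _) (S.+-identityʳ _))))
    E-update {suc m} (a ∷ c) (b ∷ q) (t ∷ T) =
      let (e₁ , f₁) = Ê-++ (mark (a · c) (quad q T))
                           (mark (b · q) (quad c T) ++ consAll 1ℤ (newRow a c b q t) (cross c q T))
          (e₂ , f₂) = Ê-++ (mark (b · q) (quad c T)) (consAll 1ℤ (newRow a c b q t) (cross c q T))
          (g₁ , h₁) = Ê-mark (a · c) (quad q T)
          (g₂ , h₂) = Ê-mark (b · q) (quad c T)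
          (i , j) = Ê-consAll (newRow a c b q t) (cross c q T)
          row = trans (lin-⊞ ((a · q) ⊞ (b · c)) t) (+-congʳ (trans (lin-⊞ (a · q) (b · c)) (+-cong (lin-· a q) (lin-· b c))))
          ih = E-update c q T
          e = trans e₁ (trans (+-cong g₁ (trans e₂ (+-cong g₂ i))) (trans (+-identityˡ _) (+-identityˡ _)))
          f = trans f₁ (+-cong (trans h₁ (*-congʳ (lin-· a c))) (trans f₂ (+-cong (trans h₂ (*-congʳ (lin-· b q)))
                (trans j (*-congʳ row)))))
          A = κ m ⟦ a ⟧ ; B = κ m ⟦ b ⟧ ; C = lin c ; Q = lin q ; R = lin t ; X = E T
          K = Ê (cross c q T) ; U = Ê (quad q T) ; V = Ê (quad c T)
          R′ = lin (newRow a c b q t)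
      in trans ih (+-cong (solve 3 (λ C Q X → (con 1 :+ C :* Q) :* X := (con 1 :+ C :* Q) :* X) refl C Q X)
                          (+-cong (sym e) (sym e))) ,
         trans (*-cong row ih)
         -- Beyond the wanted `(1 + cq)E`, only the terms with `Q :* Q :* X` and `C :* C :* X` are
         -- not visibly doubled; they are isolated so that `Ê-quad` can double them.
         (trans (solve 7 (λ A B C Q R X K →
                  (A :* Q :+ B :* C :+ R) :* ((con 1 :+ C :* Q) :* X :+ (K :+ K)) :=
                  ((con 1 :+ C :* Q) :* (R :* X) :+ (C :* B :+ A :* Q) :* X) :+
                  (A :* C :* (Q :* Q :* X) :+ (B :* Q :* (C :* C :* X) :+
                    con 2 :* ((A :* Q :+ B :* C :+ R) :* K)))) refl A B C Q R X K)
         (+-cong (+-congˡ (*-congʳ (sym (+-identityˡ _))))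
           (trans (+-cong (*-congˡ (sym (Ê-quad q T))) (+-congʳ (*-congˡ (sym (Ê-quad c T)))))
           (trans (solve 8 (λ A B C Q R K U V →
               A :* C :* (U :+ U) :+ (B :* Q :* (V :+ V) :+
                    con 2 :* ((A :* Q :+ B :* C :+ R) :* K)) :=
               (A :* C :* U :+ (B :* Q :* V :+ (A :* Q :+ B :* C :+ R) :* K)) :+
               (A :* C :* U :+ (B :* Q :* V :+ (A :* Q :+ B :* C :+ R) :* K))) refl A B C Q R K U V)
             (+-cong (sym f) (sym f))))))
      where
      open Λ m
      open Solver (Λ m) using (solve; con; _:=_; _:+_; _:*_)

    -- The top monomial contains `xₚ`, so only the coefficient of `xₚ` in `c · E(T)` counts, where
    -- `c = xₚ + c⁻` by the hypothesis. The even correction stands on the left because it cannot be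
    -- subtracted on the right.
    haf-pull : ∀ {m} (p : Fin (suc m)) (c : Row (suc m)) (T : Tri P (suc m)) →
      ⟦ proj₁ (pick p c) ⟧ S.≈ S.1# →
      let c⁻ = proj₂ (pick p c) ; q = proj₁ (pull p T) ; T⁻ = proj₂ (pull p T) in
      haf (c ∷ T) S.+ (weightedSum haf (cross c⁻ q T⁻) S.+ weightedSum haf (cross c⁻ q T⁻)) S.≈
      haf (update c⁻ q T⁻)
    haf-pull {m} p c T cₚ≈1 =
      let (_ , e₁) = σ-* p (lin c) (E T)
          (f₀ , f₁) = σ-lin p c
          (g₀ , g₁) = σ-E p T
          c⁻ = proj₂ (pick p c) ; q = proj₁ (pull p T) ; T⁻ = proj₂ (pull p T)
          cp = proj₁ (pick p c)
          eq : proj₂ (σ p (Λ._*_ (suc m) (lin c) (E T))) ≈ (1# + lin c⁻ * lin q) * E T⁻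
          eq = trans e₁ (trans (+-cong (*-cong f₀ g₁) (*-cong f₁ g₀))
                 (trans (+-congˡ (*-congʳ (trans (κ-cong m cₚ≈1) (κ-1 m))))
                   (solve 3 (λ C Q X → C :* (Q :* X) :+ con 1 :* X := (con 1 :+ C :* Q) :* X)
                     refl (lin c⁻) (lin q) (E T⁻))))
          K = Ê (cross c⁻ q T⁻)
      in S.trans (S.+-cong
                   (S.trans (S.sym (top-σ p (Λ._*_ (suc m) (lin c) (E T)))) (top-cong m eq))
                   (S.trans (S.+-cong (S.sym (top-Ê (cross c⁻ q T⁻))) (S.sym (top-Ê (cross c⁻ q T⁻))))
                            (S.sym (top-+ m K K))))
         (S.trans (S.sym (top-+ m _ _)) (S.sym (top-cong m (E-update c⁻ q T⁻))))
      where
      open Λ m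
      open Solver (Λ m) using (solve; con; _:=_; _:+_; _:*_)

    combination : ∀ {m} → (Row m → S.Carrier) → List (P × Row m) → S.Carrier
    combination f []            = S.0#
    combination f ((a , u) ∷ L) = ⟦ a ⟧ S.* f u S.+ combination f L

    private
      lin-combination : ∀ {m} → List (P × Row m) → ∣Λ∣ m
      lin-combination {m} []            = Λ.0# m
      lin-combination {m} ((a , u) ∷ L) =
        Λ._+_ m (Λ._*_ m (κ m ⟦ a ⟧) (lin u)) (lin-combination L)

      lin-combination-0 : ∀ {m} (L : List (P × Row m)) → Λ._≈_ (suc m)
        (lin-combination (List.map (λ (b , u) → b , 𝟘 ∷ u) L)) (lin-combination L , Λ.0# m)
      lin-combination-0 {m} []            = Λ.refl (suc m)
      lin-combination-0 {m} ((a , u) ∷ L) =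
        let (e , f) = lin-combination-0 L
        in +-congˡ e ,
           trans (+-cong (trans (+-cong (trans (*-congˡ (trans (κ-cong m ⟦𝟘⟧) (κ-0 m))) (zeroʳ _)) (zeroˡ _))
                                (+-identityˡ _)) f) (+-identityˡ _)
        where open Λ m

      lin-units : ∀ {m} (r : Row m) → Λ._≈_ m (lin-combination (units r)) (lin r)
      lin-units         []      = S.refl
      lin-units {suc m} (a ∷ r) =
        let (e , f) = lin-combination-0 (units r)
        in trans (+-cong (trans (*-congˡ (lin-zeros r)) (zeroʳ _)) (trans e (lin-units r))) (+-identityˡ _) ,
           trans (+-cong (+-cong (trans (*-congˡ (trans (κ-cong m ⟦𝟙⟧) (κ-1 m))) (*-identityʳ _)) (zeroˡ _)) f)
                 (trans (+-identityʳ _) (+-identityʳ _))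
        where open Λ m

      top-combination : ∀ {m} (L : List (P × Row m)) (T : Tri P m) →
        top m (Λ._*_ m (lin-combination L) (E T)) S.≈ combination (λ u → haf (u ∷ T)) L
      top-combination {m} []            T = S.trans (top-cong m (Λ.zeroˡ m _)) (top-0 m)
      top-combination {m} ((a , u) ∷ L) T =
        S.trans (top-cong m (trans (distribʳ _ _ _) (+-congʳ (*-assoc _ _ _))))
          (S.trans (top-+ m _ _) (S.+-cong (top-κ m _ _) (top-combination L T)))
        where open Λ m

    haf-units : ∀ {m} (r : Row m) (T : Tri P m) →
                haf (r ∷ T) S.≈ combination (λ u → haf (u ∷ T)) (units r)
    haf-units {m} r T = S.trans (top-cong m (Λ.*-congʳ m (Λ.sym m (lin-units r))))
                                (top-combination (units r) T)

    haf-linear : ∀ {m} (g : P) (r c e : Row m) (T : Tri P m) →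
      Λ._≈_ m (lin r) (Λ._+_ m (Λ._*_ m (κ m ⟦ g ⟧) (lin c)) (lin e)) →
      haf (r ∷ T) S.≈ ⟦ g ⟧ S.* haf (c ∷ T) S.+ haf (e ∷ T)
    haf-linear {m} g r c e T eq =
      S.trans (top-cong m (trans (*-congʳ eq) (trans (distribʳ _ _ _) (+-congʳ (*-assoc _ _ _)))))
        (S.trans (top-+ m _ _) (S.+-congʳ (top-κ m _ _)))
      where open Λ m

-- The recursion modulo powers of 2 and its correctness

module EliminationStep where

  open import Algebra.Bundles using (CommutativeSemiring)
  import Algebra.Solver.Ring.NaturalCoefficients.Default as Solver
  open import Data.Bool.Base using (Bool; true; false; if_then_else_)
  open import Data.Fin.Base using (Fin; zero; suc)
  open import Data.Integer.Base as ℤ using (ℤ; 1ℤ; -1ℤ)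
  open import Data.List.Base using (List; []; _∷_)
  open import Data.Nat.Base using (ℕ; zero; suc)
  open import Data.Product.Base using (Σ-syntax; _×_; _,_; proj₁; proj₂)
  open import Data.Vec.Base as Vec using (Vec; []; _∷_)
  open import Level using (0ℓ)
  open import Data.List.Relation.Unary.All using (All; []; _∷_)
  open import Data.List.Relation.Unary.All.Properties using (map⁺)
  open import Data.Vec.Relation.Binary.Pointwise.Inductive using (Pointwise; []; _∷_)
  open SquarefreeAlgebra
  open ReductionIdentities

  -- Up to multiples of 2, ratio g a is (true , a / g) or (false , g / a).
  module HafnianAlgorithm {P : Set} (_⊕_ _⊗_ : P → P → P) (𝟘 𝟙 : P)
    (_⊙_ : ℤ → P → P) (ratio : P → P → Bool × P) where

    open Elimination _⊕_ _⊗_ 𝟘 𝟙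

    -- A triple `(g , c , p)`: the pivot entry, the quotients modulo 2 of all entries by it, and its
    -- position.
    Pivot : ℕ → Set
    Pivot m = P × Row (suc m) × Fin (suc m)

    -- The pivot is the entry of least order of vanishing modulo 2. If the new entry `a` divides the
    -- old pivot, it takes over, and the old quotients are rescaled by the quotient of the two.
    choose : ∀ {m} → Bool × P → P → Pivot m → Pivot (suc m)
    choose (true  , d) a (g , c , p) = g , d ∷ c , suc p
    choose (false , d) a (g , c , p) = a , 𝟙 ∷ (d · c) , zero

    pivot : ∀ {m} → Row (suc m) → Pivot m
    pivot (a ∷ [])    = a , 𝟙 ∷ [] , zero
    pivot (a ∷ b ∷ r) = choose (ratio (proj₁ (pivot (b ∷ r))) a) a (pivot (b ∷ r))

    residual : P → P → P → P
    residual g c a = (-1ℤ ⊙ (g ⊗ c)) ⊕ a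

    remainder : ∀ {m} → P → Row m → Row m → Row m
    remainder g c r = Vec.zipWith (residual g) c r

    total : ∀ {A : Set} → (A → P) → List A → P
    total f []      = 𝟘
    total f (x ∷ L) = f x ⊕ total f L

    wsum : ∀ {m} → (Tri P m → P) → WeightedList m → P
    wsum f = total (λ (s , M) → s ⊙ f M)

    usum : ∀ {m} → (Row m → P) → List (P × Row m) → P
    usum f = total (λ (a , u) → a ⊗ f u)

    -- Every call lowers `k`, or keeps `k` and removes two indices. Modulo `2⁰ = 1` all values
    -- agree, so 0 may be returned there; an odd number of indices has no perfect matching.
    hafnian : ℕ → ∀ m → Tri P m → P
    hafnian zero    _             _       = 𝟘
    hafnian (suc k) zero          _       = 𝟙
    hafnian (suc k) (suc zero)    _       = 𝟘
    hafnian (suc k) (suc (suc m)) (r ∷ T) =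
      (g ⊗ (((ℤ.- ℤ.+ 2) ⊙ wsum (hafnian k m) (cross c⁻ q T⁻)) ⊕ hafnian (suc k) m (update c⁻ q T⁻)))
      ⊕ usum (λ u → hafnian k (suc (suc m)) (u ∷ T)) (units (remainder g c r))
      where
      g  = proj₁ (pivot r)
      c  = proj₁ (proj₂ (pivot r))
      p  = proj₂ (proj₂ (pivot r))
      c⁻ = proj₂ (pick p c)
      q  = proj₁ (pull p T)
      T⁻ = proj₂ (pull p T)

  module Congruence (S : CommutativeSemiring 0ℓ 0ℓ) where
    open CommutativeSemiring S
    open Solver S using (solve; con; _:=_; _:+_; _:*_)

    2# : Carrier
    2# = 1# + 1#

    2^ : ℕ → Carrier
    2^ zero    = 1#
    2^ (suc k) = 2# * 2^ k

    Even : Carrier → Set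
    Even a = Σ[ h ∈ Carrier ] a ≈ 2# * h

    infix 4 _≡_[_]
    -- A semiring has no differences, so the multiple of `2^ k` is added on the right.
    _≡_[_] : Carrier → Carrier → ℕ → Set
    f ≡ g [ k ] = Σ[ h ∈ Carrier ] f ≈ g + 2^ k * h

    ≡-reflexive : ∀ {f g} k → f ≈ g → f ≡ g [ k ]
    ≡-reflexive k f≈g = 0# , trans f≈g (sym (trans (+-congˡ (zeroʳ _)) (+-identityʳ _)))

    ≡-trans : ∀ {f g h} k → f ≡ g [ k ] → g ≡ h [ k ] → f ≡ h [ k ]
    ≡-trans {f} {g} {h} k (a , p) (b , q) = b + a , trans p (trans (+-congʳ q)
      (solve 4 (λ h t a b → (h :+ t :* b) :+ t :* a := h :+ t :* (b :+ a)) refl h (2^ k) a b))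

    ≡-+ : ∀ {f g f′ g′} k → f ≡ g [ k ] → f′ ≡ g′ [ k ] → f + f′ ≡ g + g′ [ k ]
    ≡-+ {f} {g} {f′} {g′} k (a , p) (b , q) = a + b , trans (+-cong p q)
      (solve 5 (λ g g′ t a b → (g :+ t :* a) :+ (g′ :+ t :* b) := (g :+ g′) :+ t :* (a :+ b))
        refl g g′ (2^ k) a b)

    ≡-* : ∀ {f g} k a → f ≡ g [ k ] → a * f ≡ a * g [ k ]
    ≡-* {f} {g} k a (h , p) = a * h , trans (*-congˡ p)
      (solve 4 (λ g t a h → a :* (g :+ t :* h) := a :* g :+ t :* (a :* h)) refl g (2^ k) a h)

    -- The source of all precision: an even factor turns an error that is a multiple of `2^ k` into
    -- a multiple of `2^ (suc k)`, so the other factor is required to one binary digit less.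
    ≡-even : ∀ {f g a} k → Even a → f ≡ g [ k ] → a * f ≡ a * g [ suc k ]
    ≡-even {f} {g} {a} k (b , e) (h , p) = b * h , trans (*-congˡ p)
      (trans (distribˡ _ _ _) (+-congˡ (trans (*-congʳ e)
        (solve 4 (λ w b t h → (w :* b) :* (t :* h) := (w :* t) :* (b :* h)) refl 2# b (2^ k) h))))

  record Division (S : CommutativeSemiring 0ℓ 0ℓ)
                  {P : Set} (_⊕_ _⊗_ : P → P → P) (𝟘 𝟙 : P)
                  (_⊙_ : ℤ → P → P) (ratio : P → P → Bool × P) : Set where
    open CommutativeSemiring S
    open Congruence S using (Even)
    field
      interpretation : Interpretation S _⊕_ _⊗_ 𝟘 𝟙
    open Interpretation interpretation public
    field
      ⟦⊙⟧  : ∀ s a → ⟦ s ⊙ a ⟧ ≈ ⟨ s ⟩ * ⟦ a ⟧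
      ⟨-2⟩ : ⟨ ℤ.- ℤ.+ 2 ⟩ ≈ ⟨ -1ℤ ⟩ + ⟨ -1ℤ ⟩

    Quotient : P → P → Bool × P → Set
    Quotient g a (g∣a , d) = if g∣a
      then Even (⟨ -1ℤ ⟩ * (⟦ g ⟧ * ⟦ d ⟧) + ⟦ a ⟧)
      else Even (⟨ -1ℤ ⟩ * (⟦ a ⟧ * ⟦ d ⟧) + ⟦ g ⟧)

    field
      quotient : ∀ g a → Quotient g a (ratio g a)

  module Correctness (S : CommutativeSemiring 0ℓ 0ℓ)
    {P : Set} (_⊕_ _⊗_ : P → P → P) (𝟘 𝟙 : P)
    (_⊙_ : ℤ → P → P) (ratio : P → P → Bool × P)
    (division : Division S _⊕_ _⊗_ 𝟘 𝟙 _⊙_ ratio)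
    where

    open CommutativeSemiring S
    open Solver S using (solve; con; _:=_; _:+_; _:*_)
    open Division division
    open Congruence S
    open Elimination _⊕_ _⊗_ 𝟘 𝟙
    open HafnianAlgorithm _⊕_ _⊗_ 𝟘 𝟙 _⊙_ ratio
    open Squarefree S
    open Expansion ⟦_⟧
    open Reduction S _⊕_ _⊗_ 𝟘 𝟙 interpretation

    private
      module Λ m = CommutativeSemiring (Λ m)

      n : Carrier
      n = ⟨ -1ℤ ⟩

      n+1≈0 : n + 1# ≈ 0#
      n+1≈0 = trans (+-cong refl (sym ⟨1⟩)) (⟨-1*⟩ 1ℤ)

      n*x+x≈0 : ∀ x → n * x + x ≈ 0#
      n*x+x≈0 x = trans (solve 2 (λ n x → n :* x :+ x := (n :+ con 1) :* x) refl n x)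
                        (trans (*-congʳ n+1≈0) (zeroˡ x))

    EvenResidual : P → P → P → Set
    EvenResidual g c a = Even (n * (⟦ g ⟧ * ⟦ c ⟧) + ⟦ a ⟧)

    private
      residual-self : ∀ a → EvenResidual a 𝟙 a
      residual-self a = 0# , trans (+-congʳ (*-congˡ (trans (*-congˡ ⟦𝟙⟧) (*-identityʳ _))))
                               (trans (n*x+x≈0 ⟦ a ⟧) (sym (zeroʳ _)))

      residual-trans : ∀ {a g c d b} → EvenResidual a d g → EvenResidual g c b →
                       EvenResidual a (d ⊗ c) b
      residual-trans {a} {g} {c} {d} {b} (h , p) (i , q) = h * ⟦ c ⟧ + i ,
        trans (sym (+-identityʳ _))
        -- The vanishing sum `n * (g * c) + g * c` is inserted so that both given residuals can be
        -- split off.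
        (trans (+-cong (+-congʳ (*-congˡ (*-congˡ (⟦⊗⟧ d c)))) (sym (n*x+x≈0 (⟦ g ⟧ * ⟦ c ⟧))))
        (trans (solve 6 (λ n a g c d b →
                  (n :* (a :* (d :* c)) :+ b) :+ (n :* (g :* c) :+ g :* c) :=
                  (n :* (a :* d) :+ g) :* c :+ (n :* (g :* c) :+ b)) refl n ⟦ a ⟧ ⟦ g ⟧ ⟦ c ⟧ ⟦ d ⟧ ⟦ b ⟧)
        (trans (+-cong (*-congʳ p) q)
               (solve 4 (λ t h c i → t :* h :* c :+ t :* i := t :* (h :* c :+ i)) refl 2# h ⟦ c ⟧ i))))

    IsPivot : ∀ {m} → Row (suc m) → Pivot m → Set
    IsPivot r (g , c , p) = ⟦ proj₁ (pick p c) ⟧ ≈ 1# × Pointwise (EvenResidual g) c r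

    isPivot : ∀ {m} (r : Row (suc m)) → IsPivot r (pivot r)
    isPivot (a ∷ [])    = ⟦𝟙⟧ , residual-self a ∷ []
    isPivot (a ∷ b ∷ r) = choose-isPivot (ratio (proj₁ (pivot (b ∷ r))) a) (quotient _ a) (isPivot (b ∷ r))
      where
      scaled : ∀ {m a g d} {c s : Row m} → EvenResidual a d g →
               Pointwise (EvenResidual g) c s → Pointwise (EvenResidual a) (d · c) s
      scaled e []       = []
      scaled e (f ∷ fs) = residual-trans e f ∷ scaled e fs

      choose-isPivot : ∀ {m a} {s : Row (suc m)} {pv : Pivot m} x →
        Quotient (proj₁ pv) a x → IsPivot s pv → IsPivot (a ∷ s) (choose x a pv)
      choose-isPivot (true  , d) e (u , es) = u , e ∷ es
      choose-isPivot (false , d) e (u , es) = ⟦𝟙⟧ , residual-self _ ∷ scaled e es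

    private
      ⟦residual⟧ : ∀ g c a → ⟦ residual g c a ⟧ ≈ n * (⟦ g ⟧ * ⟦ c ⟧) + ⟦ a ⟧
      ⟦residual⟧ g c a = trans (⟦⊕⟧ _ _) (+-congʳ (trans (⟦⊙⟧ _ _) (*-congˡ (⟦⊗⟧ g c))))

      lin-remainder : ∀ {m} g (c r : Row m) →
        Λ._≈_ m (lin r) (Λ._+_ m (Λ._*_ m (κ m ⟦ g ⟧) (lin c)) (lin (remainder g c r)))
      lin-remainder         g []      []      = sym (trans (+-congʳ (zeroʳ _)) (+-identityˡ _))
      lin-remainder {suc m} g (b ∷ c) (a ∷ r) = lin-remainder g c r ,
        (let module Λₘ = Λ m in
         Λₘ.trans (κ-cong m (sym
           (trans (+-congˡ (⟦residual⟧ g b a))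
           (trans (solve 3 (λ n x a → x :+ (n :* x :+ a) := (n :* x :+ x) :+ a) refl n (⟦ g ⟧ * ⟦ b ⟧) ⟦ a ⟧)
           (trans (+-congʳ (n*x+x≈0 _)) (+-identityˡ _))))))
         (Λₘ.trans (κ-+ m _ _) (Λₘ.+-congʳ
           (Λₘ.trans (κ-* m ⟦ g ⟧ ⟦ b ⟧) (Λₘ.sym (Λₘ.trans (Λₘ.+-congˡ (Λₘ.zeroˡ _)) (Λₘ.+-identityʳ _)))))))

      units-even : ∀ {m} g {c r : Row m} → Pointwise (EvenResidual g) c r →
                   All (λ au → Even ⟦ proj₁ au ⟧) (units (remainder g c r))
      units-even g []                                = []
      units-even g (_∷_ {x = c} {y = a} (h , p) es) =
        (h , trans (⟦residual⟧ g c a) p) ∷ map⁺ (units-even g es)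

      combination-≡ : ∀ {m} k (f : Row m → Carrier) (f′ : Row m → P) →
        (∀ u → f u ≡ ⟦ f′ u ⟧ [ k ]) → ∀ {L} → All (λ au → Even ⟦ proj₁ au ⟧) L →
        combination f L ≡ ⟦ usum f′ L ⟧ [ suc k ]
      combination-≡ k f f′ f≡f′ []       = ≡-reflexive (suc k) (sym ⟦𝟘⟧)
      combination-≡ k f f′ f≡f′ {(a , u) ∷ L} (e ∷ es) =
        ≡-trans (suc k) (≡-+ (suc k) (≡-even k e (f≡f′ u)) (combination-≡ k f f′ f≡f′ es))
          (≡-reflexive (suc k) (sym (trans (⟦⊕⟧ _ _) (+-congʳ (⟦⊗⟧ _ _)))))

      weightedSum-≡ : ∀ {m} k (f : Tri P m → Carrier) (f′ : Tri P m → P) →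
        (∀ M → f M ≡ ⟦ f′ M ⟧ [ k ]) → ∀ L → weightedSum f L ≡ ⟦ wsum f′ L ⟧ [ k ]
      weightedSum-≡ k f f′ f≡f′ []            = ≡-reflexive k (sym ⟦𝟘⟧)
      weightedSum-≡ k f f′ f≡f′ ((s , M) ∷ L) =
        ≡-trans k (≡-+ k (≡-* k ⟨ s ⟩ (f≡f′ M)) (weightedSum-≡ k f f′ f≡f′ L))
          (≡-reflexive k (sym (trans (⟦⊕⟧ _ _) (+-congʳ (⟦⊙⟧ _ _)))))

    -- The recursion is an exact identity (`exact`), so errors come only from the recursive calls.
    -- Each call with the smaller `k` is multiplied by something even, namely -2 in front of the
    -- `cross` sum or an entry of the remainder row in front of a unit row, and `≡-even` restores
    -- the lost digit.
    hafnian-correct : ∀ k m (M : Tri P m) → haf M ≡ ⟦ hafnian k m M ⟧ [ k ]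
    hafnian-correct zero    m    M         = haf M , sym (trans (+-congʳ ⟦𝟘⟧) (trans (+-identityˡ _) (*-identityˡ _)))
    hafnian-correct (suc k) zero []        = ≡-reflexive (suc k) (sym ⟦𝟙⟧)
    hafnian-correct (suc k) (suc zero) ([] ∷ []) = ≡-reflexive (suc k) (trans (zeroˡ _) (sym ⟦𝟘⟧))
    hafnian-correct (suc k) (suc (suc m)) (r ∷ T) =
      ≡-trans (suc k) (≡-reflexive (suc k) exact)
      (≡-trans (suc k)
        (≡-+ (suc k)
          (≡-* (suc k) ⟦ g ⟧ (≡-+ (suc k)
            (≡-even k (n , trans ⟨-2⟩ (solve 1 (λ n → n :+ n := (con 1 :+ con 1) :* n) refl n))
              (weightedSum-≡ k haf (hafnian k m) (hafnian-correct k m) (cross c⁻ q T⁻)))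
            (hafnian-correct (suc k) m (update c⁻ q T⁻))))
          (combination-≡ k _ _ (λ u → hafnian-correct k (suc (suc m)) (u ∷ T)) (units-even g (proj₂ (isPivot r)))))
        (≡-reflexive (suc k) (sym
          (trans (⟦⊕⟧ _ _) (+-congʳ (trans (⟦⊗⟧ _ _) (*-congˡ (trans (⟦⊕⟧ _ _) (+-congʳ (⟦⊙⟧ _ _))))))))))
      where
      g  = proj₁ (pivot r)
      c  = proj₁ (proj₂ (pivot r))
      p  = proj₂ (proj₂ (pivot r))
      c⁻ = proj₂ (pick p c)
      q  = proj₁ (pull p T)
      T⁻ = proj₂ (pull p T)
      X  = weightedSum haf (cross c⁻ q T⁻)

      haf-c : haf (c ∷ T) ≈ ⟨ ℤ.- ℤ.+ 2 ⟩ * X + haf (update c⁻ q T⁻)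
      haf-c =
        -- Adding the zero `n * (X + X) + (X + X)` produces both the summand -2X and the left side
        -- of `haf-pull`.
        trans (sym (trans (+-congˡ (n*x+x≈0 (X + X))) (+-identityʳ _)))
        (trans (solve 3 (λ h n X → h :+ (n :* (X :+ X) :+ (X :+ X)) := (n :+ n) :* X :+ (h :+ (X :+ X)))
                 refl (haf (c ∷ T)) n X)
        (+-cong (*-congʳ (sym ⟨-2⟩)) (haf-pull p c T (proj₁ (isPivot r)))))

      exact : haf (r ∷ T) ≈ ⟦ g ⟧ * (⟨ ℤ.- ℤ.+ 2 ⟩ * X + haf (update c⁻ q T⁻)) +
                            combination (λ u → haf (u ∷ T)) (units (remainder g c r))
      exact = trans (haf-linear g r c (remainder g c r) T (lin-remainder g c r))
                    (+-cong (*-congˡ haf-c) (haf-units (remainder g c r) T))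

-- Sums over perfect matchings as top coefficients

module MatchingSums where

  open import Algebra.Bundles using (CommutativeSemiring)
  import Algebra.Solver.Ring.NaturalCoefficients.Default as Solver
  open import Data.Bool.Base using (true; false; if_then_else_)
  open import Data.Empty using (⊥-elim)
  open import Data.Fin.Base using (Fin; zero; suc)
  open import Data.Fin.Properties using (<⇒≢) renaming (_≟_ to _≟ᶠ_; _<?_ to _<?ᶠ_)
  open import Data.List.Base using (List; []; _∷_; _++_; foldr; map; filter; cartesianProduct; tabulate; length; allFin)
  open import Data.List.Relation.Unary.All as All using (All; []; _∷_)
  open import Data.List.Relation.Unary.All.Properties using (map⁺; ++⁺; all-filter)
  open import Data.Nat.Base using (ℕ; zero; suc)
  open import Data.Product.Base using (_×_; _,_; proj₁; proj₂)
  open import Data.Vec.Base as Vec using (Vec; []; _∷_)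
  open import Function.Base using (_∘_; id)
  open import Level using (0ℓ)
  open import Relation.Binary.PropositionalEquality as ≡ using (_≡_; _≢_)
  open import Relation.Nullary using (¬_; Dec; yes; no; does)
  open import Relation.Unary using (Pred; Decidable)
  open import Defs using (pairs; sublists; matchings; IsPartition; isPartition?; _isEndOf?_)
  open SquarefreeAlgebra

  toTri : ∀ {A : Set} m → (Fin m → Fin m → A) → Tri A m
  toTri zero    f = []
  toTri (suc m) f = Vec.tabulate (λ j → f zero (suc j)) ∷ toTri m (λ i j → f (suc i) (suc j))

  module Products (R : CommutativeSemiring 0ℓ 0ℓ) where
    open CommutativeSemiring R hiding (zero)
    open Solver R using (solve; con; _:=_; _:+_; _:*_)

    sumₗ productₗ : List Carrier → Carrier
    sumₗ     = foldr _+_ 0#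
    productₗ = foldr _*_ 1#

    ∑ ∏ : ∀ {A : Set} → (A → Carrier) → List A → Carrier
    ∑ f L = sumₗ (map f L)
    ∏ f L = productₗ (map f L)

    ∑-++ : ∀ {A : Set} (f : A → Carrier) L K → ∑ f (L ++ K) ≈ ∑ f L + ∑ f K
    ∑-++ f []      K = sym (+-identityˡ _)
    ∑-++ f (x ∷ L) K = trans (+-congˡ (∑-++ f L K)) (sym (+-assoc _ _ _))

    ∏-++ : ∀ {A : Set} (f : A → Carrier) L K → ∏ f (L ++ K) ≈ ∏ f L * ∏ f K
    ∏-++ f []      K = sym (*-identityˡ _)
    ∏-++ f (x ∷ L) K = trans (*-congˡ (∏-++ f L K)) (sym (*-assoc _ _ _))

    ∑-cong : ∀ {A : Set} {f g : A → Carrier} {L} → All (λ x → f x ≈ g x) L → ∑ f L ≈ ∑ g L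
    ∑-cong []       = refl
    ∑-cong (p ∷ ps) = +-cong p (∑-cong ps)

    ∏-map : ∀ {A B : Set} (f : B → Carrier) (h : A → B) L → ∏ f (map h L) ≡ ∏ (f ∘ h) L
    ∏-map f h []      = ≡.refl
    ∏-map f h (x ∷ L) = ≡.cong (f (h x) *_) (∏-map f h L)

    -- Multiplying out means choosing 1 or `f x` in every factor, and the choices of `f x` form a
    -- sublist.
    ∏-sublists : ∀ {A : Set} (f : A → Carrier) L → ∏ (λ x → 1# + f x) L ≈ ∑ (∏ f) (sublists L)
    ∏-sublists f []      = sym (+-identityʳ _)
    ∏-sublists f (x ∷ L) =
      trans (*-congˡ (∏-sublists f L))
      (trans (trans (distribʳ _ _ _) (+-cong (*-identityˡ _) (∑-∷ (sublists L))))
             (sym (∑-++ (∏ f) (sublists L) (map (x ∷_) (sublists L)))))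
      where
      ∑-∷ : ∀ K → f x * ∑ (∏ f) K ≈ ∑ (∏ f) (map (x ∷_) K)
      ∑-∷ []      = zeroʳ _
      ∑-∷ (M ∷ K) = trans (distribˡ _ _ _) (+-congˡ (∑-∷ K))

    ∑-filter : ∀ {A : Set} {P : Pred A 0ℓ} (P? : Decidable P) (f : A → Carrier) L →
               ∑ (λ x → if does (P? x) then f x else 0#) L ≈ ∑ f (filter P? L)
    ∑-filter P? f []      = refl
    ∑-filter P? f (x ∷ L) with does (P? x)
    ... | true  = +-congˡ (∑-filter P? f L)
    ... | false = trans (+-identityˡ _) (∑-filter P? f L)

    ∏-filter : ∀ {A : Set} {P : Pred A 0ℓ} (P? : Decidable P) (f : A → Carrier) L →
               ∏ f (filter P? L) ≈ ∏ (λ x → if does (P? x) then f x else 1#) L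
    ∏-filter P? f []      = refl
    ∏-filter P? f (x ∷ L) with does (P? x)
    ... | true  = *-congˡ (∏-filter P? f L)
    ... | false = trans (∏-filter P? f L) (sym (*-identityˡ _))

    ∏-cartesian : ∀ {A B : Set} (f : A × B → Carrier) L K →
                  ∏ f (cartesianProduct L K) ≈ ∏ (λ x → ∏ (λ y → f (x , y)) K) L
    ∏-cartesian f []      K = refl
    ∏-cartesian f (x ∷ L) K =
      trans (∏-++ f (map (x ,_) K) (cartesianProduct L K))
            (*-cong (reflexive (∏-map f (x ,_) K)) (∏-cartesian f L K))

    ∏ᶠ : ∀ m → (Fin m → Carrier) → Carrier
    ∏ᶠ zero    f = 1#
    ∏ᶠ (suc m) f = f zero * ∏ᶠ m (f ∘ suc)

    ∏ᶠ-cong : ∀ m {f g : Fin m → Carrier} → (∀ i → f i ≈ g i) → ∏ᶠ m f ≈ ∏ᶠ m g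
    ∏ᶠ-cong zero    e = refl
    ∏ᶠ-cong (suc m) e = *-cong (e zero) (∏ᶠ-cong m (e ∘ suc))

    ∏-tabulate : ∀ {A : Set} m (f : A → Carrier) (h : Fin m → A) → ∏ f (tabulate h) ≈ ∏ᶠ m (f ∘ h)
    ∏-tabulate zero    f h = refl
    ∏-tabulate (suc m) f h = *-congˡ (∏-tabulate m f (h ∘ suc))

  All-sublists : ∀ {A : Set} {P : Pred A 0ℓ} {L} → All P L → All (All P) (sublists L)
  All-sublists []       = [] ∷ []
  All-sublists (p ∷ ps) = ++⁺ (All-sublists ps) (map⁺ (All.map (p ∷_) (All-sublists ps)))

  -- Multiplication by the variable `xᵥ`, on exponent vectors.
  bump : ∀ {m} → Fin m → (Fin m → ℕ) → Fin m → ℕ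
  bump zero    f zero    = suc (f zero)
  bump zero    f (suc u) = f (suc u)
  bump (suc v) f zero    = f zero
  bump (suc v) f (suc u) = bump v (f ∘ suc) u

  bump-≡ : ∀ {m} (v : Fin m) f → bump v f v ≡ suc (f v)
  bump-≡ zero    f = ≡.refl
  bump-≡ (suc v) f = bump-≡ v (f ∘ suc)

  bump-≢ : ∀ {m} {u v : Fin m} f → u ≢ v → bump v f u ≡ f u
  bump-≢ {u = zero}  {zero}  f u≢v = ⊥-elim (u≢v ≡.refl)
  bump-≢ {u = zero}  {suc v} f u≢v = ≡.refl
  bump-≢ {u = suc u} {zero}  f u≢v = ≡.refl
  bump-≢ {u = suc u} {suc v} f u≢v = bump-≢ (f ∘ suc) (u≢v ∘ ≡.cong suc)

  degree : ∀ {m} → List (Fin m × Fin m) → Fin m → ℕ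
  degree M v = length (filter (v isEndOf?_) M)

  -- For `i = j` the claim would fail: the pair has `i` as an end once, whereas the exponent is
  -- raised twice.
  degree-∷ : ∀ {m} {i j : Fin m} M → i ≢ j → ∀ v → bump i (bump j (degree M)) v ≡ degree ((i , j) ∷ M) v
  degree-∷ {i = i} {j} M i≢j v with v ≟ᶠ i | v ≟ᶠ j
  ... | yes ≡.refl | yes ≡.refl = ⊥-elim (i≢j ≡.refl)
  ... | yes ≡.refl | no v≢j     = ≡.trans (bump-≡ i (bump j (degree M))) (≡.cong suc (bump-≢ (degree M) v≢j))
  ... | no v≢i     | yes ≡.refl = ≡.trans (bump-≢ (bump j (degree M)) v≢i) (bump-≡ j (degree M))
  ... | no v≢i     | no v≢j     = ≡.trans (bump-≢ (bump j (degree M)) v≢i) (bump-≢ (degree M) v≢j)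

  module Matchings (S : CommutativeSemiring 0ℓ 0ℓ) {P : Set} (⟦_⟧ : P → CommutativeSemiring.Carrier S) where
    open Squarefree S
    open Expansion ⟦_⟧
    private
      module S = CommutativeSemiring S
      module Λ m = CommutativeSemiring (Λ m)
      module ΠS = Products S
      module Π m = Products (Λ m)

    X : ∀ {m} → Fin m → ∣Λ∣ m
    X {suc m} zero    = Λ.0# m , Λ.1# m
    X {suc m} (suc i) = X i , Λ.0# m

    -- Exponents are natural numbers rather than bits, so that every set of pairs has a monomial; it
    -- is 0 as soon as some vertex is covered twice.
    monomial : ∀ m → (Fin m → ℕ) → ∣Λ∣ m
    variable-power : ∀ m → ℕ → ∣Λ∣ m → ∣Λ∣ (suc m)
    monomial zero    f = S.1#
    monomial (suc m) f = variable-power m (f zero) (monomial m (f ∘ suc))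
    variable-power m zero          a = a , Λ.0# m
    variable-power m (suc zero)    a = Λ.0# m , a
    variable-power m (suc (suc _)) a = Λ.0# (suc m)

    variable-power-cong : ∀ m e {a b} → Λ._≈_ m a b → Λ._≈_ (suc m) (variable-power m e a) (variable-power m e b)
    variable-power-cong m zero          p = p , Λ.refl m
    variable-power-cong m (suc zero)    p = Λ.refl m , p
    variable-power-cong m (suc (suc _)) p = Λ.refl (suc m)

    monomial-cong : ∀ m {f g} → (∀ i → f i ≡ g i) → Λ._≈_ m (monomial m f) (monomial m g)
    monomial-cong zero            e = S.refl
    monomial-cong (suc m) {f} {g} e rewrite e zero =
      variable-power-cong m (g zero) (monomial-cong m (e ∘ suc))

    variable-power-* : ∀ m e x a →
      Λ._≈_ (suc m) (Λ._*_ (suc m) (x , Λ.0# m) (variable-power m e a)) (variable-power m e (Λ._*_ m x a))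
    variable-power-* m zero          x a = refl , trans (+-cong (zeroʳ _) (zeroˡ _)) (+-identityˡ _)
      where open Λ m hiding (zero)
    variable-power-* m (suc zero)    x a = zeroʳ _ , trans (+-congˡ (zeroˡ _)) (+-identityʳ _)
      where open Λ m hiding (zero)
    variable-power-* m (suc (suc e)) x a = Λ.zeroʳ (suc m) _

    X-monomial : ∀ {m} (v : Fin m) f → Λ._≈_ m (Λ._*_ m (X v) (monomial m f)) (monomial m (bump v f))
    X-monomial {suc m} zero f = go (f zero) (monomial m (f ∘ suc))
      where
      open Λ m hiding (zero)
      go : ∀ e a → Λ._≈_ (suc m) (Λ._*_ (suc m) (0# , 1#) (variable-power m e a)) (variable-power m (suc e) a)
      go zero          a = zeroˡ _ , trans (+-cong (zeroˡ _) (*-identityˡ _)) (+-identityˡ _)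
      go (suc zero)    a = zeroˡ _ , trans (+-cong (zeroˡ _) (zeroʳ _)) (+-identityˡ _)
      go (suc (suc e)) a = Λ.zeroʳ (suc m) _
    X-monomial {suc m} (suc v) f =
      Λ.trans (suc m) (variable-power-* m (f zero) (X v) (monomial m (f ∘ suc)))
                      (variable-power-cong m (f zero) (X-monomial v (f ∘ suc)))

    top-monomial-1 : ∀ m f → (∀ i → f i ≡ 1) → top m (monomial m f) S.≈ S.1#
    top-monomial-1 zero    f e = S.refl
    top-monomial-1 (suc m) f e rewrite e zero = top-monomial-1 m (f ∘ suc) (e ∘ suc)

    top-monomial-0 : ∀ m f → ¬ (∀ i → f i ≡ 1) → top m (monomial m f) S.≈ S.0#
    top-monomial-0 zero    f ¬e = ⊥-elim (¬e λ ())
    top-monomial-0 (suc m) f ¬e with f zero in eq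
    ... | zero        = top-0 m
    ... | suc zero    = top-monomial-0 m (f ∘ suc) (λ e → ¬e λ { zero → eq ; (suc i) → e i })
    ... | suc (suc _) = top-0 m

    module _ {m} (A : Fin m → Fin m → P) where

      weight : Fin m × Fin m → S.Carrier
      weight (i , j) = ⟦ A i j ⟧

      factor : Fin m × Fin m → ∣Λ∣ m
      factor (i , j) = Λ._*_ m (κ m ⟦ A i j ⟧) (Λ._*_ m (X i) (X j))

      ∏-factor : ∀ {M} → All (λ (i , j) → i ≢ j) M →
        Λ._≈_ m (Π.∏ m factor M) (Λ._*_ m (κ m (ΠS.∏ weight M)) (monomial m (degree M)))
      ∏-factor {[]} [] = Λ.sym m (Λ.trans m (Λ.*-cong m (κ-1 m) (monomial-0 m)) (Λ.*-identityˡ m _))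
        where
        monomial-0 : ∀ m → Λ._≈_ m (monomial m (λ _ → 0)) (Λ.1# m)
        monomial-0 zero    = S.refl
        monomial-0 (suc m) = monomial-0 m , Λ.refl m
      ∏-factor {(i , j) ∷ M} (i≢j ∷ es) =
        trans (*-congˡ (∏-factor es))
        (trans (solve 5 (λ a x y w t → (a :* (x :* y)) :* (w :* t) := (a :* w) :* (x :* (y :* t)))
                 refl (κ m ⟦ A i j ⟧) (X i) (X j) (κ m (ΠS.∏ weight M)) (monomial m (degree M)))
        (*-cong (sym (κ-* m _ _))
          (trans (*-congˡ (X-monomial j (degree M)))
          (trans (X-monomial i _) (monomial-cong m (degree-∷ M i≢j))))))
        where
        open Λ m hiding (zero)
        open Solver (Λ m) using (solve; _:=_; _:+_; _:*_)

      -- The exponent vector of the monomial is `degree M`, and it equals that of `x₁⋯xₘ` exactly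
      -- when each vertex lies in one pair. Taking the top coefficient thus does the work of the
      -- filter `isPartition?`.
      top-∏-factor : ∀ {M} → All (λ (i , j) → i ≢ j) M →
        top m (Π.∏ m factor M) S.≈ (if does (isPartition? M) then ΠS.∏ weight M else S.0#)
      top-∏-factor {M} es =
        S.trans (top-cong m (∏-factor es)) (S.trans (top-κ m _ _) (decide (isPartition? M)))
        where
        decide : (d : Dec (IsPartition M)) → ΠS.∏ weight M S.* top m (monomial m (degree M)) S.≈
                                             (if does d then ΠS.∏ weight M else S.0#)
        decide (yes p) = S.trans (S.*-congˡ (top-monomial-1 m (degree M) p)) (S.*-identityʳ _)
        decide (no ¬p) = S.trans (S.*-congˡ (top-monomial-0 m (degree M) ¬p)) (S.zeroʳ _)

      top-∑ : ∀ {B : Set} (f : B → ∣Λ∣ m) L → top m (Π.∑ m f L) S.≈ ΠS.∑ (top m ∘ f) L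
      top-∑ f []      = top-0 m
      top-∑ f (x ∷ L) = S.trans (top-+ m _ _) (S.+-congˡ (top-∑ f L))

      ∑-matchings : ΠS.∑ (ΠS.∏ weight) (matchings m) S.≈
                    top m (Π.∏ m (λ x → Λ._+_ m (Λ.1# m) (factor x)) (pairs m))
      ∑-matchings = S.sym
        (S.trans (top-cong m (Π.∏-sublists m factor (pairs m)))
        (S.trans (top-∑ (Π.∏ m factor) (sublists (pairs m)))
        (S.trans (ΠS.∑-cong (All.map top-∏-factor (All-sublists distinct)))
                 (ΠS.∑-filter isPartition? (ΠS.∏ weight) (sublists (pairs m))))))
        where
        distinct : All (λ (i , j) → i ≢ j) (pairs m)
        distinct = All.map <⇒≢ (all-filter (λ p → proj₁ p <?ᶠ proj₂ p) (cartesianProduct (allFin m) (allFin m)))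

    -- The condition `i < j` is moved from the index set into the factor, so that the product runs
    -- over a full square and can be split by rows.
    upperFactor : ∀ {m} → (Fin m → Fin m → P) → Fin m → Fin m → ∣Λ∣ m
    upperFactor {m} A i j = if does (i <?ᶠ j) then Λ._+_ m (Λ.1# m) (factor A (i , j)) else Λ.1# m

    private
      ι : ∀ m → ∣Λ∣ m → ∣Λ∣ (suc m)
      ι m a = a , Λ.0# m

      ∏ᶠ-ι : ∀ m n (f : Fin n → ∣Λ∣ m) → Λ._≈_ (suc m) (Π.∏ᶠ (suc m) n (ι m ∘ f)) (ι m (Π.∏ᶠ m n f))
      ∏ᶠ-ι m zero    f = Λ.refl (suc m)
      ∏ᶠ-ι m (suc n) f = Λ.trans (suc m) (Λ.*-congˡ (suc m) (∏ᶠ-ι m n (f ∘ suc)))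
        (refl , trans (+-cong (zeroʳ _) (zeroˡ _)) (+-identityˡ _))
        where open Λ m hiding (zero)

      factor-suc : ∀ {m} (A : Fin (suc m) → Fin (suc m) → P) i j →
        Λ._≈_ (suc m) (upperFactor A (suc i) (suc j)) (ι m (upperFactor (λ i j → A (suc i) (suc j)) i j))
      factor-suc {m} A i j with does (i <?ᶠ j)
      ... | false = Λ.refl (suc m)
      ... | true  = refl , trans (+-identityˡ _)
        (trans (+-cong (trans (*-congˡ (trans (+-cong (zeroʳ _) (zeroˡ _)) (+-identityˡ _))) (zeroʳ _)) (zeroˡ _))
               (+-identityˡ _))
        where open Λ m hiding (zero)

      linearSum : ∀ m n → (Fin n → S.Carrier × ∣Λ∣ m) → ∣Λ∣ m
      linearSum m zero    f = Λ.0# m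
      linearSum m (suc n) f = Λ._+_ m (Λ._*_ m (κ m (proj₁ (f zero))) (proj₂ (f zero))) (linearSum m n (f ∘ suc))

      linearSum-ι : ∀ m n (a : Fin n → S.Carrier) (x : Fin n → ∣Λ∣ m) →
        Λ._≈_ (suc m) (linearSum (suc m) n (λ j → a j , ι m (x j))) (ι m (linearSum m n (λ j → a j , x j)))
      linearSum-ι m zero    a x = Λ.refl (suc m)
      linearSum-ι m (suc n) a x =
        let (e , f) = linearSum-ι m n (a ∘ suc) (x ∘ suc)
        in +-congˡ e , trans (+-cong (trans (+-cong (zeroʳ _) (zeroˡ _)) (+-identityˡ _)) f) (+-identityˡ _)
        where open Λ m hiding (zero)

      lin-tabulate : ∀ m (a : Fin m → P) →
        Λ._≈_ m (linearSum m m (λ j → ⟦ a j ⟧ , X j)) (lin (Vec.tabulate a))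
      lin-tabulate zero    a = S.refl
      lin-tabulate (suc m) a =
        let (e , f) = linearSum-ι m m (λ j → ⟦ a (suc j) ⟧) X
        in trans (+-cong (zeroʳ _) (trans e (lin-tabulate m (a ∘ suc)))) (+-identityˡ _) ,
           trans (+-cong (trans (+-cong (*-identityʳ _) (zeroˡ _)) (+-identityʳ _)) f) (+-identityʳ _)
        where open Λ m hiding (zero)

      firstRow : ∀ {m n} (a : Fin n → P) (x : Fin n → ∣Λ∣ m) → Λ._≈_ (suc m)
        (Π.∏ᶠ (suc m) n (λ j → Λ._+_ (suc m) (Λ.1# (suc m))
          (Λ._*_ (suc m) (κ (suc m) ⟦ a j ⟧) (Λ._*_ (suc m) (Λ.0# m , Λ.1# m) (ι m (x j))))))
        (Λ.1# m , linearSum m n (λ j → ⟦ a j ⟧ , x j))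
      firstRow {m} {zero}  a x = Λ.refl (suc m)
      firstRow {m} {suc n} a x = Λ.trans (suc m) (Λ.*-congˡ (suc m) (firstRow {m} (a ∘ suc) (x ∘ suc)))
        ( solve 2 (λ a x → (con 1 :+ a :* (con 0 :* x)) :* con 1 := con 1) refl A Y
        , solve 3 (λ a x l → (con 1 :+ a :* (con 0 :* x)) :* l :+
                     (con 0 :+ (a :* (con 0 :* con 0 :+ con 1 :* x) :+ con 0 :* (con 0 :* x))) :* con 1
                     := a :* x :+ l) refl A Y _ )
        where
        open Λ m hiding (zero)
        open Solver (Λ m) using (solve; con; _:=_; _:+_; _:*_)
        A = κ m ⟦ a zero ⟧
        Y = x zero

    -- Induction on the number of indices: in the first row and column, the diagonal factor and
    -- those below it are 1, the rest multiply to `1 + x₁ lin(t)`, and all remaining factors are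
    -- free of `x₁`.
    E-toTri : ∀ m (A : Fin m → Fin m → P) →
      Λ._≈_ m (Π.∏ᶠ m m (λ i → Π.∏ᶠ m m (upperFactor A i))) (E (toTri m A))
    E-toTri zero    A = S.refl
    E-toTri (suc m) A =
      Λ.trans (suc m) (Λ.*-cong (suc m) (Λ.trans (suc m) (Λ.*-identityˡ (suc m) _) (firstRow {m} (λ j → A zero (suc j)) X))
        (Λ.trans (suc m) (Π.∏ᶠ-cong (suc m) m λ i →
            Λ.trans (suc m) (Λ.*-identityˡ (suc m) _)
            (Λ.trans (suc m) (Π.∏ᶠ-cong (suc m) m (factor-suc A i)) (∏ᶠ-ι m m _)))
          (Λ.trans (suc m) (∏ᶠ-ι m m _)
            (E-toTri m (λ i j → A (suc i) (suc j)) , Λ.refl m))))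
      (*-identityˡ _ , trans (+-cong (*-identityˡ _) (*-congʳ (lin-tabulate m _))) (+-identityˡ _))
      where open Λ m hiding (zero)

    ∑-matchings≈haf : ∀ m (A : Fin m → Fin m → P) →
      ΠS.∑ (ΠS.∏ (weight A)) (matchings m) S.≈ haf (toTri m A)
    ∑-matchings≈haf m A = S.trans (∑-matchings A) (top-cong m
      (trans (Π.∏-filter m (λ p → proj₁ p <?ᶠ proj₂ p) (λ x → 1# + factor A x) (cartesianProduct (allFin m) (allFin m)))
      (trans (Π.∏-cartesian m _ (allFin m) (allFin m))
      (trans (Π.∏-tabulate m m _ id)
      (trans (Π.∏ᶠ-cong m m (λ i → Π.∏-tabulate m m _ id)) (E-toTri m A))))))
      where open Λ m hiding (zero)

-- Truncated power series and their division modulo 2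

module PowerSeries where

  open import Algebra.Bundles using (CommutativeSemiring)
  open import Algebra.Structures.Biased using (isCommutativeSemiringˡ)
  open import Data.Bool.Base using (Bool; true; false)
  open import Data.Empty using (⊥-elim)
  open import Data.Integer.Base as ℤ using (ℤ; 0ℤ; 1ℤ; +_; _+_; _*_; -_)
  open import Data.Integer.DivMod using (n%ℕd<d; a≡a%ℕn+[a/ℕn]*n)
  import Data.Integer.Properties as ℤₚ
  open import Data.Integer.Tactic.RingSolver using (solve-∀)
  open import Data.Nat.Base as ℕ using (ℕ; zero; suc; _<_; z≤n; s≤s)
  import Data.Nat.Properties as ℕₚ
  open import Data.Product.Base using (Σ-syntax; _×_; _,_; proj₁; proj₂)
  open import Data.Vec.Base as Vec using (Vec; []; _∷_)
  open import Function.Base using (_∘_)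
  open import Level using (0ℓ)
  open import Relation.Binary.PropositionalEquality
  open import Relation.Binary.Structures using (IsEquivalence)
  open import Relation.Nullary using (Dec; yes; no; does)
  open import Defs using (_mod2^_)

  Series : Set
  Series = ℕ → ℤ

  one : Series
  one zero    = 1ℤ
  one (suc _) = 0ℤ

  infixl 7 _*ˢ_
  _*ˢ_ : Series → Series → Series
  (f *ˢ g) zero    = f 0 * g 0
  (f *ˢ g) (suc i) = f 0 * g (suc i) + ((f ∘ suc) *ˢ g) i

  module _ where
    open ≡-Reasoning

    -- Coefficient `i` of a product depends only on the coefficients up to `i` of the factors; hence
    -- multiplication is well defined modulo `xᴰ`.
    *ˢ-cong : ∀ i {f f′ g g′} → (∀ {j} → j ℕ.≤ i → f j ≡ f′ j) → (∀ {j} → j ℕ.≤ i → g j ≡ g′ j) →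
              (f *ˢ g) i ≡ (f′ *ˢ g′) i
    *ˢ-cong zero    p q = cong₂ _*_ (p z≤n) (q z≤n)
    *ˢ-cong (suc i) p q = cong₂ _+_ (cong₂ _*_ (p z≤n) (q ℕₚ.≤-refl))
                            (*ˢ-cong i (p ∘ s≤s) (q ∘ ℕₚ.m≤n⇒m≤1+n))

    *ˢ-zeroˡ : ∀ g i → ((λ _ → 0ℤ) *ˢ g) i ≡ 0ℤ
    *ˢ-zeroˡ g zero    = refl
    *ˢ-zeroˡ g (suc i) = cong (_+_ (0ℤ)) (*ˢ-zeroˡ g i)

    *ˢ-scale : ∀ a f g i → ((λ j → a * f j) *ˢ g) i ≡ a * (f *ˢ g) i
    *ˢ-scale a f g zero    = ℤₚ.*-assoc a (f 0) (g 0)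
    *ˢ-scale a f g (suc i) rewrite *ˢ-scale a (f ∘ suc) g i = lemma a (f 0) _ _
      where
      lemma : ∀ a x y z → a * x * y + a * z ≡ a * (x * y + z)
      lemma = solve-∀

    *ˢ-constant : ∀ a f g → f 0 ≡ a → (∀ i → f (suc i) ≡ 0ℤ) → ∀ i → (f *ˢ g) i ≡ a * g i
    *ˢ-constant a f g p q zero    = cong (_* g 0) p
    *ˢ-constant a f g p q (suc i) = begin
      f 0 * g (suc i) + ((f ∘ suc) *ˢ g) i    ≡⟨ cong₂ _+_ (cong (_* g (suc i)) p) (*ˢ-cong i {g = g} (λ {j} _ → q j) (λ _ → refl)) ⟩
      a * g (suc i) + ((λ _ → 0ℤ) *ˢ g) i     ≡⟨ cong (_+_ (a * g (suc i))) (*ˢ-zeroˡ g i) ⟩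
      a * g (suc i) + 0ℤ                      ≡⟨ ℤₚ.+-identityʳ _ ⟩
      a * g (suc i)                           ∎

    *ˢ-distribʳ : ∀ h f g i → ((λ j → f j + g j) *ˢ h) i ≡ (f *ˢ h) i + (g *ˢ h) i
    *ˢ-distribʳ h f g zero    = ℤₚ.*-distribʳ-+ (h 0) (f 0) (g 0)
    *ˢ-distribʳ h f g (suc i) rewrite *ˢ-distribʳ h (f ∘ suc) (g ∘ suc) i = lemma (f 0) (g 0) _ _ _
      where
      lemma : ∀ a b c d e → (a + b) * c + (d + e) ≡ (a * c + d) + (b * c + e)
      lemma = solve-∀

    private
      -- The definition peels off the first coefficient of the left factor. Peeling the right factor
      -- instead is the missing half of commutativity.
      *ˢ-sucʳ : ∀ f g i → (f *ˢ g) (suc i) ≡ f (suc i) * g 0 + (f *ˢ (g ∘ suc)) i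
      *ˢ-sucʳ f g zero    = ℤₚ.+-comm (f 0 * g 1) (f 1 * g 0)
      *ˢ-sucʳ f g (suc i) rewrite *ˢ-sucʳ (f ∘ suc) g i =
        lemma (f 0 * g (suc (suc i))) (f (suc (suc i)) * g 0) (((f ∘ suc) *ˢ (g ∘ suc)) i)
        where
        lemma : ∀ a b c → a + (b + c) ≡ b + (a + c)
        lemma = solve-∀

    *ˢ-comm : ∀ f g i → (f *ˢ g) i ≡ (g *ˢ f) i
    *ˢ-comm f g zero    = ℤₚ.*-comm (f 0) (g 0)
    *ˢ-comm f g (suc i) = trans (cong₂ _+_ (ℤₚ.*-comm (f 0) (g (suc i))) (*ˢ-comm (f ∘ suc) g i))
                                (sym (*ˢ-sucʳ g f i))

    *ˢ-assoc : ∀ f g h i → ((f *ˢ g) *ˢ h) i ≡ (f *ˢ (g *ˢ h)) i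
    *ˢ-assoc f g h zero    = ℤₚ.*-assoc (f 0) (g 0) (h 0)
    *ˢ-assoc f g h (suc i) = begin
      f 0 * g 0 * h (suc i) + ((λ j → f 0 * g (suc j) + ((f ∘ suc) *ˢ g) j) *ˢ h) i
        ≡⟨ cong (_+_ (f 0 * g 0 * h (suc i))) (*ˢ-distribʳ h (λ j → f 0 * g (suc j)) ((f ∘ suc) *ˢ g) i) ⟩
      f 0 * g 0 * h (suc i) + (((λ j → f 0 * g (suc j)) *ˢ h) i + (((f ∘ suc) *ˢ g) *ˢ h) i)
        ≡⟨ cong (_+_ (f 0 * g 0 * h (suc i))) (cong₂ _+_ (*ˢ-scale (f 0) (g ∘ suc) h i) (*ˢ-assoc (f ∘ suc) g h i)) ⟩
      f 0 * g 0 * h (suc i) + (f 0 * ((g ∘ suc) *ˢ h) i + ((f ∘ suc) *ˢ (g *ˢ h)) i)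
        ≡⟨ lemma (f 0) (g 0) _ _ _ ⟩
      f 0 * (g 0 * h (suc i) + ((g ∘ suc) *ˢ h) i) + ((f ∘ suc) *ˢ (g *ˢ h)) i ∎
      where
      lemma : ∀ a b c d e → a * b * c + (a * d + e) ≡ a * (b * c + d) + e
      lemma = solve-∀

  -- ℤ[[x]]/(xᴰ)
  truncated : ℕ → CommutativeSemiring 0ℓ 0ℓ
  truncated D = record
    { Carrier = Series
    ; _≈_     = λ f g → ∀ i → i < D → f i ≡ g i
    ; _+_     = λ f g i → f i + g i
    ; _*_     = _*ˢ_
    ; 0#      = λ _ → 0ℤ
    ; 1#      = one
    ; isCommutativeSemiring = isCommutativeSemiringˡ record
      { +-isCommutativeMonoid = record
        { isMonoid = record
          { isSemigroup = record
            { isMagma = record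
              { isEquivalence = isEquivalence′
              ; ∙-cong = λ p q i i<D → cong₂ _+_ (p i i<D) (q i i<D) }
            ; assoc = λ f g h i _ → ℤₚ.+-assoc (f i) (g i) (h i) }
          ; identity = (λ f i _ → ℤₚ.+-identityˡ (f i)) , (λ f i _ → ℤₚ.+-identityʳ (f i)) }
        ; comm = λ f g i _ → ℤₚ.+-comm (f i) (g i) }
      ; *-isCommutativeMonoid = record
        { isMonoid = record
          { isSemigroup = record
            { isMagma = record
              { isEquivalence = isEquivalence′
              ; ∙-cong = λ p q i i<D → *ˢ-cong i (λ j≤i → p _ (ℕₚ.≤-<-trans j≤i i<D))
                                                 (λ j≤i → q _ (ℕₚ.≤-<-trans j≤i i<D)) }
            ; assoc = λ f g h i _ → *ˢ-assoc f g h i }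
          ; identity = (λ f i _ → one-* f i) , (λ f i _ → trans (*ˢ-comm f one i) (one-* f i)) }
        ; comm = λ f g i _ → *ˢ-comm f g i }
      ; distribʳ = λ h f g i _ → *ˢ-distribʳ h f g i
      ; zeroˡ = λ g i _ → *ˢ-zeroˡ g i
      }
    }
    where
    isEquivalence′ : IsEquivalence (λ (f g : Series) → ∀ i → i < D → f i ≡ g i)
    isEquivalence′ = record
      { refl  = λ _ _ → refl
      ; sym   = λ p i i<D → sym (p i i<D)
      ; trans = λ p q i i<D → trans (p i i<D) (q i i<D) }

    one-* : ∀ f i → (one *ˢ f) i ≡ f i
    one-* f i = trans (*ˢ-constant 1ℤ one f refl (λ _ → refl) i) (ℤₚ.*-identityˡ (f i))

  ⟦_⟧ : ∀ {n} → Vec ℤ n → Series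
  ⟦ []    ⟧ _       = 0ℤ
  ⟦ a ∷ v ⟧ zero    = a
  ⟦ a ∷ v ⟧ (suc i) = ⟦ v ⟧ i

  scale : ∀ {n} → ℤ → Vec ℤ n → Vec ℤ n
  scale a = Vec.map (a *_)

  -- The sum, truncated to the length of the second argument.
  addTo : ∀ {m n} → Vec ℤ m → Vec ℤ n → Vec ℤ n
  addTo []      w       = w
  addTo (a ∷ v) []      = []
  addTo (a ∷ v) (b ∷ w) = a + b ∷ addTo v w

  multiply : ∀ {m n} → Vec ℤ m → Vec ℤ n → Vec ℤ m
  multiply []      w = []
  multiply (a ∷ v) w = addTo (scale a w) (0ℤ ∷ multiply v w)

  -- The quotient b / a modulo 2 of power series, when a has an odd constant term
  divide : ∀ {m} n → Vec ℤ n → Vec ℤ m → Vec ℤ n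
  divide zero    []      a = []
  divide (suc n) (b ∷ v) a = b ∷ divide n (Vec.tail (addTo (scale (- b) a) (b ∷ v))) a

  isEven : ℤ → Bool
  isEven a = does (a mod2^ 1 ℤₚ.≟ 0ℤ)

  -- Orders of vanishing modulo 2 are compared by dropping the constant terms, that is a factor `x`,
  -- as long as both are even. Once one of them is odd, its series is a unit modulo 2 and divides
  -- the other.
  ratio : ∀ {n} → Vec ℤ n → Vec ℤ n → Bool × Vec ℤ n
  ratioStep : ∀ {n} → Bool → Bool → Vec ℤ (suc n) → Vec ℤ (suc n) → Bool × Vec ℤ (suc n)
  ratio []      []      = true , []
  ratio (b ∷ g) (c ∷ a) = ratioStep (isEven b) (isEven c) (b ∷ g) (c ∷ a)
  -- Dropping `x` leaves the quotient one coefficient short. It is padded with 0, but any value is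
  -- right: that coefficient only ever meets an even constant term.
  ratioStep true  true  (b ∷ g) (c ∷ a) = proj₁ (ratio g a) , addTo (proj₂ (ratio g a)) (scale 0ℤ (b ∷ g))
  ratioStep true  false g       a       = false , divide _ g a
  ratioStep false _     g       a       = true , divide _ a g

  ⟦scale⟧ : ∀ {n} a (v : Vec ℤ n) i → ⟦ scale a v ⟧ i ≡ a * ⟦ v ⟧ i
  ⟦scale⟧ a []      i       = sym (ℤₚ.*-zeroʳ a)
  ⟦scale⟧ a (b ∷ v) zero    = refl
  ⟦scale⟧ a (b ∷ v) (suc i) = ⟦scale⟧ a v i

  ⟦addTo⟧ : ∀ {m n} (v : Vec ℤ m) (w : Vec ℤ n) i → i < n → ⟦ addTo v w ⟧ i ≡ ⟦ v ⟧ i + ⟦ w ⟧ i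
  ⟦addTo⟧ []      w       i       _         = sym (ℤₚ.+-identityˡ _)
  ⟦addTo⟧ (a ∷ v) (b ∷ w) zero    _         = refl
  ⟦addTo⟧ (a ∷ v) (b ∷ w) (suc i) (s≤s i<n) = ⟦addTo⟧ v w i i<n

  ⟦multiply⟧ : ∀ {m n} (v : Vec ℤ m) (w : Vec ℤ n) i → i < m → ⟦ multiply v w ⟧ i ≡ (⟦ v ⟧ *ˢ ⟦ w ⟧) i
  ⟦multiply⟧ (a ∷ v) w zero    i<m = trans (⟦addTo⟧ (scale a w) (0ℤ ∷ multiply v w) 0 i<m)
                                           (trans (ℤₚ.+-identityʳ _) (⟦scale⟧ a w 0))
  ⟦multiply⟧ (a ∷ v) w (suc i) (s≤s i<m) =
    trans (⟦addTo⟧ (scale a w) (0ℤ ∷ multiply v w) (suc i) (s≤s i<m))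
          (cong₂ _+_ (⟦scale⟧ a w (suc i)) (⟦multiply⟧ v w i i<m))

  infix 4 _≡₂_
  _≡₂_ : ℤ → ℤ → Set
  x ≡₂ y = Σ[ h ∈ ℤ ] y ≡ x + + 2 * h

  even⇒ : ∀ a → isEven a ≡ true → Σ[ h ∈ ℤ ] a ≡ + 2 * h
  even⇒ a = go (a mod2^ 1 ℤₚ.≟ 0ℤ)
    where
    go : (d : Dec (a mod2^ 1 ≡ 0ℤ)) → does d ≡ true → Σ[ h ∈ ℤ ] a ≡ + 2 * h
    go (yes r≡0) _ = a ℤ./ℕ 2 ,
      trans (a≡a%ℕn+[a/ℕn]*n a 2)
        (trans (cong (_+ (a ℤ./ℕ 2) * + 2) r≡0) (trans (ℤₚ.+-identityˡ _) (ℤₚ.*-comm (a ℤ./ℕ 2) (+ 2))))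
    go (no _)    ()

  odd⇒ : ∀ a → isEven a ≡ false → Σ[ h ∈ ℤ ] a ≡ 1ℤ + + 2 * h
  odd⇒ a = go (a mod2^ 1 ℤₚ.≟ 0ℤ)
    where
    remainder : ∀ r → r < 2 → r ≢ 0 → r ≡ 1
    remainder zero          _              r≢0 = ⊥-elim (r≢0 refl)
    remainder (suc zero)    _              r≢0 = refl
    remainder (suc (suc r)) (s≤s (s≤s ())) r≢0

    go : (d : Dec (a mod2^ 1 ≡ 0ℤ)) → does d ≡ false → Σ[ h ∈ ℤ ] a ≡ 1ℤ + + 2 * h
    go (yes _)  ()
    go (no r≢0) _ = a ℤ./ℕ 2 ,
      trans (a≡a%ℕn+[a/ℕn]*n a 2)
        (cong₂ _+_ (cong +_ (remainder (a ℤ.%ℕ 2) (n%ℕd<d a 2) (λ e → r≢0 (cong +_ e))))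
                   (ℤₚ.*-comm (a ℤ./ℕ 2) (+ 2)))

  -- Division by an odd number is the identity modulo 2, so long division takes `b` itself as the
  -- next quotient coefficient. The leading term `b - bc` of what is left is even and is dropped.
  divide-≡₂ : ∀ {m} n (b : Vec ℤ n) (a : Vec ℤ (suc m)) → isEven (⟦ a ⟧ 0) ≡ false →
              ∀ i → i < n → (⟦ divide n b a ⟧ *ˢ ⟦ a ⟧) i ≡₂ ⟦ b ⟧ i
  divide-≡₂ (suc n) (b ∷ v) (c ∷ a) odd zero _ =
    let (h , p) = odd⇒ c odd
    in - (b * h) , trans (lemma b h) (cong (λ c → b * c + + 2 * - (b * h)) (sym p))
    where
    lemma : ∀ b h → b ≡ b * (1ℤ + + 2 * h) + + 2 * - (b * h)
    lemma = solve-∀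
  divide-≡₂ (suc n) (b ∷ v) (c ∷ a) odd (suc i) (s≤s i<n) =
    let (h , p) = divide-≡₂ n _ (c ∷ a) odd i i<n
    in h , trans (lemma₁ b (⟦ a ⟧ i) (⟦ v ⟧ i))
           (trans (cong (_+_ (b * ⟦ a ⟧ i))
                    (trans (sym (trans (⟦addTo⟧ (scale (- b) a) v i i<n) (cong (_+ ⟦ v ⟧ i) (⟦scale⟧ (- b) a i)))) p))
                  (sym (ℤₚ.+-assoc (b * ⟦ a ⟧ i) _ _)))
    where
    lemma₁ : ∀ b a v → v ≡ b * a + (- b * a + v)
    lemma₁ = solve-∀

  ratio-≡₂ : ∀ {n} (g a : Vec ℤ n) →
    (proj₁ (ratio g a) ≡ true  → ∀ i → i < n → (⟦ g ⟧ *ˢ ⟦ proj₂ (ratio g a) ⟧) i ≡₂ ⟦ a ⟧ i) ×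
    (proj₁ (ratio g a) ≡ false → ∀ i → i < n → (⟦ a ⟧ *ˢ ⟦ proj₂ (ratio g a) ⟧) i ≡₂ ⟦ g ⟧ i)
  ratio-≡₂ [] [] = (λ _ _ ()) , (λ _ _ ())
  ratio-≡₂ {suc n} (b ∷ g) (c ∷ a) with isEven b in evb | isEven c in evc
  ... | false | _ = (λ _ i i<n → commuted i (divide-≡₂ _ (c ∷ a) (b ∷ g) evb i i<n)) , λ ()
    where
    commuted : ∀ i {y} → (⟦ divide (suc n) (c ∷ a) (b ∷ g) ⟧ *ˢ ⟦ b ∷ g ⟧) i ≡₂ y →
               (⟦ b ∷ g ⟧ *ˢ ⟦ divide (suc n) (c ∷ a) (b ∷ g) ⟧) i ≡₂ y
    commuted i {y} = subst (_≡₂ y) (*ˢ-comm ⟦ divide (suc n) (c ∷ a) (b ∷ g) ⟧ ⟦ b ∷ g ⟧ i)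
  ... | true | false = (λ ()) , λ _ i i<n → commuted i (divide-≡₂ _ (b ∷ g) (c ∷ a) evc i i<n)
    where
    commuted : ∀ i {y} → (⟦ divide (suc n) (b ∷ g) (c ∷ a) ⟧ *ˢ ⟦ c ∷ a ⟧) i ≡₂ y →
               (⟦ c ∷ a ⟧ *ˢ ⟦ divide (suc n) (b ∷ g) (c ∷ a) ⟧) i ≡₂ y
    commuted i {y} = subst (_≡₂ y) (*ˢ-comm ⟦ divide (suc n) (b ∷ g) (c ∷ a) ⟧ ⟦ c ∷ a ⟧ i)
  ... | true | true =
    (λ eq → shifted b g c a (even⇒ b evb) (even⇒ c evc) (proj₁ (ratio-≡₂ g a) eq)) ,
    (λ eq → shifted c a b g (even⇒ c evc) (even⇒ b evb) (proj₂ (ratio-≡₂ g a) eq))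
    where
    d = proj₂ (ratio g a)
    e = addTo d (scale 0ℤ (b ∷ g))
    ⟦e⟧ : ∀ i → i < suc n → ⟦ e ⟧ i ≡ ⟦ d ⟧ i
    ⟦e⟧ i i<n = trans (⟦addTo⟧ d (scale 0ℤ (b ∷ g)) i i<n)
                  (trans (cong (_+_ (⟦ d ⟧ i)) (trans (⟦scale⟧ 0ℤ (b ∷ g) i) (ℤₚ.*-zeroˡ (⟦ b ∷ g ⟧ i)))) (ℤₚ.+-identityʳ _))
    shifted : ∀ x (u : Vec ℤ n) y (v : Vec ℤ n) → Σ[ h ∈ ℤ ] x ≡ + 2 * h → Σ[ h ∈ ℤ ] y ≡ + 2 * h →
              (∀ i → i < n → (⟦ u ⟧ *ˢ ⟦ d ⟧) i ≡₂ ⟦ v ⟧ i) →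
              ∀ i → i < suc n → (⟦ x ∷ u ⟧ *ˢ ⟦ e ⟧) i ≡₂ ⟦ y ∷ v ⟧ i
    shifted x u y v (h , p) (h′ , q) ih zero _ = h′ + - (h * ⟦ e ⟧ 0) ,
      trans q (trans (lemma h h′ (⟦ e ⟧ 0)) (cong (λ x → x * ⟦ e ⟧ 0 + + 2 * (h′ + - (h * ⟦ e ⟧ 0))) (sym p)))
      where
      lemma : ∀ h h′ e → + 2 * h′ ≡ + 2 * h * e + + 2 * (h′ + - (h * e))
      lemma = solve-∀
    shifted x u y v (h , p) _ ih (suc i) (s≤s i<n) =
      let (h″ , r) = ih i i<n
          E = ⟦ e ⟧ (suc i)
      -- The constant term `x = 2h` contributes `2hE`, which the witness absorbs.
      in h″ + - (h * E) ,
         trans r (trans (cong (_+ + 2 * h″) (sym (*ˢ-cong i {⟦ u ⟧} (λ _ → refl)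
                           (λ j≤i → ⟦e⟧ _ (s≤s (ℕₚ.≤-trans j≤i (ℕₚ.<⇒≤ i<n)))))))
                 (trans (lemma h E ((⟦ u ⟧ *ˢ ⟦ e ⟧) i) h″)
                        (cong (λ x → x * E + (⟦ u ⟧ *ˢ ⟦ e ⟧) i + + 2 * (h″ + - (h * E))) (sym p))))
      where
      lemma : ∀ h E X h″ → X + + 2 * h″ ≡ + 2 * h * E + X + + 2 * (h″ + - (h * E))
      lemma = solve-∀

-- From polynomials as lists to truncated series and remainders modulo 2^k

module TruncatedCoefficients where

  open import Algebra.Bundles using (CommutativeSemiring)
  open import Data.Bool.Base using (true; false; if_then_else_)
  open import Data.Empty using (⊥-elim)
  open import Data.Fin.Base using (Fin)
  open import Data.Fin.Properties using () renaming (_<?_ to _<?ᶠ_)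
  open import Data.Integer.Base as ℤ using (ℤ; 0ℤ; 1ℤ; -1ℤ; +_; -[1+_]; _+_; _*_; -_)
  open import Data.Integer.DivMod using (n%ℕd<d; a≡a%ℕn+[a/ℕn]*n)
  import Data.Integer.Properties as ℤₚ
  open import Data.Integer.Tactic.RingSolver using (solve-∀)
  open import Data.List.Base as List using (List; []; _∷_; length; cartesianProduct; allFin)
  open import Data.List.Properties using (length-filter; length-++; length-map; length-tabulate)
  open import Data.List.Relation.Unary.All as All using (All; []; _∷_)
  open import Data.List.Relation.Unary.All.Properties using (map⁺; ++⁺; filter⁺)
  open import Data.Nat.Base as ℕ using (ℕ; zero; suc; _<_; _≤_; z≤n; s≤s; _^_)
  open import Data.Nat.DivMod using (m<n⇒m%n≡m)
  open import Data.Nat.Properties as ℕₚ using (_<?_; m^n≢0)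
  open import Data.Product.Base using (Σ-syntax; _×_; _,_; proj₁; proj₂)
  open import Data.Vec.Base as Vec using (Vec; []; _∷_)
  import Data.Vec.Properties as Vecₚ
  open import Relation.Binary.PropositionalEquality
  open import Relation.Nullary using (yes; no; Dec)
  open import Defs
  open SquarefreeAlgebra
  open ReductionIdentities
  open EliminationStep
  open MatchingSums
  open PowerSeries

  constant : ℤ → Series
  constant a zero    = a
  constant a (suc _) = 0ℤ

  constant-* : ∀ a f i → (constant a *ˢ f) i ≡ a * f i
  constant-* a f = *ˢ-constant a (constant a) f refl (λ _ → refl)

  zeroᵛ : ∀ n → Vec ℤ n
  zeroᵛ n = Vec.replicate n 0ℤ

  ⟦zeroᵛ⟧ : ∀ n i → ⟦ zeroᵛ n ⟧ i ≡ 0ℤ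
  ⟦zeroᵛ⟧ zero    i       = refl
  ⟦zeroᵛ⟧ (suc n) zero    = refl
  ⟦zeroᵛ⟧ (suc n) (suc i) = ⟦zeroᵛ⟧ n i

  -- Division yields a witness for each coefficient, whereas evenness in the ring asks for a single
  -- series of halves. Beyond the truncation its coefficients are set to 0.
  choice : ∀ {n} (Q : ℕ → ℤ → Set) → (∀ i → i < n → Σ[ h ∈ ℤ ] Q i h) →
           Σ[ h ∈ Series ] (∀ i → i < n → Q i (h i))
  choice {n} Q p = (λ i → pick′ i (i <? n)) , λ i i<n → spec i i<n (i <? n)
    where
    pick′ : ∀ i → Dec (i < n) → ℤ
    pick′ i (yes i<n) = proj₁ (p i i<n)
    pick′ i (no _)    = 0ℤ
    spec : ∀ i → i < n → (d : Dec (i < n)) → Q i (pick′ i d)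
    spec i i<n (yes i<n′) = proj₂ (p i i<n′)
    spec i i<n (no i≮n)   = ⊥-elim (i≮n i<n)

  module Coefficients (d : ℕ) where

    D : ℕ
    D = suc d

    open CommutativeSemiring (truncated D) using (_≈_) renaming (_*_ to _*′_; _+_ to _+′_)
    open Congruence (truncated D)

    𝟘 𝟙 : Vec ℤ D
    𝟘 = zeroᵛ D
    𝟙 = 1ℤ ∷ zeroᵛ d

    2#-constant : ∀ h i → (2# *ˢ h) i ≡ + 2 * h i
    2#-constant h = *ˢ-constant (+ 2) 2# h refl (λ _ → refl)

    2^-constant : ∀ k h i → (2^ k *ˢ h) i ≡ + (2 ^ k) * h i
    2^-constant zero    h i = constantly i
      where
      constantly : ∀ i → (one *ˢ h) i ≡ 1ℤ * h i
      constantly = *ˢ-constant 1ℤ one h refl (λ _ → refl)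
    2^-constant (suc k) h i = begin
      ((2# *ˢ 2^ k) *ˢ h) i       ≡⟨ *ˢ-assoc 2# (2^ k) h i ⟩
      (2# *ˢ (2^ k *ˢ h)) i       ≡⟨ 2#-constant (2^ k *ˢ h) i ⟩
      + 2 * (2^ k *ˢ h) i         ≡⟨ cong (+ 2 *_) (2^-constant k h i) ⟩
      + 2 * (+ (2 ^ k) * h i)     ≡⟨ sym (ℤₚ.*-assoc (+ 2) (+ (2 ^ k)) (h i)) ⟩
      + 2 * + (2 ^ k) * h i       ≡⟨ cong (_* h i) (sym (ℤₚ.pos-* 2 (2 ^ k))) ⟩
      + (2 ^ suc k) * h i         ∎
      where open ≡-Reasoning

    interpretation : Interpretation (truncated D) addTo multiply 𝟘 𝟙
    interpretation = record
      { ⟦_⟧   = ⟦_⟧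
      ; ⟨_⟩   = constant
      ; ⟦⊕⟧   = ⟦addTo⟧
      ; ⟦⊗⟧   = ⟦multiply⟧
      ; ⟦𝟘⟧   = λ i _ → ⟦zeroᵛ⟧ D i
      ; ⟦𝟙⟧   = λ { zero _ → refl ; (suc i) _ → ⟦zeroᵛ⟧ d i }
      ; ⟨1⟩   = λ { zero _ → refl ; (suc i) _ → refl }
      ; ⟨1*⟩  = λ { s zero _ → ℤₚ.*-identityˡ s ; s (suc i) _ → refl }
      ; ⟨-1*⟩ = λ { s zero _ → cancel s ; s (suc i) _ → refl }
      }
      where
      cancel : ∀ s → -1ℤ * s + s ≡ 0ℤ
      cancel = solve-∀

    even-residual : ∀ (g f a : Series) → (∀ i → i < D → (g *ˢ f) i ≡₂ a i) →
                    Even ((constant -1ℤ *′ (g *′ f)) +′ a)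
    even-residual g f a p =
      let (h , q) = choice (λ i h → a i ≡ (g *ˢ f) i + + 2 * h) p
      in h , λ i i<D → begin
        (constant -1ℤ *ˢ (g *ˢ f)) i + a i          ≡⟨ cong₂ _+_ (constant-* -1ℤ (g *ˢ f) i) (q i i<D) ⟩
        -1ℤ * (g *ˢ f) i + ((g *ˢ f) i + + 2 * h i)  ≡⟨ lemma ((g *ˢ f) i) (h i) ⟩
        + 2 * h i                                    ≡⟨ sym (2#-constant h i) ⟩
        (2# *ˢ h) i                                  ∎
      where
      open ≡-Reasoning
      lemma : ∀ x h → -1ℤ * x + (x + + 2 * h) ≡ + 2 * h
      lemma = solve-∀

    division : Division (truncated D) addTo multiply 𝟘 𝟙 scale ratio
    division = record
      { interpretation = interpretation
      ; ⟦⊙⟧            = λ s a i _ → trans (⟦scale⟧ s a i) (sym (constant-* s ⟦ a ⟧ i))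
      ; ⟨-2⟩           = λ { zero _ → refl ; (suc i) _ → refl }
      ; quotient       = λ g a → go g a (ratio g a) (ratio-≡₂ g a)
      }
      where
      go : ∀ (g a : Vec ℤ D) x →
        ((proj₁ x ≡ true  → ∀ i → i < D → (⟦ g ⟧ *ˢ ⟦ proj₂ x ⟧) i ≡₂ ⟦ a ⟧ i) ×
         (proj₁ x ≡ false → ∀ i → i < D → (⟦ a ⟧ *ˢ ⟦ proj₂ x ⟧) i ≡₂ ⟦ g ⟧ i)) →
        (if proj₁ x then Even ((constant -1ℤ *′ (⟦ g ⟧ *′ ⟦ proj₂ x ⟧)) +′ ⟦ a ⟧)
                    else Even ((constant -1ℤ *′ (⟦ a ⟧ *′ ⟦ proj₂ x ⟧)) +′ ⟦ g ⟧))
      go g a (true  , f) (p , _) = even-residual ⟦ g ⟧ ⟦ f ⟧ ⟦ a ⟧ (p refl)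
      go g a (false , f) (_ , p) = even-residual ⟦ a ⟧ ⟦ f ⟧ ⟦ g ⟧ (p refl)

    open HafnianAlgorithm addTo multiply 𝟘 𝟙 scale ratio public
    open Elimination addTo multiply 𝟘 𝟙 public

    pad : ∀ {n} → Vec ℤ n → Vec ℤ D
    pad v = addTo v 𝟘

  -- Uniqueness of remainders: they differ by a multiple `q` of `2 ^ k`, and a positive `q` pushes
  -- the first beyond `2 ^ k`, a negative one the second.
  mod2^-cong : ∀ k {a b} h → a ≡ b + + (2 ^ k) * h → a mod2^ k ≡ b mod2^ k
  mod2^-cong k {a} {b} h a≡b+2^kh = cong +_ (unique (h + b ℤ./ℕ 2 ^ k + - (a ℤ./ℕ 2 ^ k)) eq)
    where
    instance
      nonZero = m^n≢0 2 k
    r s : ℕ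
    r = a ℤ.%ℕ 2 ^ k
    s = b ℤ.%ℕ 2 ^ k
    eq : + r ≡ + s + (h + b ℤ./ℕ 2 ^ k + - (a ℤ./ℕ 2 ^ k)) * + (2 ^ k)
    eq = begin
      + r                                                     ≡⟨ lemma₁ (+ r) (a ℤ./ℕ 2 ^ k) (+ (2 ^ k)) ⟩
      (+ r + a ℤ./ℕ 2 ^ k * + (2 ^ k)) + - (a ℤ./ℕ 2 ^ k) * + (2 ^ k)
        ≡⟨ cong (_+ - (a ℤ./ℕ 2 ^ k) * + (2 ^ k)) (trans (sym (a≡a%ℕn+[a/ℕn]*n a (2 ^ k)))
             (trans a≡b+2^kh (cong (_+ + (2 ^ k) * h) (a≡a%ℕn+[a/ℕn]*n b (2 ^ k))))) ⟩
      ((+ s + b ℤ./ℕ 2 ^ k * + (2 ^ k)) + + (2 ^ k) * h) + - (a ℤ./ℕ 2 ^ k) * + (2 ^ k)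
        ≡⟨ lemma₂ (+ s) (b ℤ./ℕ 2 ^ k) (+ (2 ^ k)) h (a ℤ./ℕ 2 ^ k) ⟩
      + s + (h + b ℤ./ℕ 2 ^ k + - (a ℤ./ℕ 2 ^ k)) * + (2 ^ k) ∎
      where
      open ≡-Reasoning
      lemma₁ : ∀ r q t → r ≡ (r + q * t) + - q * t
      lemma₁ = solve-∀
      lemma₂ : ∀ s q t h p → ((s + q * t) + t * h) + - p * t ≡ s + (h + q + - p) * t
      lemma₂ = solve-∀
    absurd : ∀ n {u v} → u < 2 ^ k → u ≡ v ℕ.+ suc n ℕ.* 2 ^ k → u ≡ v
    absurd n {v = v} u< refl = ⊥-elim (ℕₚ.<⇒≱ u< (ℕₚ.≤-trans (ℕₚ.m≤m+n (2 ^ k) (n ℕ.* 2 ^ k)) (ℕₚ.m≤n+m _ v)))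
    unique : ∀ q → + r ≡ + s + q * + (2 ^ k) → r ≡ s
    unique (+ zero)   e = ℤₚ.+-injective (trans e (trans (cong (_+_ (+ s)) (ℤₚ.*-zeroˡ (+ (2 ^ k)))) (ℤₚ.+-identityʳ _)))
    unique (+ suc n)  e = absurd n (n%ℕd<d a (2 ^ k))
      (ℤₚ.+-injective (trans e (cong (_+_ (+ s)) (sym (ℤₚ.pos-* (suc n) (2 ^ k))))))
    unique -[1+ n ]   e = sym (absurd n (n%ℕd<d b (2 ^ k))
      (ℤₚ.+-injective (trans (lemma (+ s) (+ suc n) (+ (2 ^ k)))
        (trans (cong (_+ + suc n * + (2 ^ k)) (sym e)) (cong (_+_ (+ r)) (sym (ℤₚ.pos-* (suc n) (2 ^ k))))))))
      where
      lemma : ∀ s q t → s ≡ s + - q * t + q * t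
      lemma = solve-∀

  coeff-+ : ∀ p q i → coeff (p +ᵖ q) i ≡ coeff p i + coeff q i
  coeff-+ []      q       i       = sym (ℤₚ.+-identityˡ _)
  coeff-+ (a ∷ p) []      i       = sym (ℤₚ.+-identityʳ _)
  coeff-+ (a ∷ p) (b ∷ q) zero    = refl
  coeff-+ (a ∷ p) (b ∷ q) (suc i) = coeff-+ p q i

  coeff-map : ∀ (f : ℤ → ℤ) p i → f 0ℤ ≡ 0ℤ → coeff (List.map f p) i ≡ f (coeff p i)
  coeff-map f []      i       e = sym e
  coeff-map f (b ∷ p) zero    e = refl
  coeff-map f (b ∷ p) (suc i) e = coeff-map f p i e

  coeff-* : ∀ p q i → coeff (p *ᵖ q) i ≡ (coeff p *ˢ coeff q) i
  coeff-* []      q i       = sym (*ˢ-zeroˡ (coeff q) i)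
  coeff-* (a ∷ p) q zero    = trans (coeff-+ (List.map (a *_) q) _ 0)
    (trans (ℤₚ.+-identityʳ _) (coeff-map (a *_) q 0 (ℤₚ.*-zeroʳ a)))
  coeff-* (a ∷ p) q (suc i) = trans (coeff-+ (List.map (a *_) q) _ (suc i))
    (cong₂ _+_ (coeff-map (a *_) q (suc i) (ℤₚ.*-zeroʳ a)) (coeff-* p q i))

  coeff-toList : ∀ {n} (v : Vec ℤ n) i → coeff (Vec.toList v) i ≡ ⟦ v ⟧ i
  coeff-toList []      i       = refl
  coeff-toList (a ∷ v) zero    = refl
  coeff-toList (a ∷ v) (suc i) = coeff-toList v i

  coeff-beyond : ∀ p i → length p ≤ i → coeff p i ≡ 0ℤ
  coeff-beyond []      i       _         = refl
  coeff-beyond (a ∷ p) (suc i) (s≤s p≤i) = coeff-beyond p i p≤i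

  length-+ : ∀ p q {b} → length p ≤ b → length q ≤ b → length (p +ᵖ q) ≤ b
  length-+ []      q       _       q≤b     = q≤b
  length-+ (a ∷ p) []      p≤b     _       = p≤b
  length-+ (a ∷ p) (b ∷ q) (s≤s p≤b) (s≤s q≤b) = s≤s (length-+ p q p≤b q≤b)

  length-* : ∀ p q → length (p *ᵖ q) ≤ length p ℕ.+ length q
  length-* []      q = z≤n
  length-* (a ∷ p) q = length-+ (List.map (a *_) q) _
    (ℕₚ.≤-trans (ℕₚ.≤-reflexive (length-map (a *_) q)) (ℕₚ.m≤n+m (length q) (suc (length p))))
    (s≤s (length-* p q))

  length-sum : ∀ {b} {ps : List Poly} → All (λ p → length p ≤ b) ps → length (sumᵖ ps) ≤ b
  length-sum []       = z≤n
  length-sum {ps = p ∷ ps} (q ∷ qs) = length-+ p (sumᵖ ps) q (length-sum qs)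

  length-product : ∀ {A : Set} {b} (w : A → Poly) → (∀ x → length (w x) ≤ b) → ∀ M →
                   length (productᵖ (List.map w M)) ≤ suc (length M ℕ.* b)
  length-product w w≤b []      = s≤s z≤n
  length-product {b = b} w w≤b (x ∷ M) = begin
    length (w x *ᵖ productᵖ (List.map w M))        ≤⟨ length-* (w x) _ ⟩
    length (w x) ℕ.+ length (productᵖ (List.map w M)) ≤⟨ ℕₚ.+-mono-≤ (w≤b x) (length-product w w≤b M) ⟩
    b ℕ.+ suc (length M ℕ.* b)                     ≡⟨ ℕₚ.+-suc b (length M ℕ.* b) ⟩
    suc (b ℕ.+ length M ℕ.* b)                     ∎
    where open ℕₚ.≤-Reasoning

  length-sublists : ∀ {A : Set} (L : List A) → All (λ M → length M ≤ length L) (sublists L)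
  length-sublists []      = z≤n ∷ []
  length-sublists (x ∷ L) = ++⁺ (All.map ℕₚ.m≤n⇒m≤1+n (length-sublists L))
                                (map⁺ (All.map s≤s (length-sublists L)))

  length-pairs : ∀ m → length (pairs m) ≤ m ℕ.* m
  length-pairs m = begin
    length (pairs m)                                  ≤⟨ length-filter (λ p → proj₁ p <?ᶠ proj₂ p) (cartesianProduct (allFin m) (allFin m)) ⟩
    length (cartesianProduct (allFin m) (allFin m))   ≡⟨ length-cartesian (allFin m) ⟩
    length (allFin m) ℕ.* length (allFin m)           ≡⟨ cong (λ l → l ℕ.* l) (length-tabulate {n = m} (λ i → i)) ⟩
    m ℕ.* m                                           ∎
    where
    open ℕₚ.≤-Reasoning
    length-cartesian : ∀ (L : List (Fin m)) → length (cartesianProduct L (allFin m)) ≡ length L ℕ.* length (allFin m)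
    length-cartesian []      = refl
    length-cartesian (x ∷ L) = trans (length-++ (List.map (x ,_) (allFin m)))
      (cong₂ ℕ._+_ (length-map (x ,_) (allFin m)) (length-cartesian L))

  length-matchings : ∀ m → All (λ M → length M ≤ m ℕ.* m) (matchings m)
  length-matchings m = filter⁺ isPartition?
    (All.map (λ M≤ → ℕₚ.≤-trans M≤ (length-pairs m)) (length-sublists (pairs m)))

  module Reduced {n N : ℕ} (A : 𝒮 n N) where
    private m = 2 ℕ.* n

    -- A product over at most `m²` pairs has length at most `1 + m²(N + 1)`. This crude bound for
    -- the degree is chosen because a program can produce a list of exactly this length: all
    -- coefficients of the input matrix and one more.
    open Coefficients ((m ℕ.* m) ℕ.* suc N) public
    open Products (truncated D)
    open CommutativeSemiring (truncated D) using (_≈_; *-cong) renaming (refl to ≈-refl; sym to ≈-sym; trans to ≈-trans)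

    paddedEntry : Fin m → Fin m → Vec ℤ D
    paddedEntry i j = pad (𝒮.entry A i j)

    length-haf : length (haf A) ≤ D
    length-haf = length-sum (map⁺ (All.map
      (λ {M} M≤ → ℕₚ.≤-trans (length-product _ entry-length M) (s≤s (ℕₚ.*-monoˡ-≤ (suc N) M≤)))
      (length-matchings m)))
      where
      length-toList : ∀ {l} (v : Vec ℤ l) → length (Vec.toList v) ≤ l
      length-toList []      = z≤n
      length-toList (x ∷ v) = s≤s (length-toList v)
      entry-length : ∀ ((i , j) : Fin m × Fin m) → length (𝒮.poly A i j) ≤ suc N
      entry-length (i , j) = length-toList (𝒮.entry A i j)

    open Squarefree (truncated D) using (module Expansion)
    open Expansion (⟦_⟧ {D}) using () renaming (haf to recursiveHaf)

    coeff-haf : coeff (haf A) ≈ recursiveHaf (toTri m paddedEntry)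
    coeff-haf = ≈-trans (λ i _ → coeff-sum (matchings m) i)
      (≈-trans (∑-cong (All.universal coeff-product (matchings m)))
               (Matchings.∑-matchings≈haf (truncated D) ⟦_⟧ m paddedEntry))
      where
      w : Fin m × Fin m → Poly
      w (i , j) = 𝒮.poly A i j
      coeff-sum : ∀ L i → coeff (sumᵖ (List.map (λ M → productᵖ (List.map w M)) L)) i ≡
                          ∑ (λ M → coeff (productᵖ (List.map w M))) L i
      coeff-sum []      i = refl
      coeff-sum (M ∷ L) i = trans (coeff-+ (productᵖ (List.map w M)) _ i) (cong (_+_ (coeff (productᵖ (List.map w M)) i)) (coeff-sum L i))
      coeff-product : ∀ M → coeff (productᵖ (List.map w M)) ≈ ∏ (λ (i , j) → ⟦ paddedEntry i j ⟧) M
      coeff-product []            = λ { zero _ → refl ; (suc i) _ → refl }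
      coeff-product ((i , j) ∷ M) = ≈-trans
        (λ l _ → coeff-* (w (i , j)) (productᵖ (List.map w M)) l)
        (*-cong (λ l l<D → trans (coeff-toList (𝒮.entry A i j) l)
                   (sym (trans (⟦addTo⟧ (𝒮.entry A i j) 𝟘 l l<D)
                          (trans (cong (_+_ (⟦ 𝒮.entry A i j ⟧ l)) (⟦zeroᵛ⟧ D l)) (ℤₚ.+-identityʳ _)))))
                (coeff-product M))

    reduced : ℕ → Vec ℤ D
    reduced k = Vec.map (_mod2^ k) (hafnian k m (toTri m paddedEntry))

    -- Below `D` the congruence of `hafnian-correct` gives equal remainders; from `D` on both lists
    -- have ended, the hafnian by `length-haf`.
    reduced-correct : ∀ k → Vec.toList (reduced k) ≈ᵖ haf₂^ k A
    reduced-correct k i with i <? D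
    ... | no i≮D = trans (coeff-beyond (Vec.toList (reduced k)) i
                           (subst (_≤ i) (sym (Vecₚ.length-toList (reduced k))) (ℕₚ.≮⇒≥ i≮D)))
                   (sym (coeff-beyond (haf₂^ k A) i
                           (subst (_≤ i) (sym (length-map (_mod2^ k) (haf A))) (ℕₚ.≤-trans length-haf (ℕₚ.≮⇒≥ i≮D)))))
    ... | yes i<D =
      let (h , p) = Correctness.hafnian-correct (truncated D) addTo multiply 𝟘 𝟙 scale ratio division k m
                      (toTri m paddedEntry)
      in begin
        coeff (Vec.toList (reduced k)) i    ≡⟨ coeff-toList (reduced k) i ⟩
        ⟦ reduced k ⟧ i                     ≡⟨ ⟦map⟧ (hafnian k m (toTri m paddedEntry)) i i<D ⟩
        ⟦ hafnian k m (toTri m paddedEntry) ⟧ i mod2^ k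
          ≡⟨ sym (mod2^-cong k {b = ⟦ hafnian k m (toTri m paddedEntry) ⟧ i} (h i) (trans (coeff-haf i i<D) (trans (p i i<D) (cong (_+_ (⟦ hafnian k m (toTri m paddedEntry) ⟧ i)) (2^-constant k h i))))) ⟩
        coeff (haf A) i mod2^ k             ≡⟨ sym (coeff-map (_mod2^ k) (haf A) i (mod2^-cong-0 k)) ⟩
        coeff (haf₂^ k A) i                 ∎
      where
      open ≡-Reasoning
      open Congruence (truncated D) using (2^)
      ⟦map⟧ : ∀ {l} {f : ℤ → ℤ} (v : Vec ℤ l) i → i < l → ⟦ Vec.map f v ⟧ i ≡ f (⟦ v ⟧ i)
      ⟦map⟧ (x ∷ v) zero    _         = refl
      ⟦map⟧ (x ∷ v) (suc i) (s≤s i<l) = ⟦map⟧ v i i<l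
      mod2^-cong-0 : ∀ k → 0ℤ mod2^ k ≡ 0ℤ
      mod2^-cong-0 k = cong +_ (m<n⇒m%n≡m {{m^n≢0 2 k}} (ℕ.>-nonZero⁻¹ (2 ^ k) {{m^n≢0 2 k}}))

-- A cost calculus for the programming language

module RunningTimes where

  open import Data.Bool.Base using (T)
  open import Data.Integer.Base as ℤ using (ℤ; 0ℤ)
  open import Data.List.Base using ([]; _∷_)
  open import Data.List.Relation.Unary.All using ([]; _∷_; lookup)
  open import Data.Nat.Base using (ℕ; zero; suc; _+_; _*_; _≤_; _≤ᵇ_)
  open import Data.Nat.Properties
  open import Data.Product.Base using (Σ-syntax; _×_; _,_)
  open import Data.Sum.Base using (_⊎_; inj₁; inj₂)
  open import Relation.Binary.PropositionalEquality using (_≡_; _≢_; refl; sym; cong)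
  open import Defs

  infix 3 _·_⇓_within_
  -- Only an upper bound for the time is recorded, so that runs can be composed without exact step
  -- counts.
  data _·_⇓_within_ {σ τ} : Val (σ ⇒ τ) → Val σ → Val τ → ℕ → Set where
    applied : ∀ {Γ} {ρ : Env Γ} {b u v t T} →
              (u ∷ closᵛ ρ b ∷ ρ) ⊢ b ⇓ v [ t ] → t ≤ T → closᵛ ρ b · u ⇓ v within T

  -- A cost is recorded as n · X + x, where n counts evaluation rules and calls of
  -- cost at most X, and x collects the costs of the other calls.
  Post : Ty → Set₁
  Post τ = Val τ → ℕ → ℕ → Set

  -- A subroutine of cost at most `X` counts like one more rule. A recursive call brings its own
  -- bound `T`, since that depends on the size of the argument.
  data Call (X : ℕ) {σ τ} (w : Val (σ ⇒ τ)) (u : Val σ) (n x : ℕ) (Q : Post τ) : Set where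
    call  : ∀ {v} → w · u ⇓ v within X → Q v (suc n) x → Call X w u n x Q
    recur : ∀ {v T} → w · u ⇓ v within T → Q v n (T + x) → Call X w u n x Q

  onPair : ∀ {σ τ} {A : Set₁} → (Val σ → Val τ → A) → Val (σ ⊗ τ) → A
  onPair f (pairᵛ u v) = f u v

  onList : ∀ {σ} {A : Set₁} → A → (Val σ → Val (list σ) → A) → Val (list σ) → A
  onList a f (listᵛ [])       = a
  onList a f (listᵛ (u ∷ us)) = f u (listᵛ us)

  onNat : ∀ {A : Set₁} → (ℕ → A) → Val nat → A
  onNat f (natᵛ m) = f m

  onInt : ∀ {A : Set₁} → (ℤ → A) → Val int → A
  onInt f (intᵛ a) = f a

  onSuc : ∀ {A : Set₁} → A → (ℕ → A) → ℕ → A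
  onSuc a f zero    = a
  onSuc a f (suc m) = f m

  consᵛ : ∀ {σ} → Val σ → Val (list σ) → Val (list σ)
  consᵛ u (listᵛ us) = listᵛ (u ∷ us)

  -- Symbolic execution in continuation style. For a concrete body it reduces to a nest of `Call`s,
  -- so a run is proved by listing the runs of the called closures in order of evaluation.
  wp : (X : ℕ) → ∀ {Γ τ} → Env Γ → Tm Γ τ → ℕ → ℕ → Post τ → Set
  wp X ρ (var v)        n x Q = Q (lookup ρ v) (suc n) x
  wp X ρ (let′ d e)     n x Q = wp X ρ d (suc n) x λ u n x → wp X (u ∷ ρ) e n x Q
  wp X ρ (fun b)        n x Q = Q (closᵛ ρ b) (suc n) x
  wp X ρ (app d e)      n x Q = wp X ρ d (suc n) x λ w n x → wp X ρ e n x λ u n x → Call X w u n x Q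
  wp X ρ (pair d e)     n x Q = wp X ρ d (suc n) x λ u n x → wp X ρ e n x λ v n x → Q (pairᵛ u v) n x
  wp X ρ (fst e)        n x Q = wp X ρ e (suc n) x λ w n x → onPair (λ u v → Q u n x) w
  wp X ρ (snd e)        n x Q = wp X ρ e (suc n) x λ w n x → onPair (λ u v → Q v n x) w
  wp X ρ nil            n x Q = Q (listᵛ []) (suc n) x
  wp X ρ (cons d e)     n x Q = wp X ρ d (suc n) x λ u n x → wp X ρ e n x λ us n x → Q (consᵛ u us) n x
  wp X ρ (caseL c d e)  n x Q = wp X ρ c (suc n) x λ w n x →
    onList (wp X ρ d n x Q) (λ u us → wp X (u ∷ us ∷ ρ) e n x Q) w
  wp X ρ ze             n x Q = Q (natᵛ 0) (suc n) x
  wp X ρ (su e)         n x Q = wp X ρ e (suc n) x λ w n x → onNat (λ m → Q (natᵛ (suc m)) n x) w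
  wp X ρ (caseN c d e)  n x Q = wp X ρ c (suc n) x λ w n x →
    onNat (onSuc (wp X ρ d n x Q) (λ m → wp X (natᵛ m ∷ ρ) e n x Q)) w
  wp X ρ (lit a)        n x Q = Q (intᵛ a) (suc n) x
  wp X ρ (add d e)      n x Q = wp X ρ d (suc n) x λ v n x → wp X ρ e n x λ w n x →
    onInt (λ a → onInt (λ b → Q (intᵛ (a ℤ.+ b)) n x) w) v
  wp X ρ (mul d e)      n x Q = wp X ρ d (suc n) x λ v n x → wp X ρ e n x λ w n x →
    onInt (λ a → onInt (λ b → Q (intᵛ (a ℤ.* b)) n x) w) v
  wp X ρ (neg e)        n x Q = wp X ρ e (suc n) x λ w n x → onInt (λ a → Q (intᵛ (ℤ.- a)) n x) w
  wp X ρ (reduce d e)   n x Q = wp X ρ d (suc n) x λ v n x → wp X ρ e n x λ w n x →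
    onInt (λ a → onNat (λ j → Q (intᵛ (a mod2^ j)) n x) w) v
  wp X ρ (ifZero c d e) n x Q = wp X ρ c (suc n) x λ w n x →
    onInt (λ a → (a ≡ 0ℤ × wp X ρ d n x Q) ⊎ (a ≢ 0ℤ × wp X ρ e n x Q)) w

  -- Here `b` and `c` are the accumulated bounds before and after; in additive form the steps chain
  -- without subtraction. Being a data type, it lets unification recover its arguments.
  data Spent (t b c : ℕ) : Set where
    spent : t + b ≤ c → Spent t b c

  record Result (X : ℕ) {Γ τ} (ρ : Env Γ) (e : Tm Γ τ) (n x : ℕ) (Q : Post τ) : Set where
    constructor result
    field
      {value}   : Val τ
      {time}    : ℕ
      {n′ x′}   : ℕ
      run       : ρ ⊢ e ⇓ value [ time ]
      post      : Q value n′ x′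
      cost      : Spent time (n * X + x) (n′ * X + x′)

  private
    combine : ∀ {s t b c d} → Spent s b c → Spent t c d → Spent (s + t) b d
    combine {s} {t} {b} {c} {d} (spent p) (spent q) = spent (begin
      s + t + b    ≡⟨ cong (_+ b) (+-comm s t) ⟩
      t + s + b    ≡⟨ +-assoc t s b ⟩
      t + (s + b)  ≤⟨ +-monoʳ-≤ t p ⟩
      t + c        ≤⟨ q ⟩
      d            ∎)
      where open ≤-Reasoning

    tick : ∀ {t X} n x → t ≤ X → Spent t (n * X + x) (suc n * X + x)
    tick {t} {X} n x p = spent (begin
      t + (n * X + x)  ≤⟨ +-monoˡ-≤ _ p ⟩
      X + (n * X + x)  ≡⟨ sym (+-assoc X (n * X) x) ⟩
      suc n * X + x    ∎)
      where open ≤-Reasoning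

    extra : ∀ {t T} X n x → t ≤ T → Spent t (n * X + x) (n * X + (T + x))
    extra {t} {T} X n x p = spent (begin
      t + (n * X + x)  ≤⟨ +-monoˡ-≤ _ p ⟩
      T + (n * X + x)  ≡⟨ sym (+-assoc T (n * X) x) ⟩
      T + n * X + x    ≡⟨ cong (_+ x) (+-comm T (n * X)) ⟩
      n * X + T + x    ≡⟨ +-assoc (n * X) T x ⟩
      n * X + (T + x)  ∎)
      where open ≤-Reasoning

  sound : ∀ {X} → 1 ≤ X → ∀ {Γ τ} {ρ : Env Γ} (e : Tm Γ τ) {n x Q} →
          wp X ρ e n x Q → Result X ρ e n x Q
  sound 1≤X (var v) {n} {x} p = result ⇓var p (tick n x 1≤X)
  sound 1≤X (let′ d e) {n} {x} p with sound 1≤X d p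
  ... | result r q c with sound 1≤X e q
  ... | result r′ q′ c′ = result (⇓let r r′) q′ (combine (combine (tick {1} n x 1≤X) c) c′)
  sound 1≤X (fun b) {n} {x} p = result ⇓fun p (tick n x 1≤X)
  sound {X} 1≤X (app d e) {n} {x} p with sound 1≤X d p
  ... | result r q c with sound 1≤X e q
  ... | result {n′ = m} {x′ = y} r′ (call (applied s s≤X) z) c′ =
    result (⇓app r r′ s) z (combine (combine (combine (tick {1} n x 1≤X) c) c′) (tick m y s≤X))
  ... | result {n′ = m} {x′ = y} r′ (recur (applied s s≤T) z) c′ =
    result (⇓app r r′ s) z (combine (combine (combine (tick {1} n x 1≤X) c) c′) (extra X m y s≤T))
  sound 1≤X (pair d e) {n} {x} p with sound 1≤X d p
  ... | result r q c with sound 1≤X e q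
  ... | result r′ q′ c′ = result (⇓pair r r′) q′ (combine (combine (tick {1} n x 1≤X) c) c′)
  sound 1≤X (fst e) {n} {x} p with sound 1≤X e p
  ... | result {value = pairᵛ u v} r q c = result (⇓fst r) q (combine (tick {1} n x 1≤X) c)
  sound 1≤X (snd e) {n} {x} p with sound 1≤X e p
  ... | result {value = pairᵛ u v} r q c = result (⇓snd r) q (combine (tick {1} n x 1≤X) c)
  sound 1≤X nil {n} {x} p = result ⇓nil p (tick n x 1≤X)
  sound 1≤X (cons d e) {n} {x} p with sound 1≤X d p
  ... | result r q c with sound 1≤X e q
  ... | result {value = listᵛ us} r′ q′ c′ = result (⇓cons r r′) q′ (combine (combine (tick {1} n x 1≤X) c) c′)
  sound 1≤X (caseL a d e) {n} {x} p with sound 1≤X a p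
  ... | result {value = listᵛ []} r q c with sound 1≤X d q
  ...   | result r′ q′ c′ = result (⇓caseL-[] r r′) q′ (combine (combine (tick {1} n x 1≤X) c) c′)
  sound 1≤X (caseL a d e) {n} {x} p | result {value = listᵛ (u ∷ us)} r q c with sound 1≤X e q
  ...   | result r′ q′ c′ = result (⇓caseL-∷ r r′) q′ (combine (combine (tick {1} n x 1≤X) c) c′)
  sound 1≤X ze {n} {x} p = result ⇓ze p (tick n x 1≤X)
  sound 1≤X (su e) {n} {x} p with sound 1≤X e p
  ... | result {value = natᵛ m} r q c = result (⇓su r) q (combine (tick {1} n x 1≤X) c)
  sound 1≤X (caseN a d e) {n} {x} p with sound 1≤X a p
  ... | result {value = natᵛ zero} r q c with sound 1≤X d q
  ...   | result r′ q′ c′ = result (⇓caseN-ze r r′) q′ (combine (combine (tick {1} n x 1≤X) c) c′)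
  sound 1≤X (caseN a d e) {n} {x} p | result {value = natᵛ (suc m)} r q c with sound 1≤X e q
  ...   | result r′ q′ c′ = result (⇓caseN-su r r′) q′ (combine (combine (tick {1} n x 1≤X) c) c′)
  sound 1≤X (lit a) {n} {x} p = result ⇓lit p (tick n x 1≤X)
  sound 1≤X (add d e) {n} {x} p with sound 1≤X d p
  ... | result {value = intᵛ a} r q c with sound 1≤X e q
  ... | result {value = intᵛ b} r′ q′ c′ = result (⇓add r r′) q′ (combine (combine (tick {1} n x 1≤X) c) c′)
  sound 1≤X (mul d e) {n} {x} p with sound 1≤X d p
  ... | result {value = intᵛ a} r q c with sound 1≤X e q
  ... | result {value = intᵛ b} r′ q′ c′ = result (⇓mul r r′) q′ (combine (combine (tick {1} n x 1≤X) c) c′)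
  sound 1≤X (neg e) {n} {x} p with sound 1≤X e p
  ... | result {value = intᵛ a} r q c = result (⇓neg r) q (combine (tick {1} n x 1≤X) c)
  sound 1≤X (reduce d e) {n} {x} p with sound 1≤X d p
  ... | result {value = intᵛ a} r q c with sound 1≤X e q
  ... | result {value = natᵛ b} r′ q′ c′ = result (⇓reduce r r′) q′ (combine (combine (tick {1} n x 1≤X) c) c′)
  sound 1≤X (ifZero a d e) {n} {x} p with sound 1≤X a p
  ... | result {value = intᵛ a} r (inj₁ (refl , q)) c with sound 1≤X d q
  ...   | result r′ q′ c′ = result (⇓ifZero-yes r r′) q′ (combine (combine (tick {1} n x 1≤X) c) c′)
  sound 1≤X (ifZero a d e) {n} {x} p | result {value = intᵛ a′} r (inj₂ (a≢0 , q)) c with sound 1≤X e q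
  ...   | result r′ q′ c′ = result (⇓ifZero-no r a≢0 r′) q′ (combine (combine (tick {1} n x 1≤X) c) c′)

  data Bounded (X n x T : ℕ) : Set where
    bounded : n * X + x ≤ T → Bounded X n x T

  Returns : ∀ {τ} → ℕ → Val τ → ℕ → Post τ
  Returns X v T v′ n x = v′ ≡ v × Bounded X n x T

  weaken : ∀ {σ τ} {w : Val (σ ⇒ τ)} {u v S T} → S ≤ T → w · u ⇓ v within S → w · u ⇓ v within T
  weaken S≤T (applied r t≤S) = applied r (≤-trans t≤S S≤T)

  evaluates : ∀ {X} → 1 ≤ X → ∀ {Γ τ} {ρ : Env Γ} (e : Tm Γ τ) {v T} →
              wp X ρ e 0 0 (Returns X v T) → Σ[ t ∈ ℕ ] (ρ ⊢ e ⇓ v [ t ] × t ≤ T)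
  evaluates 1≤X e p with sound 1≤X e p
  ... | result {time = t} r (refl , bounded c) (spent c′) = t , r , ≤-trans (≤-trans (m≤m+n _ _) c′) c

  verify : ∀ {X} → 1 ≤ X → ∀ {Γ σ τ} {ρ : Env Γ} {b : Tm (σ ∷ (σ ⇒ τ) ∷ Γ) τ} {u v T} →
           wp X (u ∷ closᵛ ρ b ∷ ρ) b 0 0 (Returns X v T) → closᵛ ρ b · u ⇓ v within T
  verify 1≤X {b = b} p = let (_ , r , t≤T) = evaluates 1≤X b p in applied r t≤T

  abstract
    -- The number 1000 exceeds the count of rules and calls in each body; `once`, `stop` and `again`
    -- have this checked by computation.
    straightCost : ℕ → ℕ
    straightCost X = 1000 * X

    loopCost : ℕ → ℕ → ℕ
    loopCost X ℓ = suc ℓ * straightCost X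

    once : ∀ {X n} {_ : T (n ≤ᵇ 1000)} → Bounded X n 0 (straightCost X)
    once {X} {n} {p} = bounded (≤-trans (≤-reflexive (+-identityʳ (n * X))) (*-monoˡ-≤ X (≤ᵇ⇒≤ n 1000 p)))

    stop : ∀ {X n ℓ} {_ : T (n ≤ᵇ 1000)} → Bounded X n 0 (loopCost X ℓ)
    stop {X} {n} {ℓ} {p} with once {X} {n} {p}
    ... | bounded q = bounded (≤-trans q (m≤m+n (straightCost X) (ℓ * straightCost X)))

    again : ∀ {X n ℓ} {_ : T (n ≤ᵇ 1000)} → Bounded X n (loopCost X ℓ + 0) (loopCost X (suc ℓ))
    again {X} {n} {ℓ} {p} = bounded (+-mono-≤ (*-monoˡ-≤ X (≤ᵇ⇒≤ n 1000 p)) (≤-reflexive (+-identityʳ _)))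

    straightCost-≤ : ∀ {X Z} → 1000 ≤ Z → straightCost X ≤ Z * X
    straightCost-≤ {X} p = *-monoˡ-≤ X p

    loopCost-≤ : ∀ {X ℓ Y Z} → suc ℓ ≤ Y → 1000 ≤ Z → loopCost X ℓ ≤ Y * (Z * X)
    loopCost-≤ {X} p q = *-mono-≤ p (*-monoˡ-≤ X q)

-- The program

module Programs where

  open import Data.Integer.Base using (0ℤ; 1ℤ; -1ℤ; +_; -_)
  open import Data.List.Base using (_∷_)
  open import Data.List.Relation.Unary.Any using (here; there)
  open import Relation.Binary.PropositionalEquality using (refl)
  open import Defs

  module _ {Γ : Cx} where

    v₀ : ∀ {a} → Tm (a ∷ Γ) a
    v₀ = var (here refl)

    v₁ : ∀ {a b} → Tm (b ∷ a ∷ Γ) a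
    v₁ = var (there (here refl))

    v₂ : ∀ {a b c} → Tm (c ∷ b ∷ a ∷ Γ) a
    v₂ = var (there (there (here refl)))

    v₃ : ∀ {a b c d} → Tm (d ∷ c ∷ b ∷ a ∷ Γ) a
    v₃ = var (there (there (there (here refl))))

    v₄ : ∀ {a b c d e} → Tm (e ∷ d ∷ c ∷ b ∷ a ∷ Γ) a
    v₄ = var (there (there (there (there (here refl)))))

    v₅ : ∀ {a b c d e f} → Tm (f ∷ e ∷ d ∷ c ∷ b ∷ a ∷ Γ) a
    v₅ = var (there (there (there (there (there (here refl))))))

    v₆ : ∀ {a b c d e f g} → Tm (g ∷ f ∷ e ∷ d ∷ c ∷ b ∷ a ∷ Γ) a
    v₆ = var (there (there (there (there (there (there (here refl)))))))

    v₇ : ∀ {a b c d e f g h} → Tm (h ∷ g ∷ f ∷ e ∷ d ∷ c ∷ b ∷ a ∷ Γ) a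
    v₇ = var (there (there (there (there (there (there (there (here refl))))))))

    v₈ : ∀ {a b c d e f g h i} → Tm (i ∷ h ∷ g ∷ f ∷ e ∷ d ∷ c ∷ b ∷ a ∷ Γ) a
    v₈ = var (there (there (there (there (there (there (there (there (here refl)))))))))

    v₉ : ∀ {a b c d e f g h i j} → Tm (j ∷ i ∷ h ∷ g ∷ f ∷ e ∷ d ∷ c ∷ b ∷ a ∷ Γ) a
    v₉ = var (there (there (there (there (there (there (there (there (there (here refl))))))))))

    v₁₀ : ∀ {a b c d e f g h i j k} → Tm (k ∷ j ∷ i ∷ h ∷ g ∷ f ∷ e ∷ d ∷ c ∷ b ∷ a ∷ Γ) a
    v₁₀ = var (there (there (there (there (there (there (there (there (there (there (here refl)))))))))))

    v₁₁ : ∀ {a b c d e f g h i j k l} → Tm (l ∷ k ∷ j ∷ i ∷ h ∷ g ∷ f ∷ e ∷ d ∷ c ∷ b ∷ a ∷ Γ) a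
    v₁₁ = var (there (there (there (there (there (there (there (there (there (there (there (here refl))))))))))))

  Body : Cx → Ty → Ty → Set
  Body Γ σ τ = Tm (σ ∷ (σ ⇒ τ) ∷ Γ) τ

  rowTy triTy weightedTy pivotTy : Ty
  rowTy      = list polyTy
  triTy      = list rowTy
  weightedTy = list (int ⊗ triTy)
  pivotTy    = (polyTy ⊗ rowTy) ⊗ nat

  -- In a body v₀ is the argument and v₁ the function itself; caseL shifts both by
  -- two and caseN, let′ by one.
  module _ {Γ : Cx} where

    mapᵇ : ∀ {σ τ} → Body Γ ((σ ⇒ τ) ⊗ list σ) (list τ)
    mapᵇ = caseL (snd v₀) nil (cons (app (fst v₂) v₀) (app v₃ (pair (fst v₂) v₁)))

    appendᵇ : ∀ {σ} → Body Γ (list σ ⊗ list σ) (list σ)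
    appendᵇ = caseL (fst v₀) (snd v₀) (cons v₀ (app v₃ (pair v₁ (snd v₂))))

    tailᵇ : ∀ {σ} → Body Γ (list σ) (list σ)
    tailᵇ = caseL v₀ nil v₁

    addᵇ : Body Γ (polyTy ⊗ polyTy) polyTy
    addᵇ = caseL (fst v₀) (snd v₀)
      (caseL (snd v₂) nil (cons (add v₂ v₀) (app v₅ (pair v₃ v₁))))

  -- The language has no top-level definitions: a subroutine is inserted as a fresh closure under
  -- binders and must exist in every context. Each layer is therefore a module that generalises over
  -- `Γ` anew.
  module _ {Γ : Cx} where

    concatᵇ : ∀ {σ} → Body Γ (list (list σ)) (list σ)
    concatᵇ = caseL v₀ nil (app (fun appendᵇ) (pair v₀ (app v₃ v₁)))

    scaleᵇ : Body Γ (int ⊗ polyTy) polyTy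
    scaleᵇ = app (fun mapᵇ) (pair (fun (mul (fst v₂) v₀)) (snd v₀))

  module _ {Γ : Cx} where

    multiplyᵇ : Body Γ (polyTy ⊗ polyTy) polyTy
    multiplyᵇ = caseL (fst v₀) nil
      (app (fun addᵇ) (pair (app (fun scaleᵇ) (pair v₀ (snd v₂)))
                            (cons (lit 0ℤ) (app v₃ (pair v₁ (snd v₂))))))

    divideᵇ : Body Γ (polyTy ⊗ polyTy) polyTy
    divideᵇ = caseL (fst v₀) nil
      (cons v₀ (app v₃ (pair
        (app (fun tailᵇ) (app (fun addᵇ) (pair (app (fun scaleᵇ) (pair (neg v₀) (snd v₂))) (cons v₀ v₁))))
        (snd v₂))))

    -- The length `D` is known to the program only through a zero polynomial of that length, which
    -- is handed down to the subroutines as their source of 0 and 1.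
    oneᵇ : Body Γ polyTy polyTy
    oneᵇ = cons (lit 1ℤ) (app (fun tailᵇ) v₀)

  module _ {Γ : Cx} where

    -- The truth value is an integer with 0 for true, because the test for 0 is the only test on
    -- integers; parity is reduction modulo `2¹` followed by that test.
    ratioᵇ : Body Γ (polyTy ⊗ polyTy) (int ⊗ polyTy)
    ratioᵇ = caseL (fst v₀) (pair (lit 0ℤ) nil) (caseL (snd v₂) (pair (lit 0ℤ) nil)
      (ifZero (reduce v₂ (su ze))
        (ifZero (reduce v₀ (su ze))
          (let′ (app v₅ (pair v₃ v₁))
            (pair (fst v₀) (app (fun addᵇ) (pair (snd v₀) (app (fun scaleᵇ) (pair (lit 0ℤ) (fst v₅)))))))
          (pair (lit 1ℤ) (app (fun divideᵇ) (pair (fst v₄) (snd v₄)))))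
        (pair (lit 0ℤ) (app (fun divideᵇ) (pair (snd v₄) (fst v₄))))))

    mulRowᵇ : Body Γ (polyTy ⊗ rowTy) rowTy
    mulRowᵇ = app (fun mapᵇ) (pair (fun (app (fun multiplyᵇ) (pair (fst v₂) v₀))) (snd v₀))

    addRowᵇ : Body Γ (rowTy ⊗ rowTy) rowTy
    addRowᵇ = caseL (fst v₀) nil (caseL (snd v₂) nil
      (cons (app (fun addᵇ) (pair v₂ v₀)) (app v₅ (pair v₃ v₁))))

    zerosᵇ : Body Γ (polyTy ⊗ rowTy) rowTy
    zerosᵇ = app (fun mapᵇ) (pair (fun (fst v₂)) (snd v₀))

    consAllᵇ : Body Γ (int ⊗ (rowTy ⊗ weightedTy)) weightedTy
    consAllᵇ = app (fun mapᵇ) (pair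
      (fun (pair (mul (fst v₂) (fst v₀)) (cons (fst (snd v₂)) (snd v₀))))
      (snd (snd v₀)))

  module _ {Γ : Cx} where

    markᵇ : Body Γ (polyTy ⊗ (rowTy ⊗ weightedTy)) weightedTy
    markᵇ = app (fun appendᵇ) (pair
      (app (fun consAllᵇ) (pair (lit 1ℤ) (snd v₀)))
      (app (fun consAllᵇ) (pair (lit -1ℤ)
        (pair (app (fun zerosᵇ) (pair (fst v₀) (fst (snd v₀)))) (snd (snd v₀))))))

    newRowᵇ : Body Γ ((polyTy ⊗ rowTy) ⊗ ((polyTy ⊗ rowTy) ⊗ rowTy)) rowTy
    newRowᵇ = app (fun addRowᵇ) (pair
      (app (fun addRowᵇ) (pair
        (app (fun mulRowᵇ) (pair (fst (fst v₀)) (snd (fst (snd v₀)))))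
        (app (fun mulRowᵇ) (pair (fst (fst (snd v₀))) (snd (fst v₀))))))
      (snd (snd v₀)))

  module _ {Γ : Cx} where

    quadᵇ : Body Γ (polyTy ⊗ (rowTy ⊗ triTy)) weightedTy
    quadᵇ = caseL (fst (snd v₀)) nil (caseL (snd (snd v₂)) nil
      (app (fun appendᵇ) (pair
        (app (fun markᵇ) (pair (fst v₄) (pair (app (fun mulRowᵇ) (pair v₂ v₃)) (cons (pair (lit 1ℤ) v₁) nil))))
        (app (fun consAllᵇ) (pair (lit 1ℤ) (pair v₀ (app v₅ (pair (fst v₄) (pair v₃ v₁)))))))))

    updateᵇ : Body Γ (rowTy ⊗ (rowTy ⊗ triTy)) triTy
    updateᵇ = caseL (fst v₀) nil (caseL (fst (snd v₂)) nil (caseL (snd (snd v₄)) nil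
      (cons (app (fun newRowᵇ) (pair (pair v₄ v₅) (pair (pair v₂ v₃) v₀)))
            (app v₇ (pair v₅ (pair v₃ v₁))))))

  module _ {Γ : Cx} where

    crossᵇ : Body Γ (polyTy ⊗ (rowTy ⊗ (rowTy ⊗ triTy))) weightedTy
    crossᵇ = caseL (fst (snd v₀)) nil (caseL (fst (snd (snd v₂))) nil (caseL (snd (snd (snd v₄))) nil
      (app (fun appendᵇ) (pair
        (app (fun markᵇ) (pair (fst v₆) (pair (app (fun mulRowᵇ) (pair v₄ v₅))
                                              (app (fun quadᵇ) (pair (fst v₆) (pair v₃ v₁))))))
        (app (fun appendᵇ) (pair
          (app (fun markᵇ) (pair (fst v₆) (pair (app (fun mulRowᵇ) (pair v₂ v₃))
                                                (app (fun quadᵇ) (pair (fst v₆) (pair v₅ v₁))))))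
          (app (fun consAllᵇ) (pair (lit 1ℤ) (pair
            (app (fun newRowᵇ) (pair (pair v₄ v₅) (pair (pair v₂ v₃) v₀)))
            (app v₇ (pair (fst v₆) (pair v₅ (pair v₃ v₁)))))))))))))

    unitsᵇ : Body Γ (polyTy ⊗ rowTy) (list (polyTy ⊗ rowTy))
    unitsᵇ = caseL (snd v₀) nil (cons
      (pair v₀ (cons (app (fun oneᵇ) (fst v₂)) (app (fun zerosᵇ) (pair (fst v₂) v₁))))
      (app (fun mapᵇ) (pair (fun (pair (fst v₀) (cons (fst v₄) (snd v₀)))) (app v₃ (pair (fst v₂) v₁)))))

    pickᵇ : Body Γ (nat ⊗ rowTy) (polyTy ⊗ rowTy)
    pickᵇ = caseL (snd v₀) (pair nil nil) (caseN (fst v₂) (pair v₀ v₁)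
      (let′ (app v₄ (pair v₀ v₂)) (pair (fst v₀) (cons v₂ (snd v₀)))))

  module _ {Γ : Cx} where

    pullᵇ : Body Γ (nat ⊗ triTy) (rowTy ⊗ triTy)
    pullᵇ = caseL (snd v₀) (pair nil nil) (caseN (fst v₂) (pair v₀ v₁)
      (let′ (app (fun pickᵇ) (pair v₀ v₁)) (let′ (app v₅ (pair v₁ v₃))
        (pair (cons (fst v₁) (fst v₀)) (cons (snd v₁) (snd v₀))))))

    pivotᵇ : Body Γ (polyTy ⊗ rowTy) pivotTy
    pivotᵇ = caseL (snd v₀) (pair (pair nil nil) ze) (caseL v₁
      (pair (pair v₀ (cons (app (fun oneᵇ) (fst v₂)) nil)) ze)
      (let′ (app v₅ (pair (fst v₄) v₃)) (let′ (app (fun ratioᵇ) (pair (fst (fst v₀)) v₃))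
        (ifZero (fst v₀)
          (pair (pair (fst (fst v₁)) (cons (snd v₀) (snd (fst v₁)))) (su (snd v₁)))
          (pair (pair v₄ (cons (app (fun oneᵇ) (fst v₆))
                               (app (fun mulRowᵇ) (pair (snd v₀) (snd (fst v₁)))))) ze)))))

    remainderᵇ : Body Γ (polyTy ⊗ (rowTy ⊗ rowTy)) rowTy
    remainderᵇ = caseL (fst (snd v₀)) nil (caseL (snd (snd v₂)) nil (cons
      (app (fun addᵇ) (pair (app (fun scaleᵇ) (pair (lit -1ℤ) (app (fun multiplyᵇ) (pair (fst v₄) v₂)))) v₀))
      (app v₅ (pair (fst v₄) (pair v₃ v₁)))))

    sumᵇ : ∀ {σ} → Body Γ ((σ ⇒ polyTy) ⊗ (polyTy ⊗ list σ)) polyTy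
    sumᵇ = caseL (snd (snd v₀)) (fst (snd v₀))
      (app (fun addᵇ) (pair (app (fst v₂) v₀) (app v₃ (pair (fst v₂) (pair (fst (snd v₂)) v₁)))))

  hafnianTy : Ty
  hafnianTy = nat ⊗ (polyTy ⊗ triTy)

  -- Here v₁₁ is the hafnian, v₁₀ its argument, v₉ = k - 1 and v₈ the rows after the first.
  module _ {Γ : Cx} {a b c d e f g : Ty} where

    correctionᵇ : Body (a ∷ b ∷ c ∷ d ∷ e ∷ f ∷ g ∷ nat ∷ hafnianTy ∷ (hafnianTy ⇒ polyTy) ∷ Γ)
                       (int ⊗ triTy) polyTy
    correctionᵇ = app (fun scaleᵇ) (pair (fst v₀) (app v₁₁ (pair v₉ (pair (fst (snd v₁₀)) (snd v₀)))))

  module _ {Γ : Cx} {a b c d e f : Ty} where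

    residualᵇ : Body (a ∷ b ∷ c ∷ d ∷ e ∷ f ∷ triTy ∷ nat ∷ hafnianTy ∷ (hafnianTy ⇒ polyTy) ∷ Γ)
                     (polyTy ⊗ rowTy) polyTy
    residualᵇ = app (fun multiplyᵇ) (pair (fst v₀)
      (app v₁₁ (pair v₉ (pair (fst (snd v₁₀)) (cons (snd v₀) v₈)))))

  module _ {Γ : Cx} where

    hafnianᵇ : Body Γ hafnianTy polyTy
    hafnianᵇ = caseN (fst v₀) (fst (snd v₀))
      (caseL (snd (snd v₁)) (app (fun oneᵇ) (fst (snd v₁)))
      (caseL v₀ (fst (snd v₃))
      (let′ (app (fun pivotᵇ) (pair (fst (snd v₅)) v₂))
      (let′ (app (fun pickᵇ) (pair (snd v₀) (snd (fst v₀))))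
      (let′ (app (fun pullᵇ) (pair (snd v₁) v₅))
      (app (fun addᵇ) (pair
        (app (fun multiplyᵇ) (pair (fst (fst v₂)) (app (fun addᵇ) (pair
          (app (fun scaleᵇ) (pair (lit (- + 2)) (app (fun sumᵇ) (pair (fun correctionᵇ) (pair (fst (snd v₈))
            (app (fun crossᵇ) (pair (fst (snd v₈)) (pair (snd v₁) (pair (fst v₀) (snd v₀))))))))))
          (app v₉ (pair (fst v₈) (pair (fst (snd v₈))
            (app (fun updateᵇ) (pair (snd v₁) (pair (fst v₀) (snd v₀)))))))))))
        (app (fun sumᵇ) (pair (fun residualᵇ) (pair (fst (snd v₈))
          (app (fun unitsᵇ) (pair (fst (snd v₈))
            (app (fun remainderᵇ) (pair (fst (fst v₂)) (pair (snd (fst v₂)) v₅)))))))))))))))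

    upperᵇ : Body Γ matrixTy triTy
    upperᵇ = caseL v₀ nil (cons (app (fun tailᵇ) v₀) (app v₃ (app (fun mapᵇ) (pair (fun tailᵇ) v₁))))

    padᵇ : Body Γ (polyTy ⊗ matrixTy) matrixTy
    padᵇ = app (fun mapᵇ) (pair
      (fun (app (fun mapᵇ) (pair (fun (app (fun addᵇ) (pair v₀ (fst v₄)))) v₀)))
      (snd v₀))

  -- The first binding makes the zero polynomial of length `D`: the matrix is flattened twice, every
  -- coefficient is replaced by 0, and one more 0 is put in front.
  algorithm : Algorithm
  algorithm =
    let′ (cons (lit 0ℤ) (app (fun mapᵇ) (pair (fun (lit 0ℤ)) (app (fun concatᵇ) (app (fun concatᵇ) v₀)))))
    (app (fun mapᵇ) (pair
      (fun (reduce v₀ v₄))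
      (app (fun hafnianᵇ) (pair v₂ (pair v₀ (app (fun upperᵇ) (app (fun padᵇ) (pair v₀ v₁))))))))

-- Runs of the list and polynomial subroutines

module BasicRuns where

  open import Data.Bool.Base using (Bool; true; false; T)
  open import Data.Fin.Base using (Fin; zero; suc; toℕ)
  open import Data.Integer.Base using (ℤ; 0ℤ; 1ℤ; +_; -_)
  open import Data.List.Base using (List; []; _∷_; _++_; length; map)
  open import Data.List.Relation.Unary.All using ([]; _∷_)
  open import Data.List.Relation.Binary.Pointwise using (Pointwise; []; _∷_)
  open import Data.Nat.Base using (ℕ; zero; suc; _+_; _*_; _^_; _≤_; _≤ᵇ_)
  open import Data.Nat.Properties
  open import Data.Product.Base using (_×_; _,_)
  open import Data.Vec.Base as Vec using (Vec; []; _∷_)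
  open import Relation.Binary.PropositionalEquality using (_≡_; refl; sym; cong; subst)
  open import Defs
  open SquarefreeAlgebra
  open PowerSeries
  open TruncatedCoefficients
  open RunningTimes
  open Programs

  values : ∀ {A : Set} {τ n} → (A → Val τ) → Vec A n → List (Val τ)
  values enc []      = []
  values enc (a ∷ v) = enc a ∷ values enc v

  polynomialᵛ : ∀ {n} → Vec ℤ n → Val polyTy
  polynomialᵛ v = listᵛ (values intᵛ v)

  rowᵛ : ∀ {n m} → Vec (Vec ℤ n) m → Val rowTy
  rowᵛ r = listᵛ (values polynomialᵛ r)

  rows : ∀ {n m} → Tri (Vec ℤ n) m → List (Val rowTy)
  rows []      = []
  rows (t ∷ T) = rowᵛ t ∷ rows T

  triᵛ : ∀ {n m} → Tri (Vec ℤ n) m → Val triTy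
  triᵛ T = listᵛ (rows T)

  weightedᵛ : ∀ {n m} → ℤ × Tri (Vec ℤ n) m → Val (int ⊗ triTy)
  weightedᵛ (s , M) = pairᵛ (intᵛ s) (triᵛ M)

  weightedListᵛ : ∀ {n m} → List (ℤ × Tri (Vec ℤ n) m) → Val weightedTy
  weightedListᵛ L = listᵛ (map weightedᵛ L)

  termᵛ : ∀ {n m} → Vec ℤ n × Vec (Vec ℤ n) m → Val (polyTy ⊗ rowTy)
  termᵛ (a , u) = pairᵛ (polynomialᵛ a) (rowᵛ u)

  finᵛ : ∀ {m} → Fin m → Val nat
  finᵛ p = natᵛ (toℕ p)

  boolᵛ : Bool → Val int
  boolᵛ true  = intᵛ 0ℤ
  boolᵛ false = intᵛ 1ℤ

  length-values : ∀ {A : Set} {τ n} (enc : A → Val τ) (v : Vec A n) → length (values enc v) ≡ n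
  length-values enc []      = refl
  length-values enc (a ∷ v) = cong suc (length-values enc v)

  module Costs (Z : ℕ) (1000≤Z : 1000 ≤ Z) where

    private
      1≤Z : 1 ≤ Z
      1≤Z = ≤-trans (≤ᵇ⇒≤ 1 1000 _) 1000≤Z

    abstract
      -- With one number `Z` above all sizes and constants, costs are compared through exponents:
      -- straight-line code adds 1, a loop adds 4, of which 3 pay for the iterations and 1 for the
      -- constant 1000.
      pow : ℕ → ℕ
      pow e = Z ^ e

      pow≡ : ∀ e → pow e ≡ Z ^ e
      pow≡ e = refl

      1≤pow : ∀ e → 1 ≤ pow e
      1≤pow e = ≤-trans (≤-reflexive (sym (^-zeroˡ e))) (^-monoˡ-≤ e 1≤Z)

      pow-mono : ∀ {a b} → a ≤ b → pow a ≤ pow b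
      pow-mono {a} {b} a≤b with m≤n⇒∃[o]m+o≡n a≤b
      ... | o , refl = ≤-trans (≤-reflexive (sym (*-identityʳ (Z ^ a))))
                         (≤-trans (*-monoʳ-≤ (Z ^ a) (1≤pow o)) (≤-reflexive (sym (^-distribˡ-+-* Z a o))))

      *-pow : ∀ {s} e → s ≤ Z → s * pow e ≤ pow (suc e)
      *-pow e s≤Z = *-monoˡ-≤ (Z ^ e) s≤Z

      straight-bound : ∀ e → straightCost (pow e) ≤ pow (suc e)
      straight-bound e = straightCost-≤ {Z ^ e} 1000≤Z

      loop-bound : ∀ e {ℓ} → suc ℓ ≤ Z ^ 3 → loopCost (pow e) ℓ ≤ pow (4 + e)
      loop-bound e {ℓ} p = ≤-trans (loopCost-≤ {Z ^ e} p 1000≤Z) (≤-reflexive (sym (^-distribˡ-+-* Z 3 (suc e))))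

    lift : ∀ a {b} {σ τ} {w : Val (σ ⇒ τ)} {u v} {_ : T (a ≤ᵇ b)} →
           w · u ⇓ v within pow a → w · u ⇓ v within pow b
    lift a {b} {_} {_} {w} {u} {v} {p} = weaken (pow-mono (≤ᵇ⇒≤ a b p))

    -- The exponent 3 is due to the lists made by `cross`: their length is at most `8m²`, and both 8
    -- and `m + 1` are at most `Z`.
    Small : ℕ → Set
    Small ℓ = suc ℓ ≤ Z ^ 3

    small-pred : ∀ {ℓ} → Small (suc ℓ) → Small ℓ
    small-pred p = ≤-trans (n≤1+n _) p

    straight : ∀ e {Γ} {ρ : Env Γ} {σ τ} {b : Tm (σ ∷ (σ ⇒ τ) ∷ Γ) τ} {u v} →
               wp (pow e) (u ∷ closᵛ ρ b ∷ ρ) b 0 0 (Returns (pow e) v (straightCost (pow e))) →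
               closᵛ ρ b · u ⇓ v within pow (suc e)
    straight e p = weaken (straight-bound e) (verify (1≤pow e) p)

    loop : ∀ e {ℓ} {σ τ} {w : Val (σ ⇒ τ)} {u v} → Small ℓ →
           w · u ⇓ v within loopCost (pow e) ℓ → w · u ⇓ v within pow (4 + e)
    loop e p = weaken (loop-bound e p)

    module _ {Γ : Cx} {ρ : Env Γ} where

      map-run : ∀ e {σ τ} {w : Val (σ ⇒ τ)} {us vs} → Small (length us) →
        Pointwise (λ u v → w · u ⇓ v within pow e) us vs →
        closᵛ ρ mapᵇ · pairᵛ w (listᵛ us) ⇓ listᵛ vs within pow (4 + e)
      map-run e s ps = loop e s (go ps)
        where
        go : ∀ {us vs} → Pointwise (λ u v → _ · u ⇓ v within pow e) us vs →
             closᵛ ρ mapᵇ · pairᵛ _ (listᵛ us) ⇓ listᵛ vs within loopCost (pow e) (length us)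
        go []       = verify (1≤pow e) (refl , stop)
        go (p ∷ ps) = verify (1≤pow e) (call p (recur (go ps) (refl , again)))

      append-run : ∀ {σ} (us vs : List (Val σ)) → Small (length us) →
        closᵛ ρ appendᵇ · pairᵛ (listᵛ us) (listᵛ vs) ⇓ listᵛ (us ++ vs) within pow 4
      append-run us vs s = loop 0 s (go us)
        where
        go : ∀ us → closᵛ ρ appendᵇ · pairᵛ (listᵛ us) (listᵛ vs) ⇓ listᵛ (us ++ vs) within loopCost (pow 0) (length us)
        go []       = verify (1≤pow 0) (refl , stop)
        go (u ∷ us) = verify (1≤pow 0) (recur (go us) (refl , again))

      tail-run : ∀ {A : Set} {σ n} (enc : A → Val σ) (v : Vec A (suc n)) →
        closᵛ ρ tailᵇ · listᵛ (values enc v) ⇓ listᵛ (values enc (Vec.tail v)) within pow 1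
      tail-run enc (a ∷ v) = straight 0 ((refl , once))

      add-run : ∀ {m n} (v : Vec ℤ m) (w : Vec ℤ n) → Small m →
        closᵛ ρ addᵇ · pairᵛ (polynomialᵛ v) (polynomialᵛ w) ⇓ polynomialᵛ (addTo v w) within pow 4
      add-run v w s = loop 0 s (go v w)
        where
        go : ∀ {m n} (v : Vec ℤ m) (w : Vec ℤ n) →
          closᵛ ρ addᵇ · pairᵛ (polynomialᵛ v) (polynomialᵛ w) ⇓ polynomialᵛ (addTo v w) within loopCost (pow 0) m
        go []      w       = verify (1≤pow 0) (refl , stop)
        go (a ∷ v) []      = verify (1≤pow 0) (refl , stop)
        go (a ∷ v) (b ∷ w) = verify (1≤pow 0) (recur (go v w) (refl , again))

    map-vec : ∀ e {A B : Set} {σ τ n} {encA : A → Val σ} {encB : B → Val τ} {f : A → B} {w : Val (σ ⇒ τ)} →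
      (∀ a → w · encA a ⇓ encB (f a) within pow e) → (v : Vec A n) →
      Pointwise (λ u v → w · u ⇓ v within pow e) (values encA v) (values encB (Vec.map f v))
    map-vec e p []      = []
    map-vec e p (a ∷ v) = p a ∷ map-vec e p v

    map-list : ∀ e {A B : Set} {σ τ} {encA : A → Val σ} {encB : B → Val τ} {f : A → B} {w : Val (σ ⇒ τ)} →
      (∀ a → w · encA a ⇓ encB (f a) within pow e) → (L : List A) →
      Pointwise (λ u v → w · u ⇓ v within pow e) (map encA L) (map encB (map f L))
    map-list e p []      = []
    map-list e p (a ∷ v) = p a ∷ map-list e p v

    small-values : ∀ {A : Set} {τ n} {enc : A → Val τ} (v : Vec A n) → Small n → Small (length (values enc v))
    small-values {enc = enc} v s = subst Small (sym (length-values enc v)) s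

    module _ {Γ : Cx} {ρ : Env Γ} where

      scale-run : ∀ {n} a (v : Vec ℤ n) → Small n →
        closᵛ ρ scaleᵇ · pairᵛ (intᵛ a) (polynomialᵛ v) ⇓ polynomialᵛ (scale a v) within pow 6
      scale-run a v s = straight 5 ((call
        (map-run 1 (small-values v s) (map-vec 1 (λ b → straight 0 ((refl , once))) v))
        (refl , once)))

    module _ {Γ : Cx} {ρ : Env Γ} where

      multiply-run : ∀ {m n} (v : Vec ℤ m) (w : Vec ℤ n) → Small m → Small n →
        closᵛ ρ multiplyᵇ · pairᵛ (polynomialᵛ v) (polynomialᵛ w) ⇓ polynomialᵛ (multiply v w) within pow 10
      multiply-run v w s s′ = loop 6 s (go v)
        where
        go : ∀ {m} (v : Vec ℤ m) →
          closᵛ ρ multiplyᵇ · pairᵛ (polynomialᵛ v) (polynomialᵛ w) ⇓ polynomialᵛ (multiply v w) within loopCost (pow 6) m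
        go []      = verify (1≤pow 6) (refl , stop)
        go (a ∷ v) = verify (1≤pow 6)
          (call (scale-run a w s′) (recur (go v)
            (call (lift 4 (add-run (scale a w) (0ℤ ∷ multiply v w) s′)) (refl , again))))

      divide-run : ∀ {m} n (b : Vec ℤ n) (a : Vec ℤ m) → Small n → Small m →
        closᵛ ρ divideᵇ · pairᵛ (polynomialᵛ b) (polynomialᵛ a) ⇓ polynomialᵛ (divide n b a) within pow 10
      divide-run n b a s s′ = loop 6 s (go n b)
        where
        go : ∀ n (b : Vec ℤ n) →
          closᵛ ρ divideᵇ · pairᵛ (polynomialᵛ b) (polynomialᵛ a) ⇓ polynomialᵛ (divide n b a) within loopCost (pow 6) n
        go zero    []      = verify (1≤pow 6) (refl , stop)
        go (suc n) (b ∷ v) = verify (1≤pow 6)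
          (call (scale-run (- b) a s′)
          (call (lift 4 (add-run (scale (- b) a) (b ∷ v) s′))
          (call (lift 1 (tail-run intᵛ (addTo (scale (- b) a) (b ∷ v))))
          (recur (go n _) (refl , again)))))

-- Runs of the row and matrix subroutines

module SubroutineRuns where

  open import Data.Bool.Base using (true; false; T)
  open import Data.Fin.Base using (Fin; zero; suc)
  open import Data.Integer.Base using (ℤ; 0ℤ; 1ℤ; -1ℤ; +_)
  import Data.Integer.Properties as ℤₚ
  open import Data.List.Base using ([]; _∷_; _++_; length; map)
  open import Data.List.Properties using (length-++; length-map; map-++)
  open import Data.List.Relation.Unary.All using ([]; _∷_)
  open import Data.List.Relation.Binary.Pointwise using ([]; _∷_)
  open import Data.Nat.Base using (ℕ; zero; suc; _+_; _*_; _^_; _≤_; z≤n; s≤s; >-nonZero)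
  open import Data.Nat.Properties
  open import Data.Nat.Tactic.RingSolver using (solve-∀)
  open import Data.Product.Base using (_,_; proj₁; proj₂)
  open import Data.Sum.Base using (inj₁; inj₂)
  open import Data.Vec.Base using (Vec; []; _∷_)
  open import Relation.Binary.PropositionalEquality using (_≡_; refl; sym; trans; cong; cong₂; subst)
  open import Relation.Nullary using (Dec; yes; no; does)
  open import Defs
  open SquarefreeAlgebra
  open PowerSeries
  open TruncatedCoefficients
  open RunningTimes
  open Programs
  open BasicRuns

  module Runs (Z : ℕ) (1000≤Z : 1000 ≤ Z) (d : ℕ) (suc-d<Z : suc (suc d) ≤ Z) where

    open Costs Z 1000≤Z
    open Coefficients d

    <⇒Small : ∀ {ℓ} → suc ℓ ≤ Z → Small ℓ
    <⇒Small {ℓ} p = ≤-trans p (≤-trans (≤-reflexive (sym (^-identityʳ Z))) (^-monoʳ-≤ Z {{>-nonZero (≤-trans (s≤s z≤n) p)}} {1} {3} (s≤s z≤n)))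

    small-D : Small D
    small-D = <⇒Small suc-d<Z

    module _ {Γ : Cx} {ρ : Env Γ} where

      one-run : closᵛ ρ oneᵇ · polynomialᵛ 𝟘 ⇓ polynomialᵛ 𝟙 within pow 2
      one-run = straight 1 (call (tail-run intᵛ 𝟘) (refl , once))

      ratio-run : ∀ {n} (g a : Vec ℤ n) → Small n →
        closᵛ ρ ratioᵇ · pairᵛ (polynomialᵛ g) (polynomialᵛ a) ⇓
          pairᵛ (boolᵛ (proj₁ (ratio g a))) (polynomialᵛ (proj₂ (ratio g a))) within pow 14
      ratio-run g a s = loop 10 s (go g a s)
        where
        go : ∀ {n} (g a : Vec ℤ n) → Small n →
          closᵛ ρ ratioᵇ · pairᵛ (polynomialᵛ g) (polynomialᵛ a) ⇓
            pairᵛ (boolᵛ (proj₁ (ratio g a))) (polynomialᵛ (proj₂ (ratio g a))) within loopCost (pow 10) n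
        go []      []              s = verify (1≤pow 10) (refl , stop)
        -- Both parity decisions are passed as arguments, so that one case distinction fixes the
        -- branch of the program and that of `ratioStep` together.
        go {suc n} (b ∷ g) (c ∷ a) s = step (b mod2^ 1 ℤₚ.≟ 0ℤ) (c mod2^ 1 ℤₚ.≟ 0ℤ)
          where
          step : (p : Dec (b mod2^ 1 ≡ 0ℤ)) (q : Dec (c mod2^ 1 ≡ 0ℤ)) →
            let x = ratioStep (does p) (does q) (b ∷ g) (c ∷ a) in
            closᵛ ρ ratioᵇ · pairᵛ (polynomialᵛ (b ∷ g)) (polynomialᵛ (c ∷ a)) ⇓
              pairᵛ (boolᵛ (proj₁ x)) (polynomialᵛ (proj₂ x)) within loopCost (pow 10) (suc n)
          step (yes p) (yes q) = verify (1≤pow 10) (inj₁ (p , inj₁ (q ,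
            recur (go g a (small-pred s))
            (call (lift 6 (scale-run 0ℤ (b ∷ g) s))
            (call (lift 4 (add-run (proj₂ (ratio g a)) (scale 0ℤ (b ∷ g)) (small-pred s))) (refl , again))))))
          step (yes p) (no ¬q) = verify (1≤pow 10) (inj₁ (p , inj₂ (¬q ,
            call (divide-run (suc n) (b ∷ g) (c ∷ a) s s) (refl , stop))))
          step (no ¬p) (yes _) = verify (1≤pow 10) (inj₂ (¬p ,
            call (divide-run (suc n) (c ∷ a) (b ∷ g) s s) (refl , stop)))
          step (no ¬p) (no _)  = verify (1≤pow 10) (inj₂ (¬p ,
            call (divide-run (suc n) (c ∷ a) (b ∷ g) s s) (refl , stop)))

      mulRow-run : ∀ {m} a (r : Row m) → Small m →
        closᵛ ρ mulRowᵇ · pairᵛ (polynomialᵛ a) (rowᵛ r) ⇓ rowᵛ (a · r) within pow 16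
      mulRow-run a r s = straight 15 (call
        (map-run 11 (small-values r s)
          (map-vec 11 (λ b → straight 10 (call (multiply-run a b small-D small-D) (refl , once))) r))
        (refl , once))

      addRow-run : ∀ {m} (r s : Row m) → Small m →
        closᵛ ρ addRowᵇ · pairᵛ (rowᵛ r) (rowᵛ s) ⇓ rowᵛ (r ⊞ s) within pow 8
      addRow-run r s p = loop 4 p (go r s)
        where
        go : ∀ {m} (r s : Row m) →
          closᵛ ρ addRowᵇ · pairᵛ (rowᵛ r) (rowᵛ s) ⇓ rowᵛ (r ⊞ s) within loopCost (pow 4) m
        go []      []      = verify (1≤pow 4) (refl , stop)
        go (a ∷ r) (b ∷ s) = verify (1≤pow 4) (call (add-run a b small-D) (recur (go r s) (refl , again)))

      zeros-run : ∀ {m} (r : Row m) → Small m →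
        closᵛ ρ zerosᵇ · pairᵛ (polynomialᵛ 𝟘) (rowᵛ r) ⇓ rowᵛ (zeros r) within pow 6
      zeros-run r s = straight 5 (call
        (map-run 1 (small-values r s) (map-vec 1 (λ b → straight 0 (refl , once)) r))
        (refl , once))

      consAll-run : ∀ {m} s (t : Row m) L → Small (length L) →
        closᵛ ρ consAllᵇ · pairᵛ (intᵛ s) (pairᵛ (rowᵛ t) (weightedListᵛ L)) ⇓
          weightedListᵛ (consAll s t L) within pow 6
      consAll-run s t L small = straight 5 (call
        (map-run 1 (subst Small (sym (length-map weightedᵛ L)) small)
          (map-list 1 (λ _ → straight 0 (refl , once)) L))
        (refl , once))

      append-weighted : ∀ {m} (L L′ : WeightedList m) → Small (length L) →
        closᵛ ρ appendᵇ · pairᵛ (weightedListᵛ L) (weightedListᵛ L′) ⇓ weightedListᵛ (L ++ L′) within pow 4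
      append-weighted L L′ s = subst (λ us → closᵛ ρ appendᵇ · pairᵛ (weightedListᵛ L) (weightedListᵛ L′) ⇓ listᵛ us within pow 4)
        (sym (map-++ weightedᵛ L L′))
        (append-run (map weightedᵛ L) (map weightedᵛ L′) (subst Small (sym (length-map weightedᵛ L)) s))

    module _ {Γ : Cx} {ρ : Env Γ} where

      mark-run : ∀ {m} (u : Row m) L → Small m → Small (length L) →
        closᵛ ρ markᵇ · pairᵛ (polynomialᵛ 𝟘) (pairᵛ (rowᵛ u) (weightedListᵛ L)) ⇓
          weightedListᵛ (mark u L) within pow 7
      mark-run u L s s′ = straight 6
        (call (consAll-run 1ℤ u L s′)
        (call (zeros-run u s)
        (call (consAll-run -1ℤ (zeros u) L s′)
        (call (lift 4 (append-weighted (consAll 1ℤ u L) (consAll -1ℤ (zeros u) L)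
                        (subst Small (sym (length-map (prepend 1ℤ u) L)) s′)))
        (refl , once)))))

      newRow-run : ∀ {m} a (c : Row m) b q t → Small m →
        closᵛ ρ newRowᵇ · pairᵛ (pairᵛ (polynomialᵛ a) (rowᵛ c)) (pairᵛ (pairᵛ (polynomialᵛ b) (rowᵛ q)) (rowᵛ t)) ⇓
          rowᵛ (newRow a c b q t) within pow 17
      newRow-run a c b q t s = straight 16
        (call (mulRow-run a q s)
        (call (mulRow-run b c s)
        (call (lift 8 (addRow-run (a · q) (b · c) s))
        (call (lift 8 (addRow-run ((a · q) ⊞ (b · c)) t s)) (refl , once)))))

    length-mark : ∀ {m} (u : Row m) L → length (mark u L) ≡ 2 * length L
    length-mark u L = trans (length-++ (consAll 1ℤ u L))
      (cong₂ _+_ (length-map (prepend 1ℤ u) L)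
                 (trans (length-map (prepend -1ℤ (zeros u)) L) (sym (+-identityʳ (length L)))))

    length-quad : ∀ {m} (q : Row m) T → length (quad q T) ≡ 2 * m
    length-quad []                []      = refl
    length-quad {suc m} (a ∷ q) (t ∷ T) =
      trans (length-++ (mark (a · q) ((1ℤ , T) ∷ [])) {consAll 1ℤ t (quad q T)})
      (trans (cong (_+_ 2) (trans (length-map (prepend 1ℤ t) (quad q T)) (length-quad q T)))
             (sym (*-suc 2 m)))

    -- One more index adds two marked lists of length `4m` each, well within the growth `16m + 8` of
    -- `8m²`.
    length-cross : ∀ {m} (c q : Row m) T → length (cross c q T) ≤ 8 * (m * m)
    length-cross []      []      []      = z≤n
    length-cross {suc m} (a ∷ c) (b ∷ q) (t ∷ T) = begin
      length (cross (a ∷ c) (b ∷ q) (t ∷ T))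
        ≡⟨ length-++ (mark (a · c) (quad q T)) ⟩
      length (mark (a · c) (quad q T)) + length (mark (b · q) (quad c T) ++ _)
        ≡⟨ cong₂ _+_ (marked (a · c) q) (trans (length-++ (mark (b · q) (quad c T)))
             (cong₂ _+_ (marked (b · q) c) (length-map (prepend 1ℤ _) (cross c q T)))) ⟩
      2 * (2 * m) + (2 * (2 * m) + length (cross c q T))
        ≤⟨ +-monoʳ-≤ (2 * (2 * m)) (+-monoʳ-≤ (2 * (2 * m)) (length-cross c q T)) ⟩
      2 * (2 * m) + (2 * (2 * m) + 8 * (m * m))
        ≤⟨ m≤m+n _ (8 * m + 8) ⟩
      2 * (2 * m) + (2 * (2 * m) + 8 * (m * m)) + (8 * m + 8)
        ≡⟨ lemma m ⟩
      8 * (suc m * suc m) ∎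
      where
      open ≤-Reasoning
      marked : ∀ u (q : Row m) → length (mark u (quad q T)) ≡ 2 * (2 * m)
      marked u q = trans (length-mark u (quad q T)) (cong (2 *_) (length-quad q T))
      lemma : ∀ m → 2 * (2 * m) + (2 * (2 * m) + 8 * (m * m)) + (8 * m + 8) ≡ 8 * ((1 + m) * (1 + m))
      lemma = solve-∀

    small-square : ∀ {m ℓ} → suc m ≤ Z → ℓ ≤ 8 * (m * m) → Small ℓ
    small-square {m} {ℓ} m<Z ℓ≤ = begin
      suc ℓ                 ≤⟨ s≤s ℓ≤ ⟩
      1 + 8 * (m * m)       ≤⟨ m≤m+n _ (7 + 16 * m) ⟩
      1 + 8 * (m * m) + (7 + 16 * m) ≡⟨ lemma m ⟩
      8 * (suc m * (suc m * 1))   ≤⟨ *-mono-≤ (≤-trans (≤ᵇ⇒≤ 8 1000 _) 1000≤Z) (*-mono-≤ m<Z (*-monoˡ-≤ 1 m<Z)) ⟩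
      Z ^ 3                 ∎
      where
      open ≤-Reasoning
      lemma : ∀ m → 1 + 8 * (m * m) + (7 + 16 * m) ≡ 8 * ((1 + m) * ((1 + m) * 1))
      lemma = solve-∀

    4m≤8m² : ∀ m → 2 * (2 * m) ≤ 8 * (m * m)
    4m≤8m² zero    = z≤n
    4m≤8m² (suc m) = begin
      2 * (2 * suc m)                             ≤⟨ m≤m+n _ (4 + 12 * m + 8 * (m * m)) ⟩
      2 * (2 * suc m) + (4 + 12 * m + 8 * (m * m)) ≡⟨ lemma m ⟩
      8 * (suc m * suc m)                         ∎
      where
      open ≤-Reasoning
      lemma : ∀ m → 2 * (2 * (1 + m)) + (4 + 12 * m + 8 * (m * m)) ≡ 8 * ((1 + m) * (1 + m))
      lemma = solve-∀

    small-quad : ∀ {m} → suc m ≤ Z → (q : Row m) (T : _) → Small (length (quad q T))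
    small-quad {m} s q T = small-square s (≤-trans (≤-reflexive (length-quad q T))
                             (≤-trans (m≤m+n (2 * m) _) (4m≤8m² m)))

    small-mark-quad : ∀ {m} → suc m ≤ Z → (u q : Row m) (T : _) → Small (length (mark u (quad q T)))
    small-mark-quad {m} s u q T = small-square s (≤-trans (≤-reflexive
      (trans (length-mark u (quad q T)) (cong (2 *_) (length-quad q T)))) (4m≤8m² m))

    pred< : ∀ {m} → suc (suc m) ≤ Z → suc m ≤ Z
    pred< p = ≤-trans (n≤1+n _) p

    module _ {Γ : Cx} {ρ : Env Γ} where

      quad-run : ∀ {m} (q : Row m) T → suc m ≤ Z →
        closᵛ ρ quadᵇ · pairᵛ (polynomialᵛ 𝟘) (pairᵛ (rowᵛ q) (triᵛ T)) ⇓ weightedListᵛ (quad q T) within pow 20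
      quad-run q T s = loop 16 (<⇒Small s) (go q T s)
        where
        go : ∀ {m} (q : Row m) T → suc m ≤ Z →
          closᵛ ρ quadᵇ · pairᵛ (polynomialᵛ 𝟘) (pairᵛ (rowᵛ q) (triᵛ T)) ⇓ weightedListᵛ (quad q T)
            within loopCost (pow 16) m
        go []      []      s = verify (1≤pow 16) (refl , stop)
        go (a ∷ q) (t ∷ T) s = verify (1≤pow 16)
          (call (mulRow-run a q (<⇒Small (pred< s)))
          (call (lift 7 (mark-run (a · q) ((1ℤ , T) ∷ []) (<⇒Small (pred< s)) (<⇒Small (≤-trans (≤ᵇ⇒≤ 2 1000 _) 1000≤Z))))
          (recur (go q T (pred< s))
          (call (lift 6 (consAll-run 1ℤ t (quad q T) (small-quad (pred< s) q T)))
          (call (lift 4 (append-weighted (mark (a · q) ((1ℤ , T) ∷ [])) (consAll 1ℤ t (quad q T))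
                          (<⇒Small (≤-trans (≤ᵇ⇒≤ 3 1000 _) 1000≤Z))))
          (refl , again))))))

      update-run : ∀ {m} (c q : Row m) T → suc m ≤ Z →
        closᵛ ρ updateᵇ · pairᵛ (rowᵛ c) (pairᵛ (rowᵛ q) (triᵛ T)) ⇓ triᵛ (update c q T) within pow 21
      update-run c q T s = loop 17 (<⇒Small s) (go c q T s)
        where
        go : ∀ {m} (c q : Row m) T → suc m ≤ Z →
          closᵛ ρ updateᵇ · pairᵛ (rowᵛ c) (pairᵛ (rowᵛ q) (triᵛ T)) ⇓ triᵛ (update c q T) within loopCost (pow 17) m
        go []      []      []      s = verify (1≤pow 17) (refl , stop)
        go (a ∷ c) (b ∷ q) (t ∷ T) s = verify (1≤pow 17)
          (call (newRow-run a c b q t (<⇒Small (pred< s))) (recur (go c q T (pred< s)) (refl , again)))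

      pick-run : ∀ {m} (p : Fin (suc m)) (r : Row (suc m)) → Small (suc m) →
        closᵛ ρ pickᵇ · pairᵛ (finᵛ p) (rowᵛ r) ⇓ termᵛ (pick p r) within pow 4
      pick-run p r s = loop 0 s (go p r)
        where
        go : ∀ {m} (p : Fin (suc m)) (r : Row (suc m)) →
          closᵛ ρ pickᵇ · pairᵛ (finᵛ p) (rowᵛ r) ⇓ termᵛ (pick p r) within loopCost (pow 0) (suc m)
        go         zero    (a ∷ r) = verify (1≤pow 0) (refl , stop)
        go {suc m} (suc p) (a ∷ r) = verify (1≤pow 0) (recur (go p r) (refl , again))

      remainder-run : ∀ {m} g (c r : Row m) → Small m →
        closᵛ ρ remainderᵇ · pairᵛ (polynomialᵛ g) (pairᵛ (rowᵛ c) (rowᵛ r)) ⇓ rowᵛ (remainder g c r) within pow 14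
      remainder-run g c r s = loop 10 s (go c r)
        where
        go : ∀ {m} (c r : Row m) →
          closᵛ ρ remainderᵇ · pairᵛ (polynomialᵛ g) (pairᵛ (rowᵛ c) (rowᵛ r)) ⇓ rowᵛ (remainder g c r)
            within loopCost (pow 10) m
        go []      []      = verify (1≤pow 10) (refl , stop)
        go (b ∷ c) (a ∷ r) = verify (1≤pow 10)
          (call (multiply-run g b small-D small-D)
          (call (lift 6 (scale-run -1ℤ (multiply g b) small-D))
          (call (lift 4 (add-run (scale -1ℤ (multiply g b)) a small-D))
          (recur (go c r) (refl , again)))))

      length-units : ∀ {m} (r : Row m) → length (units r) ≡ m
      length-units []      = refl
      length-units (a ∷ r) = cong suc (trans (length-map _ (units r)) (length-units r))

      units-run : ∀ {m} (r : Row m) → Small m →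
        closᵛ ρ unitsᵇ · pairᵛ (polynomialᵛ 𝟘) (rowᵛ r) ⇓ listᵛ (map termᵛ (units r)) within pow 10
      units-run r s = loop 6 s (go r s)
        where
        go : ∀ {m} (r : Row m) → Small m →
          closᵛ ρ unitsᵇ · pairᵛ (polynomialᵛ 𝟘) (rowᵛ r) ⇓ listᵛ (map termᵛ (units r)) within loopCost (pow 6) m
        go []      s = verify (1≤pow 6) (refl , stop)
        go (a ∷ r) s = verify (1≤pow 6)
          (call (lift 2 one-run)
          (call (zeros-run r (small-pred s))
          (recur (go r (small-pred s))
          (call (lift 5 (map-run 1 (subst Small (sym (trans (length-map termᵛ (units r)) (length-units r))) (small-pred s))
                          (map-list 1 (λ _ → straight 0 (refl , once)) (units r))))
          (refl , again)))))

    module _ {Γ : Cx} {ρ : Env Γ} where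

      cross-run : ∀ {m} (c q : Row m) T → suc m ≤ Z →
        closᵛ ρ crossᵇ · pairᵛ (polynomialᵛ 𝟘) (pairᵛ (rowᵛ c) (pairᵛ (rowᵛ q) (triᵛ T))) ⇓
          weightedListᵛ (cross c q T) within pow 24
      cross-run c q T s = loop 20 (<⇒Small s) (go c q T s)
        where
        go : ∀ {m} (c q : Row m) T → suc m ≤ Z →
          closᵛ ρ crossᵇ · pairᵛ (polynomialᵛ 𝟘) (pairᵛ (rowᵛ c) (pairᵛ (rowᵛ q) (triᵛ T))) ⇓
            weightedListᵛ (cross c q T) within loopCost (pow 20) m
        go []      []      []      s = verify (1≤pow 20) (refl , stop)
        go (a ∷ c) (b ∷ q) (t ∷ T) s = verify (1≤pow 20)
          (call (lift 16 (mulRow-run a c s′))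
          (call (quad-run q T s″)
          (call (lift 7 (mark-run (a · c) (quad q T) s′ (small-quad s″ q T)))
          (call (lift 16 (mulRow-run b q s′))
          (call (quad-run c T s″)
          (call (lift 7 (mark-run (b · q) (quad c T) s′ (small-quad s″ c T)))
          (call (lift 17 (newRow-run a c b q t s′))
          (recur (go c q T s″)
          (call (lift 6 (consAll-run 1ℤ (newRow a c b q t) (cross c q T) (small-square s″ (length-cross c q T))))
          (call (lift 4 (append-weighted (mark (b · q) (quad c T)) _ (small-mark-quad s″ (b · q) c T)))
          (call (lift 4 (append-weighted (mark (a · c) (quad q T)) _ (small-mark-quad s″ (a · c) q T)))
          (refl , again))))))))))))
          where
          s″ = pred< s
          s′ = <⇒Small s″

      pull-run : ∀ {m} (p : Fin (suc m)) (T : Tri (Vec ℤ D) (suc m)) → Small (suc m) →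
        closᵛ ρ pullᵇ · pairᵛ (finᵛ p) (triᵛ T) ⇓ pairᵛ (rowᵛ (proj₁ (pull p T))) (triᵛ (proj₂ (pull p T))) within pow 8
      pull-run p T s = loop 4 s (go p T s)
        where
        go : ∀ {m} (p : Fin (suc m)) (T : Tri (Vec ℤ D) (suc m)) → Small (suc m) →
          closᵛ ρ pullᵇ · pairᵛ (finᵛ p) (triᵛ T) ⇓ pairᵛ (rowᵛ (proj₁ (pull p T))) (triᵛ (proj₂ (pull p T)))
            within loopCost (pow 4) (suc m)
        go         zero    (t ∷ T) s = verify (1≤pow 4) (refl , stop)
        go {suc m} (suc p) (t ∷ T) s = verify (1≤pow 4)
          (call (pick-run p t (small-pred s)) (recur (go p T (small-pred s)) (refl , again)))

      pivotᵛ : ∀ {m} → Pivot m → Val pivotTy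
      pivotᵛ (g , c , p) = pairᵛ (pairᵛ (polynomialᵛ g) (rowᵛ c)) (finᵛ p)

      pivot-run : ∀ {m} (r : Row (suc m)) → Small (suc m) →
        closᵛ ρ pivotᵇ · pairᵛ (polynomialᵛ 𝟘) (rowᵛ r) ⇓ pivotᵛ (pivot r) within pow 20
      pivot-run r s = loop 16 s (go r s)
        where
        go : ∀ {m} (r : Row (suc m)) → Small (suc m) →
          closᵛ ρ pivotᵇ · pairᵛ (polynomialᵛ 𝟘) (rowᵛ r) ⇓ pivotᵛ (pivot r) within loopCost (pow 16) (suc m)
        go (a ∷ [])            s = verify (1≤pow 16) (call (lift 2 one-run) (refl , stop))
        go {suc m} (a ∷ b ∷ r) s = step (ratio (proj₁ (pivot (b ∷ r))) a) (ratio-run (proj₁ (pivot (b ∷ r))) a small-D)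
          where
          pv = pivot (b ∷ r)
          step : ∀ x →
            (∀ {Γ} {ρ : Env Γ} → closᵛ ρ ratioᵇ · pairᵛ (polynomialᵛ (proj₁ pv)) (polynomialᵛ a) ⇓
              pairᵛ (boolᵛ (proj₁ x)) (polynomialᵛ (proj₂ x)) within pow 14) →
            closᵛ ρ pivotᵇ · pairᵛ (polynomialᵛ 𝟘) (rowᵛ (a ∷ b ∷ r)) ⇓ pivotᵛ (choose x a pv)
              within loopCost (pow 16) (suc (suc m))
          step (true  , f) run = verify (1≤pow 16)
            (recur (go (b ∷ r) (small-pred s)) (call (lift 14 run) (inj₁ (refl , refl , again))))
          step (false , f) run = verify (1≤pow 16)
            (recur (go (b ∷ r) (small-pred s)) (call (lift 14 run) (inj₂ ((λ ()) ,
              call (lift 2 one-run) (call (mulRow-run f (proj₁ (proj₂ pv)) (small-pred s)) (refl , again))))))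

-- Running time of the recursion

module HafnianRuns where

  open import Data.Bool.Base using (T)
  open import Data.Fin.Base using (Fin; zero; suc)
  open import Data.Integer.Base using (ℤ; +_; -_)
  open import Data.List.Base as List using (List; []; _∷_; _++_; length; map)
  open import Data.List.Relation.Unary.All using ([]; _∷_)
  open import Data.Nat.Base using (ℕ; zero; suc; _+_; _*_; _^_; _≤_; _≤ᵇ_)
  open import Data.Nat.Properties
  open import Data.Product.Base using (_,_; proj₁; proj₂)
  open import Data.Vec.Base as Vec using (Vec; []; _∷_)
  open import Data.Vec.Properties using (tabulate-∘)
  open import Function.Base using (_∘_)
  open import Relation.Binary.PropositionalEquality using (_≡_; refl; sym; trans; cong; cong₂; subst)
  open import Defs
  open SquarefreeAlgebra
  open MatchingSums
  open PowerSeries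
  open TruncatedCoefficients
  open RunningTimes
  open Programs
  open BasicRuns
  open SubroutineRuns

  -- Z ^ level k bounds the time per row for the hafnian modulo 2^k: the subroutines
  -- take time Z²⁴, and passing from k to k + 1 costs a factor Z⁸, of which Z³ is the
  -- number of recursive calls.
  level : ℕ → ℕ
  level zero    = 24
  level (suc k) = 8 + level k

  24≤level : ∀ k → 24 ≤ level k
  24≤level zero    = ≤-refl
  24≤level (suc k) = ≤-trans (24≤level k) (m≤n+m _ 8)

  upper : ∀ {A : Set} m → Vec (Vec A m) m → Tri A m
  upper zero    []            = []
  upper (suc m) ((a ∷ r) ∷ V) = r ∷ upper m (Vec.map Vec.tail V)

  upper-tabulate : ∀ {A : Set} m (f : Fin m → Fin m → A) →
                   upper m (Vec.tabulate (λ i → Vec.tabulate (f i))) ≡ toTri m f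
  upper-tabulate zero    f = refl
  upper-tabulate (suc m) f = cong (Vec.tabulate (λ j → f zero (suc j)) ∷_)
    (trans (cong (upper m) (sym (tabulate-∘ Vec.tail (λ i → Vec.tabulate (f (suc i))))))
           (upper-tabulate m (λ i j → f (suc i) (suc j))))

  values-++ : ∀ {A : Set} {τ m n} (enc : A → Val τ) (v : Vec A m) (w : Vec A n) →
              values enc (v Vec.++ w) ≡ values enc v ++ values enc w
  values-++ enc []      w = refl
  values-++ enc (a ∷ v) w = cong (enc a ∷_) (values-++ enc v w)

  values-toList : ∀ {A : Set} {τ n} (enc : A → Val τ) (v : Vec A n) → map enc (Vec.toList v) ≡ values enc v
  values-toList enc []      = refl
  values-toList enc (a ∷ v) = cong (enc a ∷_) (values-toList enc v)

  values-tabulate : ∀ {A : Set} {τ} n (enc : A → Val τ) (f : Fin n → A) (g : Fin n → Val τ) →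
                    (∀ i → g i ≡ enc (f i)) → List.tabulate g ≡ values enc (Vec.tabulate f)
  values-tabulate zero    enc f g e = refl
  values-tabulate (suc n) enc f g e = cong₂ _∷_ (e zero) (values-tabulate n enc (f ∘ suc) (g ∘ suc) (e ∘ suc))

  module HafnianRun (Z : ℕ) (1000≤Z : 1000 ≤ Z) (d : ℕ) (suc-d<Z : suc (suc d) ≤ Z) where

    open Costs Z 1000≤Z
    open Runs Z 1000≤Z d suc-d<Z
    open Coefficients d

    lift-level : ∀ a j k {σ τ} {w : Val (σ ⇒ τ)} {u v} {_ : T (a ≤ᵇ 24)} →
                 w · u ⇓ v within pow a → w · u ⇓ v within pow (j + level k)
    lift-level a j k {_} {_} {_} {_} {_} {p} =
      weaken (pow-mono (≤-trans (≤ᵇ⇒≤ a 24 p) (≤-trans (24≤level k) (m≤n+m _ j))))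

    module _ {Γ : Cx} {ρ : Env Γ} where

      sum-run : ∀ e {A : Set} {σ} {enc : A → Val σ} {f : A → Vec ℤ D} {w : Val (σ ⇒ polyTy)} →
        4 ≤ e → (∀ x → w · enc x ⇓ polynomialᵛ (f x) within pow e) → ∀ L → Small (length L) →
        closᵛ ρ sumᵇ · pairᵛ w (pairᵛ (polynomialᵛ 𝟘) (listᵛ (map enc L))) ⇓ polynomialᵛ (total f L) within pow (4 + e)
      sum-run e {enc = enc} {f} {w} 4≤e p L s = loop e s (go L)
        where
        go : ∀ L → closᵛ ρ sumᵇ · pairᵛ w (pairᵛ (polynomialᵛ 𝟘) (listᵛ (map enc L))) ⇓ polynomialᵛ (total f L)
                     within loopCost (pow e) (length L)
        go []      = verify (1≤pow e) (refl , stop)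
        go (x ∷ L) = verify (1≤pow e)
          (call (p x) (recur (go L)
            (call (weaken (pow-mono 4≤e) (add-run (f x) (total f L) small-D)) (refl , again))))

    module _ {Γ : Cx} {ρ : Env Γ} where

      -- An elimination removes two indices and so frees two allowances `P`; one of them already
      -- pays for everything outside the recursive call of cost `c * P`.
      eliminationCost : ∀ X c P {n} {_ : T (n ≤ᵇ 1000)} → straightCost X ≤ P →
                        Bounded X n (c * P + 0) (suc (suc c) * P)
      eliminationCost X c P {n} {p} X≤P with once {X} {n} {p}
      ... | bounded q = bounded (+-mono-≤ {n * X} (≤-trans (m≤m+n _ 0) (≤-trans q X≤P))
                          (≤-trans (≤-reflexive (+-identityʳ (c * P))) (m≤n+m (c * P) P)))

      -- The bound is linear in `m` because exactly one call keeps `k`. That call is charged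
      -- separately by `recur`, while all calls with smaller `k` fit into a fixed power of `Z` by
      -- induction.
      hafnian-run : ∀ k m (M : Tri (Vec ℤ D) m) → suc m ≤ Z →
        closᵛ ρ hafnianᵇ · pairᵛ (natᵛ k) (pairᵛ (polynomialᵛ 𝟘) (triᵛ M)) ⇓ polynomialᵛ (hafnian k m M)
          within suc m * pow (level k)
      hafnian-run zero    m M s = weaken (≤-trans (pow-mono {1} {24} (≤ᵇ⇒≤ 1 24 _)) (m≤m+n _ _))
        (straight 0 (refl , once))
      hafnian-run (suc k) zero [] s = weaken (≤-trans (pow-mono (≤-trans (≤ᵇ⇒≤ 3 24 _) (24≤level (suc k)))) (m≤m+n _ _))
        (straight 2 (call one-run (refl , once)))
      hafnian-run (suc k) (suc zero) ([] ∷ []) s =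
        weaken (≤-trans (pow-mono (≤-trans (≤ᵇ⇒≤ 1 24 _) (24≤level (suc k)))) (m≤m+n _ _))
        (straight 0 (refl , once))
      hafnian-run (suc k) (suc (suc m)) ((a ∷ r) ∷ T) s = verify (1≤pow (7 + level k))
        (call (lift-level 20 7 k (pivot-run (a ∷ r) small-row))
        (call (lift-level 4 7 k (pick-run p c small-row))
        (call (lift-level 8 7 k (pull-run p T small-row))
        (call (lift-level 24 7 k (cross-run c⁻ q T⁻ s″))
        -- Exponents above `level k`: 1 for the factor `suc m` in the inductive bound, 1 for the
        -- closure around the call, 4 for the summation loop. The allowance per call is 7, and the
        -- straight-line body raises it to 8.
        (call (weaken (pow-mono (n≤1+n (6 + level k)))
                (sum-run (2 + level k) {enc = weightedᵛ} 4≤ correction-run (cross c⁻ q T⁻) (small-square s″ (length-cross c⁻ q T⁻))))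
        (call (lift-level 6 7 k (scale-run (- + 2) (wsum (hafnian k m) (cross c⁻ q T⁻)) small-D))
        (call (lift-level 21 7 k (update-run c⁻ q T⁻ s″))
        (recur (hafnian-run (suc k) m (update c⁻ q T⁻) s″)
        (call (lift-level 4 7 k (add-run _ (hafnian (suc k) m (update c⁻ q T⁻)) small-D))
        (call (lift-level 10 7 k (multiply-run g _ small-D small-D))
        (call (lift-level 14 7 k (remainder-run g c (a ∷ r) small-row))
        (call (lift-level 10 7 k (units-run (remainder g c (a ∷ r)) small-row))
        (call (weaken (pow-mono (n≤1+n (6 + level k)))
                (sum-run (2 + level k) {enc = termᵛ} 4≤ residual-run (units (remainder g c (a ∷ r)))
                  (subst Small (sym (length-units {ρ = ρ} (remainder g c (a ∷ r)))) small-row)))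
        (call (lift-level 4 7 k (add-run (multiply g _) _ small-D))
        (refl , eliminationCost (pow (7 + level k)) (suc m) (pow (8 + level k)) (straight-bound (7 + level k)))))))))))))))))
        where
        g  = proj₁ (pivot (a ∷ r))
        c  = proj₁ (proj₂ (pivot (a ∷ r)))
        p  = proj₂ (proj₂ (pivot (a ∷ r)))
        c⁻ = proj₂ (pick p c)
        q  = proj₁ (pull p T)
        T⁻ = proj₂ (pull p T)
        s′ : suc (suc m) ≤ Z
        s′ = pred< s
        s″ : suc m ≤ Z
        s″ = pred< s′
        small-row : Small (suc m)
        small-row = <⇒Small s′
        4≤ : 4 ≤ 2 + level k
        4≤ = ≤-trans (≤ᵇ⇒≤ 4 24 _) (≤-trans (24≤level k) (m≤n+m _ 2))

        self : Val (hafnianTy ⇒ polyTy)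
        self = closᵛ ρ hafnianᵇ

        module _ {a₁ a₂ a₃ a₄ a₅ a₆ : Ty} {u₁ : Val a₁} {u₂ : Val a₂} {u₃ : Val a₃}
                 {u₄ : Val a₄} {u₅ : Val a₅} {u₆ : Val a₆} {M : Val triTy} where

          environment : Env (a₁ ∷ a₂ ∷ a₃ ∷ a₄ ∷ a₅ ∷ a₆ ∷ triTy ∷ nat ∷ hafnianTy ∷ (hafnianTy ⇒ polyTy) ∷ Γ)
          environment = u₁ ∷ u₂ ∷ u₃ ∷ u₄ ∷ u₅ ∷ u₆ ∷ triᵛ T ∷ natᵛ k ∷
            pairᵛ (natᵛ (suc k)) (pairᵛ (polynomialᵛ 𝟘) M) ∷ self ∷ ρ

          correction-run : ∀ x → closᵛ environment correctionᵇ · weightedᵛ x ⇓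
            polynomialᵛ (scale (proj₁ x) (hafnian k m (proj₂ x))) within pow (2 + level k)
          correction-run (t , M) = straight (1 + level k)
            (call (weaken (*-pow (level k) s″) (hafnian-run k m M s″))
            (call (lift-level 6 1 k (scale-run t (hafnian k m M) small-D)) (refl , once)))

          residual-run : ∀ x → closᵛ environment residualᵇ · termᵛ x ⇓
            polynomialᵛ (multiply (proj₁ x) (hafnian k (suc (suc m)) (proj₂ x ∷ T))) within pow (2 + level k)
          residual-run (b , u) = straight (1 + level k)
            (call (weaken (*-pow (level k) s) (hafnian-run k (suc (suc m)) (u ∷ T) s))
            (call (lift-level 10 1 k (multiply-run b (hafnian k (suc (suc m)) (u ∷ T)) small-D small-D)) (refl , once)))

-- The whole algorithm and its polynomial bound

module AlgorithmRuns where

  open import Data.Bool.Base using (T)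
  open import Data.Fin.Base using (zero; suc)
  open import Data.Integer.Base as ℤ using (ℤ; 0ℤ; +_)
  import Data.Integer.Properties as ℤₚ
  open import Data.List.Base as List using (List; []; _∷_; _++_; map)
  open import Data.List.Relation.Unary.All using ([]; _∷_)
  open import Data.Nat.Base using (ℕ; zero; suc; _+_; _*_; _^_; _≤_; _≤ᵇ_; s≤s; >-nonZero)
  open import Data.Nat.Properties
  open import Data.Nat.Tactic.RingSolver using (solve-∀)
  open import Data.Product.Base using (Σ-syntax; _×_; _,_)
  open import Data.Vec.Base as Vec using (Vec; []; _∷_)
  open import Data.Vec.Properties using (tabulate-∘; tabulate-cong; map-const)
  open import Relation.Binary.PropositionalEquality using (_≡_; refl; sym; trans; cong; subst; subst₂)
  open import Defs
  open SquarefreeAlgebra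
  open MatchingSums
  open PowerSeries
  open TruncatedCoefficients
  open RunningTimes
  open Programs
  open BasicRuns
  open SubroutineRuns
  open HafnianRuns

  module AlgorithmRun {n N : ℕ} (A : 𝒮 n N) (Z : ℕ) (1000≤Z : 1000 ≤ Z)
    (m<Z : suc (2 * n) ≤ Z) (d<Z : suc (suc ((2 * n * (2 * n)) * suc N)) ≤ Z) where

    private
      m = 2 * n

    open Reduced A
    open Costs Z 1000≤Z
    open Runs Z 1000≤Z ((m * m) * suc N) d<Z
    open HafnianRun Z 1000≤Z ((m * m) * suc N) d<Z

    module _ {Γ : Cx} {ρ : Env Γ} where

      concat-run : ∀ {B : Set} {σ p q} {enc : B → Val σ} (V : Vec (Vec B q) p) → Small p → Small q →
        closᵛ ρ concatᵇ · listᵛ (values (λ v → listᵛ (values enc v)) V) ⇓ listᵛ (values enc (Vec.concat V)) within pow 8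
      concat-run {B} {σ} {q = q} {enc} V s s′ = loop 4 s (go V)
        where
        append-vec : ∀ {Γ} {ρ : Env Γ} {n} (v : Vec B q) (w : Vec B n) →
          closᵛ ρ appendᵇ · pairᵛ (listᵛ (values enc v)) (listᵛ (values enc w)) ⇓ listᵛ (values enc (v Vec.++ w)) within pow 4
        append-vec {ρ = ρ} v w = subst
          (λ us → closᵛ ρ appendᵇ · pairᵛ (listᵛ (values enc v)) (listᵛ (values enc w)) ⇓ listᵛ us within pow 4)
          (sym (values-++ enc v w)) (append-run (values enc v) (values enc w) (small-values v s′))
        go : ∀ {p} (V : Vec (Vec B q) p) →
          closᵛ ρ concatᵇ · listᵛ (values (λ v → listᵛ (values enc v)) V) ⇓ listᵛ (values enc (Vec.concat V))
            within loopCost (pow 4) p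
        go []      = verify (1≤pow 4) (refl , stop)
        go (v ∷ V) = verify (1≤pow 4) (recur (go V) (call (append-vec v (Vec.concat V)) (refl , again)))

      pad-run : ∀ {p q l} (V : Vec (Vec (Vec ℤ l) q) p) → Small p → Small q → Small l →
        closᵛ ρ padᵇ · pairᵛ (polynomialᵛ 𝟘) (listᵛ (values rowᵛ V)) ⇓
          listᵛ (values rowᵛ (Vec.map (Vec.map pad) V)) within pow 15
      pad-run V s s′ s″ = straight 14 (call
        (map-run 10 (small-values V s) (map-vec 10 (λ r → straight 9 (call
          (map-run 5 (small-values r s′) (map-vec 5 (λ v → straight 4 (call (add-run v 𝟘 s″) (refl , once))) r))
          (refl , once))) V))
        (refl , once))

      upper-run : ∀ {p} (V : Vec (Row p) p) → Small p →
        closᵛ ρ upperᵇ · listᵛ (values rowᵛ V) ⇓ triᵛ (upper p V) within pow 9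
      upper-run V s = loop 5 s (go V s)
        where
        go : ∀ {p} (V : Vec (Row p) p) → Small p →
          closᵛ ρ upperᵇ · listᵛ (values rowᵛ V) ⇓ triᵛ (upper p V) within loopCost (pow 5) p
        go []            s = verify (1≤pow 5) (refl , stop)
        go ((a ∷ r) ∷ V) s = verify (1≤pow 5)
          (call (lift 1 (tail-run polynomialᵛ (a ∷ r)))
          (call (map-run 1 (small-values V (small-pred s)) (map-vec 1 (tail-run polynomialᵛ) V))
          (recur (go (Vec.map Vec.tail V) (small-pred s)) (refl , again))))

      zero-run : ∀ {p} (v : Vec ℤ p) → Small p →
        closᵛ ρ mapᵇ · pairᵛ (closᵛ {σ = int} ρ (lit 0ℤ)) (polynomialᵛ v) ⇓ polynomialᵛ (zeroᵛ p) within pow 5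
      zero-run {p} v s = subst (λ w → closᵛ ρ mapᵇ · pairᵛ (closᵛ ρ (lit 0ℤ)) (polynomialᵛ v) ⇓ polynomialᵛ w within pow 5)
        (map-const v 0ℤ)
        (map-run 1 (small-values v s) (map-vec 1 (λ _ → straight 0 (refl , once)) v))

    entries : Vec (Vec (Vec ℤ (suc N)) m) m
    entries = Vec.tabulate (λ i → Vec.tabulate (𝒮.entry A i))

    padded≡ : Vec.map (Vec.map pad) entries ≡ Vec.tabulate (λ i → Vec.tabulate (paddedEntry i))
    padded≡ = trans (sym (tabulate-∘ (Vec.map pad) (λ i → Vec.tabulate (𝒮.entry A i))))
                    (tabulate-cong (λ i → sym (tabulate-∘ pad (𝒮.entry A i))))

    matrixᵛ≡ : matrixᵛ A ≡ listᵛ (values rowᵛ entries)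
    matrixᵛ≡ = cong listᵛ (values-tabulate m rowᵛ _ _
      (λ i → cong listᵛ (values-tabulate m polynomialᵛ _ _ (λ j → cong listᵛ (values-toList intᵛ (𝒮.entry A i j))))))

    polyᵛ≡ : ∀ k → polyᵛ (Vec.toList (reduced k)) ≡ polynomialᵛ (reduced k)
    polyᵛ≡ k = cong listᵛ (values-toList intᵛ (reduced k))

    private
      ≤d : ∀ {a} → a ≤ (m * m) * suc N → Small a
      ≤d p = <⇒Small (≤-trans (s≤s p) (≤-trans (n≤1+n _) d<Z))

    small-m : Small m
    small-m = <⇒Small m<Z

    algorithm-wp : ∀ k → 1 ≤ n → wp (pow (1 + level k)) (listᵛ (values rowᵛ entries) ∷ natᵛ k ∷ []) algorithm 0 0
      (Returns (pow (1 + level k)) (polynomialᵛ (reduced k)) (straightCost (pow (1 + level k))))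
    algorithm-wp k 1≤n =
      call (lift-level 8 1 k (concat-run entries small-m small-m))
      (call (lift-level 8 1 k (concat-run (Vec.concat entries) (≤d (m≤m*n (m * m) (suc N))) small-N))
      (call (lift-level 5 1 k (zero-run (Vec.concat (Vec.concat entries)) (≤d ≤-refl)))
      (call (lift-level 15 1 k (pad-run entries small-m small-m small-N))
      (call (lift-level 9 1 k upper-padded)
      (call (weaken (*-pow (level k) m<Z) (hafnian-run k m (toTri m paddedEntry) m<Z))
      (call (lift-level 5 1 k (map-run 1 (small-values (hafnian k m (toTri m paddedEntry)) small-D)
              (map-vec 1 (λ _ → straight 0 (refl , once)) (hafnian k m (toTri m paddedEntry)))))
      (refl , once)))))))
      where
      small-N : Small (suc N)
      small-N = ≤d (m≤n*m (suc N) (m * m) {{>-nonZero (*-mono-≤ 1≤m 1≤m)}})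
        where
        1≤m : 1 ≤ m
        1≤m = ≤-trans 1≤n (m≤m+n n _)
      upper-padded : ∀ {Γ} {ρ : Env Γ} → closᵛ ρ upperᵇ · listᵛ (values rowᵛ (Vec.map (Vec.map pad) entries)) ⇓
                     triᵛ (toTri m paddedEntry) within pow 9
      upper-padded {ρ = ρ} = subst (λ M → closᵛ ρ upperᵇ · listᵛ (values rowᵛ (Vec.map (Vec.map pad) entries)) ⇓ triᵛ M within pow 9)
        (trans (cong (upper m) padded≡) (upper-tabulate m paddedEntry))
        (upper-run (Vec.map (Vec.map pad) entries) small-m)

    level≡ : ∀ k → level k ≡ 24 + 8 * k
    level≡ zero    = refl
    level≡ (suc k) = trans (cong (_+_ 8) (level≡ k)) (lemma k)
      where
      lemma : ∀ k → 8 + (24 + 8 * k) ≡ 24 + 8 * (1 + k)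
      lemma = solve-∀

    -- The exponent is `26 + 8k`. As the final bound must be a pure `k`-th power, the constant 26
    -- goes into the base, which for `k ≥ 1` gives `26 + 8 = 34`.
    level-≤ : ∀ {k} → 1 ≤ k → 2 + level k ≤ 34 * k
    level-≤ {suc k} _ = begin
      2 + level (suc k)        ≡⟨ cong (_+_ 2) (level≡ (suc k)) ⟩
      2 + (24 + 8 * suc k)     ≤⟨ m≤m+n _ (26 * k) ⟩
      2 + (24 + 8 * suc k) + 26 * k ≡⟨ lemma k ⟩
      34 * suc k               ∎
      where
      open ≤-Reasoning
      lemma : ∀ k → 2 + (24 + 8 * (1 + k)) + 26 * k ≡ 34 * (1 + k)
      lemma = solve-∀

    time-bound : ∀ k → 1 ≤ k → straightCost (pow (1 + level k)) ≤ (Z ^ 34) ^ k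
    time-bound k 1≤k = begin
      straightCost (pow (1 + level k)) ≤⟨ straight-bound (1 + level k) ⟩
      pow (2 + level k)                ≤⟨ pow-mono (level-≤ 1≤k) ⟩
      pow (34 * k)                     ≡⟨ pow≡ (34 * k) ⟩
      Z ^ (34 * k)                     ≡⟨ sym (^-*-assoc Z 34 k) ⟩
      (Z ^ 34) ^ k                     ∎
      where open ≤-Reasoning

    algorithm-run : ∀ k → 1 ≤ n → 1 ≤ k →
      Σ[ t ∈ ℕ ] (RunsIn algorithm A k (Vec.toList (reduced k)) t × t ≤ (Z ^ 34) ^ k)
    algorithm-run k 1≤n 1≤k =
      let (t , r , t≤) = evaluates (1≤pow (1 + level k)) algorithm (algorithm-wp k 1≤n)
      in t ,
         runsIn (subst₂ (λ M p → (M ∷ natᵛ k ∷ []) ⊢ algorithm ⇓ p [ t ]) (sym matrixᵛ≡) (sym (polyᵛ≡ k)) r) ,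
         ≤-trans t≤ (time-bound k 1≤k)

  -- The zero coefficient `z` is a parameter, so that the same definition serves for both variables
  -- of a bivariate polynomial.
  monomial : ∀ {A : Set} → A → ℕ → A → List A
  monomial z e a = List.replicate e z ++ a ∷ []

  eval-monomial : ∀ e a x → evalᵖ (monomial 0ℤ e (+ a)) (+ x) ≡ + (x ^ e * a)
  eval-monomial zero    a x = trans (cong (λ y → + a ℤ.+ y) (ℤₚ.*-zeroʳ (+ x)))
                                (trans (ℤₚ.+-identityʳ (+ a)) (cong +_ (sym (*-identityˡ a))))
  eval-monomial (suc e) a x = trans (ℤₚ.+-identityˡ _)
    (trans (cong (+ x ℤ.*_) (eval-monomial e a x))
    (trans (sym (ℤₚ.pos-* x (x ^ e * a))) (cong +_ (sym (*-assoc x (x ^ e) a)))))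

  map-monomial : ∀ {A B : Set} (f : A → B) z e a → map f (monomial z e a) ≡ monomial (f z) e (f a)
  map-monomial f z zero    a = refl
  map-monomial f z (suc e) a = cong (f z ∷_) (map-monomial f z e a)

  pos-^ : ∀ a k → + (a ^ k) ≡ (+ a) ℤ.^ k
  pos-^ a zero    = refl
  pos-^ a (suc k) = trans (ℤₚ.pos-* a (a ^ k)) (cong (+ a ℤ.*_) (pos-^ a k))

  -- (c n² N)ᵉ
  bound : ℕ → ℕ → Poly₂
  bound c e = monomial [] (e + e) (monomial 0ℤ e (+ (c ^ e)))

  *-^ : ∀ a b e → (a * b) ^ e ≡ a ^ e * b ^ e
  *-^ a b zero    = refl
  *-^ a b (suc e) = trans (cong (a * b *_) (*-^ a b e)) ([m*n]*[o*p]≡[m*o]*[n*p] a b (a ^ e) (b ^ e))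

  eval-bound : ∀ c e n N → evalᵖ₂ (bound c e) (+ n) (+ N) ≡ + ((c * (n * n * N)) ^ e)
  eval-bound c e n N = trans (cong (λ p → evalᵖ p (+ n)) (trans (map-monomial (λ q → evalᵖ q (+ N)) [] (e + e) _)
                         (cong (monomial 0ℤ (e + e)) (eval-monomial e (c ^ e) N))))
    (trans (eval-monomial (e + e) (N ^ e * c ^ e) n) (cong +_ (begin
      n ^ (e + e) * (N ^ e * c ^ e)    ≡⟨ cong (_* (N ^ e * c ^ e)) (trans (^-distribˡ-+-* n e e) (sym (*-^ n n e))) ⟩
      (n * n) ^ e * (N ^ e * c ^ e)    ≡⟨ sym (*-assoc ((n * n) ^ e) (N ^ e) (c ^ e)) ⟩
      (n * n) ^ e * N ^ e * c ^ e      ≡⟨ cong (_* c ^ e) (sym (*-^ (n * n) N e)) ⟩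
      (n * n * N) ^ e * c ^ e          ≡⟨ *-comm ((n * n * N) ^ e) (c ^ e) ⟩
      c ^ e * (n * n * N) ^ e          ≡⟨ sym (*-^ c (n * n * N) e) ⟩
      (c * (n * n * N)) ^ e            ∎)))
    where
    open import Relation.Binary.PropositionalEquality using (module ≡-Reasoning)
    open ≡-Reasoning

  abstract
    -- Opaque, so that the 34th power of 1000 is never evaluated.
    factor : ℕ
    factor = 1000

    1000≤factor : 1000 ≤ factor
    1000≤factor = ≤-refl

  module Sizes {n N : ℕ} (1≤n : 1 ≤ n) (1≤N : 1 ≤ N) where
    private
      W = n * n * N
      1≤W : 1 ≤ W
      1≤W = *-mono-≤ (*-mono-≤ 1≤n 1≤n) 1≤N
      multiple : ∀ a {x} → x ≤ a * W → {_ : T (a ≤ᵇ 1000)} → x ≤ factor * W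
      multiple a p {a≤} = ≤-trans p (*-monoˡ-≤ W (≤-trans (≤ᵇ⇒≤ a 1000 a≤) 1000≤factor))

    1000≤Z : 1000 ≤ factor * W
    1000≤Z = ≤-trans 1000≤factor (≤-trans (≤-reflexive (sym (*-identityʳ factor))) (*-monoʳ-≤ factor 1≤W))

    m<Z : suc (2 * n) ≤ factor * W
    m<Z = multiple 3 (+-mono-≤ 1≤W (*-monoʳ-≤ 2
      (≤-trans (≤-reflexive (sym (trans (*-identityʳ (n * 1)) (*-identityʳ n)))) (*-mono-≤ (*-monoʳ-≤ n 1≤n) 1≤N))))

    -- From `1 ≤ n²N` and `N + 1 ≤ 2N` the left side is at most `2n²N + 8n²N`, hence the multiple
    -- 10.
    d<Z : suc (suc ((2 * n * (2 * n)) * suc N)) ≤ factor * W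
    d<Z = multiple 10 (begin
      2 + (2 * n * (2 * n)) * suc N   ≤⟨ +-mono-≤ (*-monoʳ-≤ 2 1≤W) (*-monoʳ-≤ (2 * n * (2 * n)) (+-monoˡ-≤ N 1≤N)) ⟩
      2 * W + (2 * n * (2 * n)) * (N + N) ≡⟨ lemma n N ⟩
      10 * W                         ∎)
      where
      open ≤-Reasoning
      lemma : ∀ n N → 2 * (n * n * N) + (2 * n * (2 * n)) * (N + N) ≡ 10 * (n * n * N)
      lemma = solve-∀

  algorithm-correct : ∀ {n N} (A : 𝒮 n N) k → 1 ≤ n → 1 ≤ N → 1 ≤ k →
    Σ[ p ∈ Poly ] Σ[ t ∈ ℕ ]
      (RunsIn algorithm A k p t × p ≈ᵖ haf₂^ k A × + t ℤ.≤ + 1 ℤ.* (evalᵖ₂ (bound factor 34) (+ n) (+ N) ℤ.^ k))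
  algorithm-correct {n} {N} A k 1≤n 1≤N 1≤k =
    let open Sizes 1≤n 1≤N
        (t , run , t≤) = AlgorithmRun.algorithm-run A (factor * (n * n * N)) 1000≤Z m<Z d<Z k 1≤n 1≤k
    in Vec.toList (Reduced.reduced A k) , t , run , Reduced.reduced-correct A k ,
       subst (+ t ℤ.≤_)
         (trans (pos-^ ((factor * (n * n * N)) ^ 34) k)
           (trans (cong (ℤ._^ k) (sym (eval-bound factor 34 n N))) (sym (ℤₚ.*-identityˡ _))))
         (ℤ.+≤+ t≤)

open import Defs
open import Data.Nat.Base using (ℕ; _≥_)
open import Data.Integer.Base using (+_; _≤_; _*_) renaming (_^_ to _^ᶻ_)
open import Data.Product.Base using (Σ-syntax; _×_; _,_)
open AlgorithmRuns using (bound; factor; algorithm-correct)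
open Programs using (algorithm)

theorem2p1 : Σ[ f ∈ Poly₂ ] Σ[ P ∈ Algorithm ] Σ[ C ∈ ℕ ]
    ((n N k : ℕ) → n ≥ 1 → N ≥ 1 → k ≥ 1 → (A : 𝒮 n N) →
    Σ[ p ∈ Poly ] Σ[ t ∈ ℕ ]
    (RunsIn P A k p t
    × p ≈ᵖ haf₂^ k A
    × + t ≤ + C * (evalᵖ₂ f (+ n) (+ N) ^ᶻ k)))
theorem2p1 = bound factor 34 , algorithm , 1 , λ n N k 1≤n 1≤N 1≤k A →
  algorithm-correct A k 1≤n 1≤N 1≤k
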